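{- For every $\tau\in\mathbb{H}^2$, $$\theta[\tfrac15;\tfrac15]^5-\theta[\tfrac15;\tfrac35]^5+\theta[\tfrac15;1]^5-\theta[\tfrac15;\tfrac75]^5+\theta[\tfrac15;\tfrac95]^5=0,$$ and $$\theta[\tfrac35;\tfrac15]^5-\theta[\tfrac35;\tfrac35]^5+\theta[\tfrac35;1]^5-\theta[\tfrac35;\tfrac75]^5+\theta[\tfrac35;\tfrac95]^5=0.$$
   Context: Let $\mathbb{H}^2=\{\tau\in\mathbb{C}:\Im\tau>0\}$. For a characteristic $(\epsilon,\epsilon')\in\mathbb{R}^2$, the theta function with characteristic is $$\theta[\epsilon;\epsilon'](\zeta,\tau)=\sum_{n\in\mathbb{Z}}\exp\Big(2\pi i\Big[\tfrac12\big(n+\tfrac{\epsilon}{2}\big)^2\tau+\big(n+\tfrac{\epsilon}{2}\big)\big(\zeta+\tfrac{\epsilon'}{2}\big)\Big]\Big),\quad (\zeta,\tau)\in\mathbb{C}\times\mathbb{H}^2,$$ (usually written with the column $\left[\begin{smallmatrix}\epsilon\\ \epsilon'\end{smallmatrix}\right]$), and the theta constant is $\theta[\epsilon;\epsilon']=\theta[\epsilon;\epsilon'](0,\tau)$, regarded as a function of $\tau$. Here $\theta[\epsilon;\epsilon']^5$ denotes the fifth power of the theta constant. -}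

module Defs where

open import Algebra.Apartness.Bundles using (HeytingField; HeytingCommutativeRing)
open import Algebra.Bundles using (CommutativeRing)
open import Algebra.Bundles.Raw using (RawRing)
import Algebra.Definitions.RawSemiring as RawSemiringDefs
import Algebra.Properties.Ring as RingProperties
open import Data.Empty using (⊥-elim)
open import Data.Fin.Base using (toℕ)
open import Data.Integer.Base using (ℤ; +_; -[1+_])
open import Data.Nat.Base using (ℕ; zero; suc; NonZero; _!) renaming (_≤_ to _≤ℕ_)
open import Data.Nat.Properties using (_!≢0)
open import Data.Product.Base using (_×_; _,_; proj₁; Σ-syntax; ∃-syntax)
open import Data.Sum.Base using (_⊎_; inj₁; inj₂)
open import Function.Bundles using (_⇔_; module Equivalence)
open import Level using (Level; _⊔_) renaming (suc to lsuc)
open import Relation.Binary.Core using (Rel)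
open import Relation.Binary.Structures using (IsStrictPartialOrder)
open import Relation.Nullary.Negation using (¬_)

-- The real numbers, characterised (up to isomorphism) as a Cauchy-complete
-- Archimedean ordered field.  The order axioms are the constructive ones, so
-- that both the Bishop reals and, classically, the usual reals are instances.
-- 0# < 1#, and x < y → x < z ⊎ z < y, follow from the corresponding
-- facts about _#_.

record RealNumbers (c ℓ₁ ℓ₂ ℓ₃ : Level) : Set (lsuc (c ⊔ ℓ₁ ⊔ ℓ₂ ⊔ ℓ₃)) where
  infix 4 _<_

  field
    heytingField : HeytingField c ℓ₁ ℓ₂

  open HeytingField heytingField public
    hiding (zero) renaming (Carrier to ℝ)

  commutativeRing : CommutativeRing c ℓ₁
  commutativeRing = HeytingCommutativeRing.commutativeRing heytingCommutativeRing

  open CommutativeRing commutativeRing public using (rawRing; ring)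
  open RawSemiringDefs (RawRing.rawSemiring rawRing) public using () renaming (_×_ to _·_)

  field
    _<_                  : Rel ℝ ℓ₃
    isStrictPartialOrder : IsStrictPartialOrder _≈_ _<_
    #⇔<⊎>                : ∀ x y → x # y ⇔ (x < y ⊎ y < x)
    +-monoˡ-<            : ∀ z {x y} → x < y → x + z < y + z
    *-positive           : ∀ {x y} → 0# < x → 0# < y → 0# < x * y
    archimedean          : ∀ x → ∃[ n ] x < n · 1#

  Cauchy : (ℕ → ℝ) → Set (c ⊔ ℓ₃)
  Cauchy s = ∀ δ → 0# < δ → ∃[ N ] ∀ m n → N ≤ℕ m → N ≤ℕ n →
    (- δ < s m - s n) × (s m - s n < δ)

  Converges : (ℕ → ℝ) → ℝ → Set (c ⊔ ℓ₃)
  Converges s x = ∀ δ → 0# < δ → ∃[ N ] ∀ n → N ≤ℕ n →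
    (- δ < s n - x) × (s n - x < δ)

  field
    complete : ∀ s → Cauchy s → ∃[ x ] Converges s x

module Fractions {c ℓ₁ ℓ₂ ℓ₃} (R : RealNumbers c ℓ₁ ℓ₂ ℓ₃) where
  open RealNumbers R
  open IsStrictPartialOrder isStrictPartialOrder
    using (<-respʳ-≈; <-respˡ-≈) renaming (trans to <-trans; irrefl to <-irrefl)
  open RingProperties ring using (-‿distribˡ-*; -‿distribʳ-*; -‿involutive)

  0<1 : 0# < 1#
  0<1 with Equivalence.to (#⇔<⊎> 1# 0#) 1#0
    where
    1-0≈1 : 1# - 0# ≈ 1#
    1-0≈1 = trans (+-congˡ (trans (sym (+-identityˡ (- 0#))) (-‿inverseʳ 0#)))
                  (+-identityʳ 1#)
    1#0 : 1# # 0#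
    1#0 = invertible⇒# (1# , trans (*-identityˡ _) 1-0≈1
                           , trans (*-identityʳ _) 1-0≈1)
  ... | inj₂ 0<1 = 0<1
  ... | inj₁ 1<0 = ⊥-elim (<-irrefl refl (<-trans 1<0 0<1′))
    where
    0<-1 : 0# < - 1#
    0<-1 = <-respˡ-≈ (-‿inverseʳ 1#)
             (<-respʳ-≈ (+-identityˡ (- 1#)) (+-monoˡ-< (- 1#) 1<0))
    0<1′ : 0# < 1#
    0<1′ = <-respʳ-≈
      (trans (sym (-‿distribˡ-* 1# (- 1#)))
        (trans (-‿cong (*-identityˡ (- 1#))) (-‿involutive 1#)))
      (*-positive 0<-1 0<-1)

  suc-positive : ∀ n → 0# < suc n · 1#
  suc-positive zero    = <-respʳ-≈ (sym (+-identityʳ 1#)) 0<1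
  suc-positive (suc n) = <-trans (suc-positive n)
    (<-respˡ-≈ (+-identityˡ _) (+-monoˡ-< (suc n · 1#) 0<1))

  -- #⇒invertible inverts the difference n · 1# - 0#.
  recip : (n : ℕ) .{{_ : NonZero n}} → ℝ
  recip (suc n) =
    proj₁ (#⇒invertible (Equivalence.from (#⇔<⊎> (suc n · 1#) 0#)
                                          (inj₂ (suc-positive n))))

  fromℤ : ℤ → ℝ
  fromℤ (+ n)    = n · 1#
  fromℤ -[1+ n ] = - (suc n · 1#)

  infix 8 _//_
  _//_ : (m n : ℕ) .{{_ : NonZero n}} → ℝ
  m // n = m · 1# * recip n

module Complex {c ℓ₁ ℓ₂ ℓ₃} (R : RealNumbers c ℓ₁ ℓ₂ ℓ₃) where
  open RealNumbers R
  open Fractions R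

  infix  4 _≈ℂ_
  infixl 6 _+ℂ_ _-ℂ_
  infixl 7 _*ℂ_
  infix  8 -ℂ_

  record ℂ : Set c where
    constructor _+i_
    field
      re im : ℝ
  open ℂ public

  _≈ℂ_ : Rel ℂ ℓ₁
  z ≈ℂ w = (re z ≈ re w) × (im z ≈ im w)

  _+ℂ_ _*ℂ_ : ℂ → ℂ → ℂ
  (a +i b) +ℂ (a′ +i b′) = (a + a′) +i (b + b′)
  (a +i b) *ℂ (a′ +i b′) = (a * a′ - b * b′) +i (a * b′ + b * a′)

  -ℂ_ : ℂ → ℂ
  -ℂ_ (a +i b) = (- a) +i (- b)

  _-ℂ_ : ℂ → ℂ → ℂ
  z -ℂ w = z +ℂ (-ℂ w)

  ↑_ : ℝ → ℂ
  ↑ x = x +i 0#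

  0ℂ 1ℂ 𝕚 : ℂ
  0ℂ = ↑ 0#
  1ℂ = ↑ 1#
  𝕚  = 0# +i 1#

  ℂ-rawRing : RawRing c ℓ₁
  ℂ-rawRing = record
    { Carrier = ℂ ; _≈_ = _≈ℂ_ ; _+_ = _+ℂ_ ; _*_ = _*ℂ_
    ; -_ = -ℂ_ ; 0# = 0ℂ ; 1# = 1ℂ }

  open RawSemiringDefs (RawRing.rawSemiring ℂ-rawRing) public using (_^_; sum)

  ∣_∣² : ℂ → ℝ
  ∣ z ∣² = re z * re z + im z * im z

  -- For 0# < δ this is ∣ z - w ∣ < δ.
  Within : ℝ → ℂ → ℂ → Set ℓ₃
  Within δ z w = ∣ z -ℂ w ∣² < δ * δ

  HasSumℕ : (ℕ → ℂ) → ℂ → Set (c ⊔ ℓ₃)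
  HasSumℕ a s = ∀ δ → 0# < δ → ∃[ N ] ∀ n → N ≤ℕ n →
    Within δ (sum {n} (λ k → a (toℕ k))) s

  -- a₋ₘ + … + a₋₁ + a₀ + … + aₙ
  partialSumℤ : (ℤ → ℂ) → ℕ → ℕ → ℂ
  partialSumℤ a m n =
    sum {m} (λ k → a -[1+ toℕ k ]) +ℂ sum {suc n} (λ k → a (+ toℕ k))

  -- The two ends of a doubly infinite series tend to infinity independently.
  HasSumℤ : (ℤ → ℂ) → ℂ → Set (c ⊔ ℓ₃)
  HasSumℤ a s = ∀ δ → 0# < δ → ∃[ N ] ∀ m n → N ≤ℕ m → N ≤ℕ n →
    Within δ (partialSumℤ a m n) s

  -- The graphs of exp and sin.  Values are unique up to _≈ℂ_, resp. _≈_.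
  IsExp : ℂ → ℂ → Set (c ⊔ ℓ₃)
  IsExp z w = HasSumℕ (λ n → ↑ (recip (n !) {{n !≢0}}) *ℂ z ^ n) w

  IsSin : ℝ → ℝ → Set (c ⊔ ℓ₃)
  IsSin x s = Σ[ cosx ∈ ℝ ] IsExp (𝕚 *ℂ ↑ x) (cosx +i s)

  -- π is the least positive zero of sin.
  IsPi : ℝ → Set (c ⊔ ℓ₃)
  IsPi π = 0# < π × IsSin π 0# × (∀ x → 0# < x → x < π → ¬ IsSin x 0#)

module Theta {c ℓ₁ ℓ₂ ℓ₃} (R : RealNumbers c ℓ₁ ℓ₂ ℓ₃) where
  open RealNumbers R public using (ℝ)
  open RealNumbers R hiding (ℝ)
  open Fractions R public using (_//_)
  open Fractions R hiding (_//_)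
  open Complex R public

  record ℍ² : Set (c ⊔ ℓ₃) where
    constructor _,ℍ_
    field
      point    : ℂ
      positive : 0# < im point
  open ℍ² public

  -- 2πi [ ½ (n + ε/2)² τ + (n + ε/2) (ζ + ε′/2) ]
  exponent : (π ε ε′ : ℝ) (ζ : ℂ) (τ : ℍ²) (n : ℤ) → ℂ
  exponent π ε ε′ ζ τ n =
    ↑ ((2 // 1) * π) *ℂ 𝕚 *ℂ
      (↑ (1 // 2) *ℂ (↑ (fromℤ n + ε * (1 // 2))) ^ 2 *ℂ point τ
        +ℂ ↑ (fromℤ n + ε * (1 // 2)) *ℂ (ζ +ℂ ↑ (ε′ * (1 // 2))))

  -- The graph of (ζ , τ) ↦ θ[ε;ε′](ζ,τ); here e n is the value of exp at the
  -- n-th exponent.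
  IsTheta : (π ε ε′ : ℝ) (ζ : ℂ) (τ : ℍ²) → ℂ → Set (c ⊔ ℓ₃)
  IsTheta π ε ε′ ζ τ t = Σ[ e ∈ (ℤ → ℂ) ]
    (∀ n → IsExp (exponent π ε ε′ ζ τ n) (e n)) × HasSumℤ e t

  -- Unique up to pointwise _≈ℂ_.  That it is inhabited is the convergence of
  -- the theta series.
  record ThetaFunction (π : ℝ) : Set (c ⊔ ℓ₃) where
    field
      θ       : (ε ε′ : ℝ) (ζ : ℂ) (τ : ℍ²) → ℂ
      isTheta : ∀ ε ε′ ζ τ → IsTheta π ε ε′ ζ τ (θ ε ε′ ζ τ)

    θ[_⨾_] : (ε ε′ : ℝ) → ℍ² → ℂ
    θ[ ε ⨾ ε′ ] τ = θ ε ε′ 0ℂ τ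

{-# OPTIONS --safe #-}
module Submission where

-- Put x = n + ε / 2 for n ∈ ℤ⁵ (coordinatewise), X = 2 (x₁ + … + x₅), an odd integer, and ω = exp (πi / 10).
-- Multiplying out the fifth powers, the alternating sum over ε′ = (2k + 1) / 5 turns into the sum over n of
-- exp (πiτ |x|²) Σₖ (-1)ᵏ ω^((2k + 1) X).  The inner sum vanishes unless 5 divides X, because ω⁴ is a nontrivial
-- fifth root of unity.  If 5 divides X, then reflecting x in the hyperplane X = 0 subtracts the integer X / 5 from
-- every coordinate, so it permutes these terms; it preserves |x|² and changes the sign of the inner sum since X is odd.
-- This is applied to the partial sums over the boxes [-L , L]⁵: the terms whose reflections are in the box cancel,
-- and each of the at most (2L + 1)⁵ others is O(exp (-π L² Im τ)).
--
-- All estimates use the relations x ≤ y = ¬ y < x and z ⊑ b, meaning ∥ z ∥ ≤ b.  They are stable under double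
-- negation, so trichotomy may be used to prove them although the order is constructive.

open import Defs
open import Algebra.Bundles using (CommutativeRing)
open import Algebra.Bundles.Raw using (RawRing)
import Algebra.Definitions.RawSemiring as RawSemiringDefs
import Algebra.Properties.AbelianGroup as AbelianGroupProperties
import Algebra.Properties.Ring as RingProperties
import Algebra.Properties.Semiring.Exp as SemiringExp
import Algebra.Properties.Semiring.Mult as SemiringMult
import Algebra.Properties.Semiring.Mult.TCOptimised as SemiringMultTC
import Algebra.Solver.Ring as RingSolver
open import Algebra.Solver.Ring.AlmostCommutativeRing using (fromCommutativeRing; _-Raw-AlmostCommutative⟶_)
open import Data.Empty using (⊥; ⊥-elim)
open import Data.Fin.Base using (toℕ)
open import Data.Integer.Base as ℤ using (ℤ; +_; -[1+_])
import Data.Integer.DivMod as ℤDivMod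
import Data.Integer.Properties as ℤₚ
open import Data.Integer.Solver using (module +-*-Solver)
open import Data.List.Base using (List; []; _∷_; _++_; applyUpTo; length)
open import Data.List.Membership.Propositional using (_∈_)
open import Data.List.Membership.Propositional.Properties using (∈-applyUpTo⁺; ∈-applyUpTo⁻; ∈-++⁺ˡ; ∈-++⁺ʳ)
import Data.List.Properties as Listₚ
open import Data.List.Relation.Unary.All as All using (All; []; _∷_)
open import Data.List.Relation.Unary.AllPairs using ([]; _∷_)
open import Data.List.Relation.Unary.Any using (Any; here; there)
open import Data.List.Relation.Unary.Unique.Propositional using (Unique)
import Data.List.Relation.Unary.Unique.Propositional.Properties as Uniqueₚ
open import Data.Maybe.Base using (Maybe; just; nothing)
open import Data.Nat.Base as ℕ using (ℕ; zero; suc; NonZero; nonZero; _!)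
import Data.Nat.Properties as ℕₚ
open import Data.Product.Base using (_×_; _,_; proj₁; proj₂; ∃-syntax)
open import Data.Sum.Base using (_⊎_; inj₁; inj₂)
open import Data.Vec.Base as Vec using (Vec; []; _∷_)
open import Data.Vec.Relation.Binary.Pointwise.Inductive as Pointwise using (Pointwise; []; _∷_)
open import Data.Vec.Relation.Unary.Any as VecAny using (here; there)
open import Function.Base using (_∘_)
open import Function.Bundles using (module Equivalence)
open import Level using (Level; _⊔_) renaming (suc to lsuc)
import Relation.Binary.PropositionalEquality as ≡
open ≡ using (_≡_)
import Relation.Binary.Reasoning.Base.Triple as TripleReasoning
import Relation.Binary.Reasoning.Setoid as SetoidReasoning
open import Relation.Binary.Structures using (IsStrictPartialOrder; IsPreorder)
open import Relation.Nullary using (¬_; Dec; yes; no)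

-- The statement supplies exp only through its power series and π only as the least positive zero of
-- sin. So the addition formula is derived from Cauchy products, the modulus of exp z from complex
-- conjugation, and exp (iπ) = -1 from the half-angle formulas. The only growth estimate obtained is
-- 1 + x ≤ exp x for x ≥ 0. It bounds a Gaussian term by 1 / (1 + κ L²) alone, which does not beat
-- the (2L + 1)⁵ points of the box. The exponent is therefore cut into three equal parts, and the
-- cube of that bound is O(L⁻⁶).
--
-- The reflection is defined on part of the lattice and does not preserve the box. Instead of
-- describing the subset on which it acts as an involution, one sums over all pairs (v , w) of
-- points of the box, weighted by the indicator that w is the reflection of v. The weighted summand
-- is antisymmetric, so the double sum equals its own negative. Summing over w first multiplies each
-- term by 0 or 1, and the terms multiplied by 0 form the remainder.
--
-- The theorem also asserts that theta functions exist, for all ε, ε′, ζ and τ. There the linear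
-- part of the exponent is absorbed by completing the square.

-- Ring solving with integer coefficients over an arbitrary commutative ring.

module IntegerCoefficients {c ℓ} (R : CommutativeRing c ℓ) where
  open CommutativeRing R
  open RingProperties ring using (-‿distribˡ-*; -‿distribʳ-*; -‿involutive; -0#≈0#)
  open AbelianGroupProperties +-abelianGroup using (⁻¹-∙-comm)
  open SemiringMultTC semiring using (×-homo-+; 1+×; ×1-homo-*) renaming (_×_ to _×′_)
  open SetoidReasoning setoid

  ι : ℤ → Carrier
  ι (+ n)    = n ×′ 1#
  ι -[1+ n ] = - (suc n ×′ 1#)

  ι-neg : ∀ i → ι (ℤ.- i) ≈ - ι i
  ι-neg (+ zero)  = sym -0#≈0#
  ι-neg (+ suc n) = refl
  ι-neg -[1+ n ]  = sym (-‿involutive _)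

  ι-⊖ : ∀ m n → ι (m ℤ.⊖ n) ≈ m ×′ 1# - n ×′ 1#
  ι-⊖ zero zero = sym (-‿inverseʳ 0#)
  ι-⊖ zero (suc n) = sym (+-identityˡ _)
  ι-⊖ (suc m) zero = sym (trans (+-congˡ -0#≈0#) (+-identityʳ _))
  ι-⊖ (suc m) (suc n) = begin
    ι (suc m ℤ.⊖ suc n)                 ≡⟨ ≡.cong ι (ℤₚ.[1+m]⊖[1+n]≡m⊖n m n) ⟩
    ι (m ℤ.⊖ n)                         ≈⟨ ι-⊖ m n ⟩
    a - b                               ≈⟨ +-congˡ (+-identityˡ _) ⟨
    a + (0# - b)                        ≈⟨ +-congˡ (+-congʳ (-‿inverseʳ 1#)) ⟨
    a + ((1# - 1#) - b)                 ≈⟨ +-congˡ (+-assoc _ _ _) ⟩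
    a + (1# + (- 1# - b))               ≈⟨ +-assoc _ _ _ ⟨
    (a + 1#) + (- 1# - b)               ≈⟨ +-cong (+-comm _ _) (⁻¹-∙-comm _ _) ⟩
    (1# + a) - (1# + b)                 ≈⟨ +-cong (1+× m 1#) (-‿cong (1+× n 1#)) ⟨
    suc m ×′ 1# - suc n ×′ 1#             ∎
    where a = m ×′ 1# ; b = n ×′ 1#

  ι-+ : ∀ i j → ι (i ℤ.+ j) ≈ ι i + ι j
  ι-+ (+ m)    (+ n)    = ×-homo-+ 1# m n
  ι-+ (+ m)    -[1+ n ] = ι-⊖ m (suc n)
  ι-+ -[1+ m ] (+ n)    = trans (ι-⊖ n (suc m)) (+-comm _ _)
  ι-+ -[1+ m ] -[1+ n ] = begin
    - (suc (suc (m ℕ.+ n)) ×′ 1#)    ≡⟨ ≡.cong (λ k → - (suc k ×′ 1#)) (≡.sym (ℕₚ.+-suc m n)) ⟩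
    - ((suc m ℕ.+ suc n) ×′ 1#)      ≈⟨ -‿cong (×-homo-+ 1# (suc m) (suc n)) ⟩
    - (suc m ×′ 1# + suc n ×′ 1#)     ≈⟨ ⁻¹-∙-comm _ _ ⟨
    - (suc m ×′ 1#) - (suc n ×′ 1#)   ∎

  private
    ι-+* : ∀ m j → ι (+ m ℤ.* j) ≈ ι (+ m) * ι j
    ι-+* m (+ n)    = trans (reflexive (≡.cong ι (≡.sym (ℤₚ.pos-* m n)))) (×1-homo-* m n)
    ι-+* m -[1+ n ] = begin
      ι (+ m ℤ.* -[1+ n ])            ≡⟨ ≡.cong ι (ℤₚ.neg-distribʳ-* (+ m) (+ suc n)) ⟨
      ι (ℤ.- (+ m ℤ.* + suc n))       ≈⟨ ι-neg (+ m ℤ.* + suc n) ⟩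
      - ι (+ m ℤ.* + suc n)           ≈⟨ -‿cong (ι-+* m (+ suc n)) ⟩
      - (ι (+ m) * ι (+ suc n))       ≈⟨ -‿distribʳ-* _ _ ⟩
      ι (+ m) * ι -[1+ n ]            ∎

  ι-* : ∀ i j → ι (i ℤ.* j) ≈ ι i * ι j
  ι-* (+ m)    j = ι-+* m j
  ι-* -[1+ m ] j = begin
    ι (-[1+ m ] ℤ.* j)              ≡⟨ ≡.cong ι (ℤₚ.neg-distribˡ-* (+ suc m) j) ⟨
    ι (ℤ.- (+ suc m ℤ.* j))         ≈⟨ ι-neg (+ suc m ℤ.* j) ⟩
    - ι (+ suc m ℤ.* j)             ≈⟨ -‿cong (ι-+* (suc m) j) ⟩
    - (ι (+ suc m) * ι j)           ≈⟨ -‿distribˡ-* _ _ ⟩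
    ι -[1+ m ] * ι j                ∎

  private
    morphism : ℤ.+-*-rawRing -Raw-AlmostCommutative⟶ fromCommutativeRing R
    morphism = record
      { ⟦_⟧ = ι ; +-homo = ι-+ ; *-homo = ι-* ; -‿homo = ι-neg
      ; 0-homo = refl ; 1-homo = refl }

    _≟ι_ : ∀ i j → Maybe (ι i ≈ ι j)
    i ≟ι j with i ℤₚ.≟ j
    ... | yes i≡j = just (reflexive (≡.cong ι i≡j))
    ... | no  _   = nothing

  open RingSolver ℤ.+-*-rawRing (fromCommutativeRing R) morphism _≟ι_ public
    using (Polynomial; solve; _:=_; _:+_; _:*_; _:-_; :-_; _:^_; con)

-- Order and arithmetic of the real numbers, constructively.

module OrderedField {c ℓ₁ ℓ₂ ℓ₃} (R : RealNumbers c ℓ₁ ℓ₂ ℓ₃) where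
  open RealNumbers R public
  open Fractions R public
  open IsStrictPartialOrder isStrictPartialOrder public
    using (<-respʳ-≈; <-respˡ-≈; <-resp-≈) renaming (trans to <-trans; irrefl to <-irrefl; asym to <-asym)
  open IntegerCoefficients commutativeRing public
  open SemiringMult (CommutativeRing.semiring commutativeRing)
    using (×-homo-+; ×1-homo-*)

  infix 4 _≤_
  _≤_ : ℝ → ℝ → Set ℓ₃
  x ≤ y = ¬ (y < x)

  ≈-stable : ∀ {x y} → ¬ ¬ (x ≈ y) → x ≈ y
  ≈-stable {x} {y} nn = proj₁ (tight x y) λ x#y → nn λ x≈y → proj₂ (tight x y) x≈y x#y

  ≤-stable : ∀ {x y} → ¬ ¬ (x ≤ y) → x ≤ y
  ≤-stable nn y<x = nn λ x≤y → x≤y y<x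

  ≤-antisym : ∀ {x y} → x ≤ y → y ≤ x → x ≈ y
  ≤-antisym {x} {y} x≤y y≤x = proj₁ (tight x y) λ x#y → excl (Equivalence.to (#⇔<⊎> x y) x#y)
    where
    excl : x < y ⊎ y < x → ⊥
    excl (inj₁ x<y) = y≤x x<y
    excl (inj₂ y<x) = x≤y y<x

  -- Apartness is tight: if both strict inequalities fail, then `x` and `y` are equal, so the three
  -- alternatives cannot fail together.
  ¬¬-trichotomy : ∀ x y → ¬ ¬ (x < y ⊎ x ≈ y ⊎ y < x)
  ¬¬-trichotomy x y neither = neither (inj₂ (inj₁ (≤-antisym (λ y<x → neither (inj₂ (inj₂ y<x))) (λ x<y → neither (inj₁ x<y)))))

  -- Cotransitivity is an axiom for `_#_` only. If `z` turns out to lie outside the interval,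
  -- transitivity of `_<_` gives the other alternative.
  <-cotrans : ∀ {x y} → x < y → ∀ z → x < z ⊎ z < y
  <-cotrans {x} {y} x<y z with #-cotrans (Equivalence.from (#⇔<⊎> x y) (inj₁ x<y)) z
  ... | inj₁ x#z with Equivalence.to (#⇔<⊎> x z) x#z
  ...   | inj₁ x<z = inj₁ x<z
  ...   | inj₂ z<x = inj₂ (<-trans z<x x<y)
  <-cotrans {x} {y} x<y z | inj₂ z#y with Equivalence.to (#⇔<⊎> z y) z#y
  ...   | inj₁ z<y = inj₂ z<y
  ...   | inj₂ y<z = inj₁ (<-trans x<y y<z)

  <⇒≤ : ∀ {x y} → x < y → x ≤ y
  <⇒≤ x<y y<x = <-asym x<y y<x

  ≤-reflexive : ∀ {x y} → x ≈ y → x ≤ y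
  ≤-reflexive x≈y y<x = <-irrefl (sym x≈y) y<x

  ≤-refl : ∀ {x} → x ≤ x
  ≤-refl = ≤-reflexive refl

  <-≤-trans : ∀ {x y z} → x < y → y ≤ z → x < z
  <-≤-trans {x} {y} {z} x<y y≤z with <-cotrans x<y z
  ... | inj₁ x<z = x<z
  ... | inj₂ z<y = ⊥-elim (y≤z z<y)

  ≤-<-trans : ∀ {x y z} → x ≤ y → y < z → x < z
  ≤-<-trans {x} {y} {z} x≤y y<z with <-cotrans y<z x
  ... | inj₁ y<x = ⊥-elim (x≤y y<x)
  ... | inj₂ x<z = x<z

  ≤-trans : ∀ {x y z} → x ≤ y → y ≤ z → x ≤ z
  ≤-trans x≤y y≤z z<x = x≤y (≤-<-trans y≤z z<x)

  ≤-isPreorder : IsPreorder _≈_ _≤_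
  ≤-isPreorder = record { isEquivalence = isEquivalence ; reflexive = ≤-reflexive ; trans = ≤-trans }

  module ≤-Reasoning = TripleReasoning ≤-isPreorder <-asym <-trans <-resp-≈ <⇒≤ <-≤-trans ≤-<-trans
    hiding (step-≈; step-≈˘)

  ≤-respʳ : ∀ {x y z} → y ≈ z → x ≤ y → x ≤ z
  ≤-respʳ e p = ≤-trans p (≤-reflexive e)

  ≤-respˡ : ∀ {x y z} → y ≈ z → y ≤ x → z ≤ x
  ≤-respˡ e p = ≤-trans (≤-reflexive (sym e)) p

  +-monoʳ-< : ∀ z {x y} → x < y → z + x < z + y
  +-monoʳ-< z x<y = <-respʳ-≈ (+-comm _ _) (<-respˡ-≈ (+-comm _ _) (+-monoˡ-< z x<y))

  private
    cancel : ∀ x z → x + z - z ≈ x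
    cancel = solve 2 (λ x z → x :+ z :- z := x) refl

  +-monoˡ-≤ : ∀ z {x y} → x ≤ y → x + z ≤ y + z
  +-monoˡ-≤ z {x} {y} x≤y y+z<x+z =
    x≤y (<-respʳ-≈ (cancel x z) (<-respˡ-≈ (cancel y z) (+-monoˡ-< (- z) y+z<x+z)))

  +-mono-≤ : ∀ {x y z w} → x ≤ y → z ≤ w → x + z ≤ y + w
  +-mono-≤ {x} {y} {z} {w} x≤y z≤w = ≤-trans (+-monoˡ-≤ z x≤y)
    (≤-respˡ (+-comm _ _) (≤-respʳ (+-comm _ _) (+-monoˡ-≤ y z≤w)))

  +-nonneg : ∀ {x y} → 0# ≤ x → 0# ≤ y → 0# ≤ x + y
  +-nonneg 0≤x 0≤y = ≤-respˡ (+-identityˡ 0#) (+-mono-≤ 0≤x 0≤y)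

  ≤-by : ∀ {x y} d → 0# ≤ d → y ≈ x + d → x ≤ y
  ≤-by {x} d 0≤d e = ≤-respʳ (sym e) (≤-respˡ (+-identityʳ x) (+-mono-≤ (≤-refl {x}) 0≤d))

  <-by : ∀ {x y} d → 0# < d → y ≈ x + d → x < y
  <-by {x} d 0<d e = <-respʳ-≈ (sym e) (<-respˡ-≈ (+-identityʳ x) (+-monoʳ-< x 0<d))

  0≤y-x : ∀ {x y} → x ≤ y → 0# ≤ y - x
  0≤y-x {x} {y} x≤y = ≤-respˡ (-‿inverseʳ x) (+-monoˡ-≤ (- x) x≤y)

  0<y-x : ∀ {x y} → x < y → 0# < y - x
  0<y-x {x} {y} x<y = <-respˡ-≈ (-‿inverseʳ x) (+-monoˡ-< (- x) x<y)

  neg-positive : ∀ {x} → x < 0# → 0# < - x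
  neg-positive {x} x<0 = <-respʳ-≈ (+-identityˡ _) (0<y-x x<0)

  neg-mono-≤ : ∀ {x y} → x ≤ y → - y ≤ - x
  neg-mono-≤ {x} {y} x≤y = ≤-by (y - x) (0≤y-x x≤y) (solve 2 (λ x y → :- x := :- y :+ (y :- x)) refl x y)

  neg-mono-< : ∀ {x y} → x < y → - y < - x
  neg-mono-< {x} {y} x≤y = <-by (y - x) (0<y-x x≤y) (solve 2 (λ x y → :- x := :- y :+ (y :- x)) refl x y)

  -- The goal is to refute `x * y < 0#`, so the signs of both factors may be distinguished by
  -- trichotomy.
  *-nonneg : ∀ {x y} → 0# ≤ x → 0# ≤ y → 0# ≤ x * y
  *-nonneg {x} {y} 0≤x 0≤y xy<0 = ¬¬-trichotomy 0# x λ where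
    (inj₂ (inj₂ x<0)) → 0≤x x<0
    (inj₂ (inj₁ 0≈x)) → <-irrefl (trans (*-congʳ (sym 0≈x)) (zeroˡ y)) xy<0
    (inj₁ 0<x) → ¬¬-trichotomy 0# y λ where
      (inj₂ (inj₂ y<0)) → 0≤y y<0
      (inj₂ (inj₁ 0≈y)) → <-irrefl (trans (*-congˡ (sym 0≈y)) (zeroʳ x)) xy<0
      (inj₁ 0<y) → <-asym xy<0 (*-positive 0<x 0<y)

  *-monoˡ-≤ : ∀ {a x y} → 0# ≤ a → x ≤ y → a * x ≤ a * y
  *-monoˡ-≤ {a} {x} {y} 0≤a x≤y = ≤-by (a * (y - x)) (*-nonneg 0≤a (0≤y-x x≤y))
    (solve 3 (λ a x y → a :* y := a :* x :+ a :* (y :- x)) refl a x y)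

  *-monoˡ-< : ∀ {a x y} → 0# < a → x < y → a * x < a * y
  *-monoˡ-< {a} {x} {y} 0≤a x≤y = <-by (a * (y - x)) (*-positive 0≤a (0<y-x x≤y))
    (solve 3 (λ a x y → a :* y := a :* x :+ a :* (y :- x)) refl a x y)

  *-monoʳ-≤ : ∀ {a x y} → 0# ≤ a → x ≤ y → x * a ≤ y * a
  *-monoʳ-≤ 0≤a x≤y = ≤-respˡ (*-comm _ _) (≤-respʳ (*-comm _ _) (*-monoˡ-≤ 0≤a x≤y))

  *-mono-≤ : ∀ {x y z w} → 0# ≤ x → 0# ≤ w → x ≤ y → z ≤ w → x * z ≤ y * w
  *-mono-≤ 0≤x 0≤w x≤y z≤w = ≤-trans (*-monoˡ-≤ 0≤x z≤w) (*-monoʳ-≤ 0≤w x≤y)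

  square-nonneg : ∀ x → 0# ≤ x * x
  square-nonneg x = ≤-stable λ k → ¬¬-trichotomy 0# x λ where
    (inj₁ 0<x) → k (<⇒≤ (*-positive 0<x 0<x))
    (inj₂ (inj₁ 0≈x)) → k (≤-reflexive (trans (sym (zeroˡ x)) (*-congʳ 0≈x)))
    (inj₂ (inj₂ x<0)) → k (≤-respʳ (solve 1 (λ x → :- x :* :- x := x :* x) refl x)
                            (<⇒≤ (*-positive (neg-positive x<0) (neg-positive x<0))))

  square-cancel-≤ : ∀ {x y} → 0# ≤ y → x * x ≤ y * y → x ≤ y
  square-cancel-≤ {x} {y} 0≤y xx≤yy y<x = xx≤yy (≤-<-trans (*-monoˡ-≤ 0≤y (<⇒≤ y<x)) yx<xx)
    where
    yx<xx : y * x < x * x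
    yx<xx = <-respˡ-≈ (*-comm x y) (*-monoˡ-< (≤-<-trans 0≤y y<x) y<x)

  square-mono-< : ∀ {x y} → 0# ≤ x → x < y → x * x < y * y
  square-mono-< {x} {y} 0≤x x<y = ≤-<-trans (*-monoˡ-≤ 0≤x (<⇒≤ x<y)) (<-respˡ-≈ (*-comm y x) (*-monoˡ-< (≤-<-trans 0≤x x<y) x<y))

  square-mono-≤ : ∀ {x y} → 0# ≤ x → x ≤ y → x * x ≤ y * y
  square-mono-≤ 0≤x x≤y = *-mono-≤ 0≤x (≤-trans 0≤x x≤y) x≤y x≤y

  *-cancelˡ-≤ : ∀ {a x y} → 0# < a → a * x ≤ a * y → x ≤ y
  *-cancelˡ-≤ 0<a ax≤ay y<x = ax≤ay (*-monoˡ-< 0<a y<x)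

  *-cancelˡ-≈ : ∀ {a x y} → 0# < a → a * x ≈ a * y → x ≈ y
  *-cancelˡ-≈ 0<a e = ≤-antisym (*-cancelˡ-≤ 0<a (≤-reflexive e)) (*-cancelˡ-≤ 0<a (≤-reflexive (sym e)))

  square-zero : ∀ {x} → x * x ≈ 0# → x ≈ 0#
  square-zero {x} e = ≤-antisym
    (square-cancel-≤ ≤-refl (≤-reflexive (trans e (sym (zeroˡ 0#)))))
    (≤-respʳ (solve 1 (λ x → :- :- x := x) refl x) (≤-respˡ (solve 0 (:- con (+ 0) := con (+ 0)) refl)
      (neg-mono-≤ (square-cancel-≤ ≤-refl (≤-reflexive (trans (solve 1 (λ x → :- x :* :- x := x :* x) refl x) (trans e (sym (zeroˡ 0#)))))))))

  sum-of-squares-zero : ∀ {x y} → x * x + y * y ≈ 0# → x ≈ 0# × y ≈ 0#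
  sum-of-squares-zero {x} {y} e = square-zero (≤-antisym (≤-respʳ e (≤-by (y * y) (square-nonneg y) refl)) (square-nonneg x))
    , square-zero (≤-antisym (≤-respʳ e (≤-by (x * x) (square-nonneg x) (+-comm _ _))) (square-nonneg y))

  inverse-positive : ∀ {x y} → 0# < x → x * y ≈ 1# → 0# < y
  inverse-positive {x} {y} 0<x xy≈1 = sign (Equivalence.to (#⇔<⊎> y 0#) y#0)
    where
    y#0 : y # 0#
    y#0 = invertible⇒# (x , trans (solve 2 (λ x y → x :* (y :- con (+ 0)) := x :* y) refl x y) xy≈1
                          , trans (solve 2 (λ x y → (y :- con (+ 0)) :* x := x :* y) refl x y) xy≈1)
    sign : y < 0# ⊎ 0# < y → 0# < y
    sign (inj₂ 0<y) = 0<y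
    sign (inj₁ y<0) = ⊥-elim (<-asym (<-respʳ-≈ (sym xy≈1) 0<1) (<-respʳ-≈ (zeroʳ x) (*-monoˡ-< 0<x y<0)))

  opaque
    positive-inverse : ∀ {x} → 0# < x → ∃[ y ] 0# < y × x * y ≈ 1#
    positive-inverse {x} 0<x with #⇒invertible (Equivalence.from (#⇔<⊎> x 0#) (inj₂ 0<x))
    ... | y , _ , e = y , inverse-positive 0<x xy≈1 , xy≈1
      where
      xy≈1 : x * y ≈ 1#
      xy≈1 = trans (solve 2 (λ x y → x :* y := (x :- con (+ 0)) :* y) refl x y) e

  -- Strict inequality is not stable under double negation, so the argument by contradiction that
  -- serves for `≤` is replaced by multiplication with the inverse of `a`.
  *-cancelˡ-< : ∀ {a x y} → 0# < a → a * x < a * y → x < y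
  *-cancelˡ-< {a} {x} {y} 0<a ax<ay with positive-inverse 0<a
  ... | z , 0<z , e = <-respʳ-≈ (un y) (<-respˡ-≈ (un x) (*-monoˡ-< 0<z ax<ay))
    where
    un : ∀ x → z * (a * x) ≈ x
    un x = trans (solve 3 (λ z n x → z :* (n :* x) := (n :* z) :* x) refl z a x) (trans (*-congʳ e) (*-identityˡ x))

  ·-homo-+ : ∀ m n → (m ℕ.+ n) · 1# ≈ m · 1# + n · 1#
  ·-homo-+ = ×-homo-+ 1#

  ·-homo-* : ∀ m n → (m ℕ.* n) · 1# ≈ (m · 1#) * (n · 1#)
  ·-homo-* = ×1-homo-*

  ·-nonneg : ∀ n → 0# ≤ n · 1#
  ·-nonneg zero    = ≤-refl
  ·-nonneg (suc n) = <⇒≤ (suc-positive n)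

  ·-mono-≤ : ∀ {m n} → m ℕ.≤ n → m · 1# ≤ n · 1#
  ·-mono-≤ {n = n} ℕ.z≤n = ·-nonneg n
  ·-mono-≤ (ℕ.s≤s m≤n) = +-mono-≤ ≤-refl (·-mono-≤ m≤n)

  *-recip : ∀ n .{{_ : NonZero n}} → (n · 1#) * recip n ≈ 1#
  *-recip (suc n) = un (suc n · 1#) _
    (proj₂ (proj₂ (#⇒invertible (Equivalence.from (#⇔<⊎> (suc n · 1#) 0#) (inj₂ (suc-positive n))))))
    where
    un : ∀ x y → (x - 0#) * y ≈ 1# → x * y ≈ 1#
    un x y e = trans (solve 2 (λ x y → x :* y := (x :- con (+ 0)) :* y) refl x y) e

  ·-positive : ∀ n .{{_ : NonZero n}} → 0# < n · 1#
  ·-positive (suc n) = suc-positive n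

  recip-positive : ∀ n .{{_ : NonZero n}} → 0# < recip n
  recip-positive n = inverse-positive (·-positive n) (*-recip n)

  inverse-anti-≤ : ∀ {x y r s} → 0# < x → 0# < y → x * r ≈ 1# → y * s ≈ 1# → x ≤ y → s ≤ r
  inverse-anti-≤ 0<x 0<y xr ys x≤y = *-cancelˡ-≤ 0<y (≤-respˡ (sym ys)
    (≤-respˡ xr (*-monoʳ-≤ (<⇒≤ (inverse-positive 0<x xr)) x≤y)))

  recip-anti-≤ : ∀ {m n} → m ℕ.≤ n → recip (suc n) ≤ recip (suc m)
  recip-anti-≤ {m} {n} m≤n = inverse-anti-≤ (suc-positive m) (suc-positive n) (*-recip (suc m)) (*-recip (suc n)) (·-mono-≤ (ℕ.s≤s m≤n))

  opaque
    -- If `N` exceeds the inverse of `δ`, then (N + 1) r = 1 < δ (N + 1), and the positive factor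
    -- cancels.
    archimedean⁻¹ : ∀ {δ} → 0# < δ → ∃[ N ] ∀ r → (suc N · 1#) * r ≈ 1# → r < δ
    archimedean⁻¹ {δ} 0<δ with positive-inverse 0<δ
    ... | y , 0<y , δy≈1 with archimedean y
    ...   | N , y<N = N , λ r e → *-cancelˡ-< (suc-positive N) (<-respʳ-≈ (*-comm _ _) (<-respˡ-≈ (sym e) 1<))
      where
      1< : 1# < δ * (suc N · 1#)
      1< = <-respˡ-≈ δy≈1 (*-monoˡ-< 0<δ (<-trans y<N (<-by 1# 0<1 (+-comm _ _))))

  opaque
    recip-small : ∀ {δ} → 0# < δ → ∃[ N ] ∀ n → N ℕ.≤ n → recip (suc n) < δ
    recip-small 0<δ = proj₁ (archimedean⁻¹ 0<δ) , λ n N≤n →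
      ≤-<-trans (recip-anti-≤ N≤n) (proj₂ (archimedean⁻¹ 0<δ) _ (*-recip (suc (proj₁ (archimedean⁻¹ 0<δ)))))

  opaque
    halve : ∀ {δ} → 0# < δ → ∃[ η ] 0# < η × η + η ≈ δ
    halve {δ} 0<δ = halve′ (recip 2) (recip-positive 2) (*-recip 2)
      where
      halve′ : ∀ r → 0# < r → (2 · 1#) * r ≈ 1# → ∃[ η ] 0# < η × η + η ≈ δ
      halve′ r 0<r e = r * δ , *-positive 0<r 0<δ ,
        trans (solve 2 (λ r δ → r :* δ :+ r :* δ := (con (+ 1) :+ (con (+ 1) :+ con (+ 0))) :* r :* δ) refl r δ)
        (trans (*-congʳ e) (*-identityˡ δ))

  opaque
    <-dense : ∀ {x} → 0# < x → ∃[ y ] 0# < y × y < x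
    <-dense 0<x with halve 0<x
    ... | η , 0<η , e = η , 0<η , <-by η 0<η (sym e)

  -- If y < x, some positive δ lies strictly below x - y, and the hypothesis fails for it.
  ≤-limit : ∀ {x y} → (∀ δ → 0# < δ → x ≤ y + δ) → x ≤ y
  ≤-limit {x} {y} h y<x with <-dense (0<y-x y<x)
  ... | δ , 0<δ , δ<x-y = h δ 0<δ (<-respʳ-≈ (solve 2 (λ x y → y :+ (x :- y) := x) refl x y) (+-monoʳ-< y δ<x-y))

-- Finite sums indexed by initial segments of the naturals.

module FiniteSums {c ℓ} (R : CommutativeRing c ℓ) where
  open CommutativeRing R
  open IntegerCoefficients R
  open SetoidReasoning setoid

  -- The new term is added at the end, so that successive partial sums of a series differ by one
  -- term definitionally; `sum` in the statement adds it in front.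
  Σ< : ℕ → (ℕ → Carrier) → Carrier
  Σ< zero    f = 0#
  Σ< (suc n) f = Σ< n f + f n

  Σ<-cong : ∀ n {f g} → (∀ k → f k ≈ g k) → Σ< n f ≈ Σ< n g
  Σ<-cong zero    f≈g = refl
  Σ<-cong (suc n) f≈g = +-cong (Σ<-cong n f≈g) (f≈g n)

  Σ<-front : ∀ n f → Σ< (suc n) f ≈ f 0 + Σ< n (f ∘ suc)
  Σ<-front zero    f = +-comm _ _
  Σ<-front (suc n) f = trans (+-congʳ (Σ<-front n f)) (+-assoc _ _ _)

-- The complex numbers: ring structure and bounds on the modulus.

module ComplexNumbers {c ℓ₁ ℓ₂ ℓ₃} (R : RealNumbers c ℓ₁ ℓ₂ ℓ₃) where
  open OrderedField R public
  open Complex R public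

  ℂ-commutativeRing : CommutativeRing c ℓ₁
  ℂ-commutativeRing = record
    { Carrier = ℂ ; _≈_ = _≈ℂ_ ; _+_ = _+ℂ_ ; _*_ = _*ℂ_ ; -_ = -ℂ_ ; 0# = 0ℂ ; 1# = 1ℂ
    ; isCommutativeRing = record
      { isRing = record
        { +-isAbelianGroup = record
          { isGroup = record
            { isMonoid = record
              { isSemigroup = record
                { isMagma = record
                  { isEquivalence = record
                    { refl = refl , refl
                    ; sym = λ p → sym (proj₁ p) , sym (proj₂ p)
                    ; trans = λ p q → trans (proj₁ p) (proj₁ q) , trans (proj₂ p) (proj₂ q) }
                  ; ∙-cong = λ p q → +-cong (proj₁ p) (proj₁ q) , +-cong (proj₂ p) (proj₂ q) }
                ; assoc = λ z w u → +-assoc _ _ _ , +-assoc _ _ _ }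
              ; identity = (λ z → +-identityˡ _ , +-identityˡ _) , (λ z → +-identityʳ _ , +-identityʳ _) }
            ; inverse = (λ z → -‿inverseˡ _ , -‿inverseˡ _) , (λ z → -‿inverseʳ _ , -‿inverseʳ _)
            ; ⁻¹-cong = λ p → -‿cong (proj₁ p) , -‿cong (proj₂ p) }
          ; comm = λ z w → +-comm _ _ , +-comm _ _ }
        ; *-cong = λ p q →
            +-cong (*-cong (proj₁ p) (proj₁ q)) (-‿cong (*-cong (proj₂ p) (proj₂ q))) ,
            +-cong (*-cong (proj₁ p) (proj₂ q)) (*-cong (proj₂ p) (proj₁ q))
        ; *-assoc = λ { (a +i b) (a′ +i b′) (a″ +i b″) →
            solve 6 (λ a b a′ b′ a″ b″ → (a :* a′ :- b :* b′) :* a″ :- (a :* b′ :+ b :* a′) :* b″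
              := a :* (a′ :* a″ :- b′ :* b″) :- b :* (a′ :* b″ :+ b′ :* a″)) refl a b a′ b′ a″ b″ ,
            solve 6 (λ a b a′ b′ a″ b″ → (a :* a′ :- b :* b′) :* b″ :+ (a :* b′ :+ b :* a′) :* a″
              := a :* (a′ :* b″ :+ b′ :* a″) :+ b :* (a′ :* a″ :- b′ :* b″)) refl a b a′ b′ a″ b″ }
        ; *-identity =
            (λ { (a +i b) → solve 2 (λ a b → con (+ 1) :* a :- con (+ 0) :* b := a) refl a b ,
                            solve 2 (λ a b → con (+ 1) :* b :+ con (+ 0) :* a := b) refl a b }) ,
            (λ { (a +i b) → solve 2 (λ a b → a :* con (+ 1) :- b :* con (+ 0) := a) refl a b ,
                            solve 2 (λ a b → a :* con (+ 0) :+ b :* con (+ 1) := b) refl a b })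
        ; distrib =
            (λ { (a +i b) (a′ +i b′) (a″ +i b″) →
              solve 6 (λ a b a′ b′ a″ b″ → a :* (a′ :+ a″) :- b :* (b′ :+ b″)
                := a :* a′ :- b :* b′ :+ (a :* a″ :- b :* b″)) refl a b a′ b′ a″ b″ ,
              solve 6 (λ a b a′ b′ a″ b″ → a :* (b′ :+ b″) :+ b :* (a′ :+ a″)
                := a :* b′ :+ b :* a′ :+ (a :* b″ :+ b :* a″)) refl a b a′ b′ a″ b″ }) ,
            (λ { (a +i b) (a′ +i b′) (a″ +i b″) →
              solve 6 (λ a b a′ b′ a″ b″ → (a′ :+ a″) :* a :- (b′ :+ b″) :* b
                := a′ :* a :- b′ :* b :+ (a″ :* a :- b″ :* b)) refl a b a′ b′ a″ b″ ,
              solve 6 (λ a b a′ b′ a″ b″ → (a′ :+ a″) :* b :+ (b′ :+ b″) :* a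
                := a′ :* b :+ b′ :* a :+ (a″ :* b :+ b″ :* a)) refl a b a′ b′ a″ b″ }) }
      ; *-comm = λ { (a +i b) (a′ +i b′) →
          solve 4 (λ a b a′ b′ → a :* a′ :- b :* b′ := a′ :* a :- b′ :* b) refl a b a′ b′ ,
          solve 4 (λ a b a′ b′ → a :* b′ :+ b :* a′ := a′ :* b :+ b′ :* a) refl a b a′ b′ } } }

  module ℂR = CommutativeRing ℂ-commutativeRing
  module ℝΣ = FiniteSums commutativeRing
  open IntegerCoefficients ℂ-commutativeRing public using ()
    renaming (solve to solveℂ; _:=_ to _⊜_; _:+_ to _⊕_; _:*_ to _⊗_; _:-_ to _⊖_; :-_ to ⊝_; con to κ; ι to ιℂ)

  conj : ℂ → ℂ
  conj (a +i b) = a +i (- b)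

  infix 4 _⊑_
  -- The bound on the modulus is stated through its square, so that no square root has to be
  -- constructed.
  record _⊑_ (z : ℂ) (b : ℝ) : Set ℓ₃ where
    constructor bounded
    field
      nonneg : 0# ≤ b
      norm²≤ : ∣ z ∣² ≤ b * b

  ∣∣²-cong : ∀ {z w} → z ≈ℂ w → ∣ z ∣² ≈ ∣ w ∣²
  ∣∣²-cong (p , q) = +-cong (*-cong p p) (*-cong q q)

  ∣∣²-nonneg : ∀ z → 0# ≤ ∣ z ∣²
  ∣∣²-nonneg z = +-nonneg (square-nonneg _) (square-nonneg _)

  ∣∣²-* : ∀ z w → ∣ z *ℂ w ∣² ≈ ∣ z ∣² * ∣ w ∣²
  ∣∣²-* (a +i b) (a′ +i b′) = solve 4 (λ a b a′ b′ →
    (a :* a′ :- b :* b′) :* (a :* a′ :- b :* b′) :+ (a :* b′ :+ b :* a′) :* (a :* b′ :+ b :* a′)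
    := (a :* a :+ b :* b) :* (a′ :* a′ :+ b′ :* b′)) refl a b a′ b′

  ∣∣²≈0⇒≈0 : ∀ {z} → ∣ z ∣² ≈ 0# → z ≈ℂ 0ℂ
  ∣∣²≈0⇒≈0 = sum-of-squares-zero

  ⊑-resp-≈ : ∀ {z w b} → z ≈ℂ w → z ⊑ b → w ⊑ b
  ⊑-resp-≈ e (bounded 0≤b p) = bounded 0≤b (≤-respˡ (∣∣²-cong e) p)

  ⊑-weaken : ∀ {z b c} → b ≤ c → z ⊑ b → z ⊑ c
  ⊑-weaken b≤c (bounded 0≤b p) = bounded (≤-trans 0≤b b≤c) (≤-trans p (square-mono-≤ 0≤b b≤c))

  ⊑-zero : ∀ {b} → 0# ≤ b → 0ℂ ⊑ b
  ⊑-zero 0≤b = bounded 0≤b (≤-respˡ (solve 0 (con (+ 0) := con (+ 0) :* con (+ 0) :+ con (+ 0) :* con (+ 0)) refl) (square-nonneg _))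

  ⊑-↑ : ∀ {x} → 0# ≤ x → ↑ x ⊑ x
  ⊑-↑ {x} 0≤x = bounded 0≤x (≤-reflexive (solve 1 (λ x → x :* x :+ con (+ 0) :* con (+ 0) := x :* x) refl x))

  ⊑-neg : ∀ {z b} → z ⊑ b → -ℂ z ⊑ b
  ⊑-neg {x +i y} (bounded 0≤b p) = bounded 0≤b (≤-respˡ (solve 2 (λ x y → x :* x :+ y :* y := :- x :* :- x :+ :- y :* :- y) refl x y) p)

  ⊑-* : ∀ {z w b c} → z ⊑ b → w ⊑ c → z *ℂ w ⊑ b * c
  ⊑-* {z} {w} {b} {c} (bounded 0≤b p) (bounded 0≤c q) = bounded (*-nonneg 0≤b 0≤c)
    (≤-respˡ (sym (∣∣²-* z w)) (≤-respʳ (solve 2 (λ b c → (b :* b) :* (c :* c) := (b :* c) :* (b :* c)) refl b c)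
      (*-mono-≤ (∣∣²-nonneg z) (square-nonneg c) p q)))

  ⊑-+ : ∀ {z w b c} → z ⊑ b → w ⊑ c → z +ℂ w ⊑ b + c
  ⊑-+ {x +i y} {u +i v} {b} {c} (bounded 0≤b p) (bounded 0≤c q) = bounded (+-nonneg 0≤b 0≤c) norm-bound
    where
    -- Cauchy–Schwarz
    dot≤ : x * u + y * v ≤ b * c
    dot≤ = square-cancel-≤ (*-nonneg 0≤b 0≤c) (≤-trans
      (≤-by ((x * v - y * u) * (x * v - y * u)) (square-nonneg _)
        (solve 4 (λ x y u v → (x :* x :+ y :* y) :* (u :* u :+ v :* v) :=
          (x :* u :+ y :* v) :* (x :* u :+ y :* v) :+ (x :* v :- y :* u) :* (x :* v :- y :* u)) refl x y u v))
      (≤-respʳ (solve 2 (λ b c → (b :* b) :* (c :* c) := (b :* c) :* (b :* c)) refl b c)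
        (*-mono-≤ (∣∣²-nonneg (x +i y)) (square-nonneg c) p q)))
    norm-bound : (x + u) * (x + u) + (y + v) * (y + v) ≤ (b + c) * (b + c)
    norm-bound = ≤-respˡ
      (solve 4 (λ x y u v → (x :* x :+ y :* y) :+ (u :* u :+ v :* v) :+ ((x :* u :+ y :* v) :+ (x :* u :+ y :* v))
        := (x :+ u) :* (x :+ u) :+ (y :+ v) :* (y :+ v)) refl x y u v)
      (≤-respʳ (solve 2 (λ b c → b :* b :+ c :* c :+ (b :* c :+ b :* c) := (b :+ c) :* (b :+ c)) refl b c)
        (+-mono-≤ (+-mono-≤ p q) (+-mono-≤ dot≤ dot≤)))

  ⊑-re : ∀ {z b} → z ⊑ b → re z ≤ b
  ⊑-re {x +i y} (bounded 0≤b p) = square-cancel-≤ 0≤b (≤-trans (≤-by (y * y) (square-nonneg y) refl) p)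

  ⊑-im : ∀ {z b} → z ⊑ b → im z ≤ b
  ⊑-im {x +i y} (bounded 0≤b p) = square-cancel-≤ 0≤b (≤-trans (≤-by (x * x) (square-nonneg x) (+-comm _ _)) p)

  private
    neg-flip : ∀ {x b} → - x ≤ b → - b ≤ x
    neg-flip {x} {b} p = ≤-respʳ (solve 1 (λ x → :- :- x := x) refl x) (neg-mono-≤ p)

  ⊑-re⁻ : ∀ {z b} → z ⊑ b → - b ≤ re z
  ⊑-re⁻ p = neg-flip (⊑-re (⊑-neg p))

  ⊑-im⁻ : ∀ {z b} → z ⊑ b → - b ≤ im z
  ⊑-im⁻ p = neg-flip (⊑-im (⊑-neg p))

  -- The triangle inequality for x and iy; the factor 2 in place of √2 avoids a root. The squares
  -- are compared by b² - x² = (b - x)(x + b).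
  ⊑-components : ∀ {x y b} → 0# ≤ b → - b ≤ x → x ≤ b → - b ≤ y → y ≤ b → (x +i y) ⊑ (b + b)
  ⊑-components {x} {y} {b} 0≤b l₁ u₁ l₂ u₂ = ⊑-resp-≈
    (solve 1 (λ x → x :+ con (+ 0) := x) refl x , solve 1 (λ x → con (+ 0) :+ x := x) refl y)
    (⊑-+ {x +i 0#} {0# +i y} (bounded 0≤b (≤-respˡ (solve 1 (λ x → x :* x := x :* x :+ con (+ 0) :* con (+ 0)) refl x) (sq l₁ u₁)))
         (bounded 0≤b (≤-respˡ (solve 1 (λ x → x :* x := con (+ 0) :* con (+ 0) :+ x :* x) refl y) (sq l₂ u₂))))
    where
    sq : ∀ {x} → - b ≤ x → x ≤ b → x * x ≤ b * b
    sq {x} l u = ≤-by ((b - x) * (x - - b)) (*-nonneg (0≤y-x u) (0≤y-x l))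
      (solve 2 (λ x b → b :* b := x :* x :+ (b :- x) :* (x :- :- b)) refl x b)

  ⊑-limit : ∀ {z} → (∀ δ → 0# < δ → z ⊑ δ) → z ≈ℂ 0ℂ
  ⊑-limit h = zero-by (λ δ 0<δ → ⊑-re (h δ 0<δ)) (λ δ 0<δ → ⊑-re⁻ (h δ 0<δ))
            , zero-by (λ δ 0<δ → ⊑-im (h δ 0<δ)) (λ δ 0<δ → ⊑-im⁻ (h δ 0<δ))
    where
    zero-by : ∀ {x} → (∀ δ → 0# < δ → x ≤ δ) → (∀ δ → 0# < δ → - δ ≤ x) → x ≈ 0#
    zero-by {x} u l = ≤-antisym
      (≤-limit λ δ 0<δ → ≤-respʳ (sym (+-identityˡ δ)) (u δ 0<δ))
      (≤-limit λ δ 0<δ → ≤-respˡ (-‿inverseˡ δ) (+-monoˡ-≤ δ (l δ 0<δ)))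

  opaque
    ⊑-exists : ∀ z → ∃[ n ] z ⊑ suc n · 1#
    ⊑-exists z with archimedean ∣ z ∣²
    ... | n , z<n = n , bounded (·-nonneg (suc n)) (≤-trans (<⇒≤ z<n) (≤-trans (≤-by 1# (<⇒≤ 0<1) (+-comm _ _))
      (≤-by ((1# + n · 1#) * (n · 1#)) (*-nonneg (·-nonneg (suc n)) (·-nonneg n))
        (solve 1 (λ n → (con (+ 1) :+ n) :* (con (+ 1) :+ n) := con (+ 1) :+ n :+ (con (+ 1) :+ n) :* n) refl (n · 1#)))))

  -- `Within` is strict and `⊑` is not, so this direction needs room between `b` and `δ`; `<-dense`
  -- provides it wherever a limit is turned into a statement about `Within`.
  ⊑⇒Within : ∀ {δ b z w} → z -ℂ w ⊑ b → b < δ → Within δ z w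
  ⊑⇒Within (bounded 0≤b p) b<δ = ≤-<-trans p (square-mono-< 0≤b b<δ)

  Within⇒⊑ : ∀ {δ z w} → 0# < δ → Within δ z w → z -ℂ w ⊑ δ
  Within⇒⊑ 0<δ p = bounded (<⇒≤ 0<δ) (<⇒≤ p)

-- Commutative algebras over the reals, normed and complete.

-- The formal identities of the exponential series are needed twice: in the normed algebra, and over
-- the reals themselves, where the majorant series lives.
record RealAlgebra {c ℓ₁ ℓ₂ ℓ₃} (R : RealNumbers c ℓ₁ ℓ₂ ℓ₃) (a ℓ : Level) : Set (lsuc (a ⊔ ℓ) ⊔ c ⊔ ℓ₁) where
  open RealNumbers R
  field
    algebra : CommutativeRing a ℓ

  module 𝔸 = CommutativeRing algebra
  open 𝔸 public using () renaming
    (Carrier to A; _≈_ to _≈ᴬ_; _+_ to _+ᴬ_; _*_ to _*ᴬ_; -_ to -ᴬ_; _-_ to _-ᴬ_; 0# to 0ᴬ; 1# to 1ᴬ)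

  field
    ofℝ      : ℝ → A
    ofℝ-cong : ∀ {x y} → x ≈ y → ofℝ x ≈ᴬ ofℝ y
    ofℝ-+    : ∀ x y → ofℝ (x + y) ≈ᴬ ofℝ x +ᴬ ofℝ y
    ofℝ-*    : ∀ x y → ofℝ (x * y) ≈ᴬ ofℝ x *ᴬ ofℝ y
    ofℝ-1    : ofℝ 1# ≈ᴬ 1ᴬ

  ofℝ-0 : ofℝ 0# ≈ᴬ 0ᴬ
  ofℝ-0 = x+x≈x⇒x≈0 _ (𝔸.trans (𝔸.sym (ofℝ-+ 0# 0#)) (ofℝ-cong (+-identityˡ 0#)))
    where open RingProperties 𝔸.ring using (x+x≈x⇒x≈0)

record NormedAlgebra {c ℓ₁ ℓ₂ ℓ₃} (R : RealNumbers c ℓ₁ ℓ₂ ℓ₃) (a ℓ m : Level) :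
    Set (lsuc (a ⊔ ℓ ⊔ m) ⊔ c ⊔ ℓ₁ ⊔ ℓ₃) where
  open OrderedField R
  infix 4 _⊑_

  field
    realAlgebra : RealAlgebra R a ℓ

  open RealAlgebra realAlgebra public

  -- z ⊑ b stands for ∥ z ∥ ≤ b.
  field
    _⊑_      : A → ℝ → Set m
    ⊑-nonneg : ∀ {z b} → z ⊑ b → 0# ≤ b
    ⊑-resp-≈ : ∀ {z w b} → z ≈ᴬ w → z ⊑ b → w ⊑ b
    ⊑-weaken : ∀ {z b c} → b ≤ c → z ⊑ b → z ⊑ c
    ⊑-zero   : ∀ {b} → 0# ≤ b → 0ᴬ ⊑ b
    ⊑-neg    : ∀ {z b} → z ⊑ b → -ᴬ z ⊑ b
    ⊑-+      : ∀ {z w b c} → z ⊑ b → w ⊑ c → z +ᴬ w ⊑ b + c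
    ⊑-*      : ∀ {z w b c} → z ⊑ b → w ⊑ c → z *ᴬ w ⊑ b * c
    ⊑-exists : ∀ z → ∃[ n ] z ⊑ suc n · 1#
    ⊑-limit  : ∀ {z} → (∀ δ → 0# < δ → z ⊑ δ) → z ≈ᴬ 0ᴬ
    ⊑-ofℝ    : ∀ {x} → 0# ≤ x → ofℝ x ⊑ x

  Lim : (ℕ → A) → A → Set (c ⊔ ℓ₃ ⊔ m)
  Lim s l = ∀ δ → 0# < δ → ∃[ N ] ∀ n → N ℕ.≤ n → s n -ᴬ l ⊑ δ

  Cauchyᴬ : (ℕ → A) → Set (c ⊔ ℓ₃ ⊔ m)
  Cauchyᴬ s = ∀ δ → 0# < δ → ∃[ N ] ∀ m n → N ℕ.≤ m → N ℕ.≤ n → s m -ᴬ s n ⊑ δ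

  field
    completeᴬ : ∀ s → Cauchyᴬ s → ∃[ l ] Lim s l

-- Null sequences, limits and convergence by telescoping majorants.

module NullSequences {c ℓ₁ ℓ₂ ℓ₃} (R : RealNumbers c ℓ₁ ℓ₂ ℓ₃) where
  open OrderedField R

  Null : (ℕ → ℝ) → Set (c ⊔ ℓ₃)
  Null b = ∀ δ → 0# < δ → ∃[ N ] ∀ n → N ℕ.≤ n → b n ≤ δ

  opaque
    -- Whether `a` vanishes cannot be decided, so δ is divided by a + 1 rather than by a.
    Null-scale : ∀ {a b} → 0# ≤ a → Null b → Null (λ n → a * b n)
    Null-scale {a} {b} 0≤a b→0 δ 0<δ with positive-inverse (≤-<-trans 0≤a (<-by 1# 0<1 refl))
    ... | y , 0<y , [a+1]y≈1 with b→0 (y * δ) (*-positive 0<y 0<δ)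
    ... | N , bound = N , λ n N≤n → ≤-trans (*-monoˡ-≤ 0≤a (bound n N≤n)) aη≤δ
      where
      aη≤δ : a * (y * δ) ≤ δ
      aη≤δ = ≤-by (y * δ) (<⇒≤ (*-positive 0<y 0<δ)) (trans (trans (sym (*-identityˡ δ)) (*-congʳ (sym [a+1]y≈1)))
        (solve 3 (λ a y δ → (a :+ con (+ 1)) :* y :* δ := a :* (y :* δ) :+ y :* δ) refl a y δ))

  opaque
    Null-recip : Null (λ n → recip (suc n))
    Null-recip δ 0<δ = proj₁ (recip-small 0<δ) , λ n N≤n → <⇒≤ (proj₂ (recip-small 0<δ) n N≤n)

  opaque
    Null-≤ : ∀ {a b} → (∀ n → a n ≤ b n) → Null b → Null a
    Null-≤ a≤b b→0 δ 0<δ with b→0 δ 0<δ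
    ... | N , bound = N , λ n N≤n → ≤-trans (a≤b n) (bound n N≤n)

module Limits {c ℓ₁ ℓ₂ ℓ₃} (R : RealNumbers c ℓ₁ ℓ₂ ℓ₃) {a ℓ m} (𝒜 : NormedAlgebra R a ℓ m) where
  open OrderedField R
  open NullSequences R
  open NormedAlgebra 𝒜
  open FiniteSums algebra
  open IntegerCoefficients algebra using ()
    renaming (solve to solveᴬ; _:=_ to _⊜_; _:+_ to _⊕_; _:*_ to _⊗_; _:-_ to _⊖_; :-_ to ⊝_)
  open RawSemiringDefs (RawRing.rawSemiring 𝔸.rawRing) using (_^_)

  opaque
    squeeze : ∀ {s l b} M → Null b → (∀ n → M ℕ.≤ n → s n -ᴬ l ⊑ b n) → Lim s l
    squeeze M b→0 s⊑b δ 0<δ with b→0 δ 0<δ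
    ... | N , bound = M ℕ.⊔ N , λ n p →
      ⊑-weaken (bound n (ℕₚ.m⊔n≤o⇒n≤o M N p)) (s⊑b n (ℕₚ.m⊔n≤o⇒m≤o M N p))

  opaque
    Lim-cong : ∀ {s t l} → (∀ n → s n ≈ᴬ t n) → Lim s l → Lim t l
    Lim-cong s≈t s→l δ 0<δ with s→l δ 0<δ
    ... | N , bound = N , λ n N≤n → ⊑-resp-≈ (𝔸.+-congʳ (s≈t n)) (bound n N≤n)

  opaque
    Lim-congʳ : ∀ {s l m} → l ≈ᴬ m → Lim s l → Lim s m
    Lim-congʳ l≈m s→l δ 0<δ with s→l δ 0<δ
    ... | N , bound = N , λ n N≤n → ⊑-resp-≈ (𝔸.+-congˡ (𝔸.-‿cong l≈m)) (bound n N≤n)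

  Lim-const : ∀ l → Lim (λ _ → l) l
  Lim-const l δ 0<δ = 0 , λ n _ → ⊑-resp-≈ (𝔸.sym (𝔸.-‿inverseʳ l)) (⊑-zero (<⇒≤ 0<δ))

  opaque
    Lim-+ : ∀ {s t l m} → Lim s l → Lim t m → Lim (λ n → s n +ᴬ t n) (l +ᴬ m)
    Lim-+ {s} {t} {l} {m} s→l t→m δ 0<δ with halve 0<δ
    ... | η , 0<η , η+η≈δ with s→l η 0<η | t→m η 0<η
    ... | M , s-bound | N , t-bound = M ℕ.⊔ N , λ n M⊔N≤n →
      ⊑-resp-≈ (solveᴬ 4 (λ s t l m → (s ⊖ l) ⊕ (t ⊖ m) ⊜ s ⊕ t ⊖ (l ⊕ m)) 𝔸.refl (s n) (t n) l m)
        (⊑-weaken (≤-reflexive η+η≈δ)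
          (⊑-+ (s-bound n (ℕₚ.m⊔n≤o⇒m≤o M N M⊔N≤n)) (t-bound n (ℕₚ.m⊔n≤o⇒n≤o M N M⊔N≤n))))

  opaque
    Lim-neg : ∀ {s l} → Lim s l → Lim (λ n → -ᴬ s n) (-ᴬ l)
    Lim-neg {s} {l} s→l δ 0<δ with s→l δ 0<δ
    ... | N , bound = N , λ n N≤n →
      ⊑-resp-≈ (solveᴬ 2 (λ s l → ⊝ (s ⊖ l) ⊜ ⊝ s ⊖ ⊝ l) 𝔸.refl (s n) l) (⊑-neg (bound n N≤n))

  private
    0<1+k+j : ∀ j k → 0# < 1# + suc k · 1# + suc j · 1#
    0<1+k+j j k = <-≤-trans 0<1 (≤-by (suc k · 1# + suc j · 1#)
      (+-nonneg (·-nonneg (suc k)) (·-nonneg (suc j))) (+-assoc _ _ _))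

  Lim-* : ∀ {s t l m} → Lim s l → Lim t m → Lim (λ n → s n *ᴬ t n) (l *ᴬ m)
  Lim-* {s} {t} {l} {m} s→l t→m δ 0<δ with ⊑-exists l | ⊑-exists m
  -- st - lm = (s - l)(t - m) + (s - l) m + l (t - m). Once |s - l| ≤ 1 and both errors are at most
  -- η, this is at most (1 + B + A) η for the integer bounds A, B of l, m; hence η is δ divided by
  -- that constant.
  ... | j , l⊑A | k , m⊑B with positive-inverse (0<1+k+j j k)
  ... | y , 0<y , Ky≈1 with s→l 1# 0<1 | s→l (y * δ) (*-positive 0<y 0<δ) | t→m (y * δ) (*-positive 0<y 0<δ)
  ... | L , s-bound₁ | M , s-bound | N , t-bound = L ℕ.⊔ M ℕ.⊔ N , bound
    where
    η = y * δ
    η-bound : 1# * η + η * (suc k · 1#) + (suc j · 1#) * η ≤ δ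
    η-bound = ≤-reflexive (trans
      (solve 4 (λ y δ A B → con (+ 1) :* (y :* δ) :+ y :* δ :* B :+ A :* (y :* δ) := (con (+ 1) :+ B :+ A) :* y :* δ) refl
        y δ (suc j · 1#) (suc k · 1#))
      (trans (*-congʳ Ky≈1) (*-identityˡ δ)))
    bound : ∀ n → L ℕ.⊔ M ℕ.⊔ N ℕ.≤ n → s n *ᴬ t n -ᴬ l *ᴬ m ⊑ δ
    bound n p = ⊑-resp-≈
        (solveᴬ 4 (λ s t l m → (s ⊖ l) ⊗ (t ⊖ m) ⊕ (s ⊖ l) ⊗ m ⊕ l ⊗ (t ⊖ m) ⊜ s ⊗ t ⊖ l ⊗ m) 𝔸.refl (s n) (t n) l m)
        (⊑-weaken η-bound (⊑-+ (⊑-+ (⊑-* (s-bound₁ n L≤n) (t-bound n N≤n)) (⊑-* (s-bound n M≤n) m⊑B)) (⊑-* l⊑A (t-bound n N≤n))))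
      where
      L⊔M≤n = ℕₚ.m⊔n≤o⇒m≤o (L ℕ.⊔ M) N p
      L≤n = ℕₚ.m⊔n≤o⇒m≤o L M L⊔M≤n
      M≤n = ℕₚ.m⊔n≤o⇒n≤o L M L⊔M≤n
      N≤n = ℕₚ.m⊔n≤o⇒n≤o (L ℕ.⊔ M) N p

  Lim-^ : ∀ {s l} n → Lim s l → Lim (λ k → s k ^ n) (l ^ n)
  Lim-^ zero    s→l = Lim-const 1ᴬ
  Lim-^ (suc n) s→l = Lim-* s→l (Lim-^ n s→l)

  Lim-zero : ∀ {s l b} → Lim s l → Null b → (∀ n → s n ⊑ b n) → l ≈ᴬ 0ᴬ
  Lim-zero {s} {l} s→l b→0 s⊑b = ⊑-limit bound
    where
    bound : ∀ δ → 0# < δ → l ⊑ δ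
    bound δ 0<δ with halve 0<δ
    ... | η , 0<η , η+η≈δ with s→l η 0<η | b→0 η 0<η
    ... | M , s-bound | N , b-bound =
      ⊑-resp-≈ (solveᴬ 2 (λ s l → s ⊕ ⊝ (s ⊖ l) ⊜ l) 𝔸.refl (s n) l)
        (⊑-weaken (≤-reflexive η+η≈δ)
          (⊑-+ (⊑-weaken (b-bound n (ℕₚ.m≤n⊔m M N)) (s⊑b n)) (⊑-neg (s-bound n (ℕₚ.m≤m⊔n M N)))))
      where n = M ℕ.⊔ N

  Lim-unique : ∀ {s l m} → Lim s l → Lim s m → l ≈ᴬ m
  Lim-unique {s} {l} {m} s→l s→m = 𝔸.trans
    (solveᴬ 2 (λ l m → l ⊜ (l ⊖ m) ⊕ m) 𝔸.refl l m)
    (𝔸.trans (𝔸.+-congʳ l-m≈0) (𝔸.+-identityˡ m))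
    where
    l-m≈0 : l -ᴬ m ≈ᴬ 0ᴬ
    l-m≈0 = Lim-zero {b = λ _ → 0#} (Lim-+ s→l (Lim-neg s→m)) (λ δ 0<δ → 0 , λ _ _ → <⇒≤ 0<δ)
      (λ n → ⊑-resp-≈ (𝔸.sym (𝔸.-‿inverseʳ (s n))) (⊑-zero ≤-refl))

  telescope-⊑ : ∀ {a : ℕ → A} {b : ℕ → ℝ} n k → (∀ m → n ℕ.≤ m → a m ⊑ b m - b (suc m)) →
    Σ< (k ℕ.+ n) a -ᴬ Σ< n a ⊑ b n - b (k ℕ.+ n)
  telescope-⊑ {a} {b} n zero dom = ⊑-resp-≈ (𝔸.sym (𝔸.-‿inverseʳ _)) (⊑-zero (≤-reflexive (sym (-‿inverseʳ _))))
  telescope-⊑ {a} {b} n (suc k) dom = ⊑-resp-≈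
    (solveᴬ 3 (λ s a t → (s ⊖ t) ⊕ a ⊜ s ⊕ a ⊖ t) 𝔸.refl (Σ< (k ℕ.+ n) a) (a (k ℕ.+ n)) (Σ< n a))
    (⊑-weaken (≤-reflexive (solve 3 (λ x y z → x :- y :+ (y :- z) := x :- z) refl (b n) (b (k ℕ.+ n)) (b (suc (k ℕ.+ n)))))
      (⊑-+ (telescope-⊑ n k dom) (dom (k ℕ.+ n) (ℕₚ.m≤n+m n k))))

  opaque
    -- From n ≥ M on, any block of terms starting at n has norm at most `b n`, because the majorants
    -- telescope. Both the exponential and the theta series converge by this criterion.
    telescoping-series : ∀ {a : ℕ → A} {b : ℕ → ℝ} M → (∀ m → M ℕ.≤ m → a m ⊑ b m - b (suc m)) → (∀ m → 0# ≤ b m) → Null b →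
      ∃[ l ] Lim (λ n → Σ< n a) l
    telescoping-series {a} {b} M dom 0≤b b→0 = completeᴬ _ cauchy
      where
      ordered : ∀ {δ} m n → M ℕ.≤ n → n ℕ.≤ m → b n ≤ δ → Σ< m a -ᴬ Σ< n a ⊑ δ
      ordered m n M≤n n≤m bn≤δ = ⊑-weaken (≤-trans (≤-by (b m) (0≤b m) (solve 2 (λ x y → x := x :- y :+ y) refl (b n) (b m))) bn≤δ)
        (≡.subst (λ m → Σ< m a -ᴬ Σ< n a ⊑ b n - b m) (ℕₚ.m∸n+n≡m n≤m)
          (telescope-⊑ n (m ℕ.∸ n) λ k n≤k → dom k (ℕₚ.≤-trans M≤n n≤k)))
      cauchy : Cauchyᴬ (λ n → Σ< n a)
      cauchy δ 0<δ = M ℕ.⊔ N , both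
        where
        N : ℕ
        N = proj₁ (b→0 δ 0<δ)
        both : ∀ m n → M ℕ.⊔ N ℕ.≤ m → M ℕ.⊔ N ℕ.≤ n → Σ< m a -ᴬ Σ< n a ⊑ δ
        both m n K≤m K≤n with ℕₚ.≤-total n m
        ... | inj₁ n≤m = ordered m n (ℕₚ.m⊔n≤o⇒m≤o M N K≤n) n≤m (proj₂ (b→0 δ 0<δ) n (ℕₚ.m⊔n≤o⇒n≤o M N K≤n))
        ... | inj₂ m≤n = ⊑-resp-≈ (solveᴬ 2 (λ s t → ⊝ (s ⊖ t) ⊜ t ⊖ s) 𝔸.refl (Σ< n a) (Σ< m a))
          (⊑-neg (ordered n m (ℕₚ.m⊔n≤o⇒m≤o M N K≤m) m≤n (proj₂ (b→0 δ 0<δ) m (ℕₚ.m⊔n≤o⇒n≤o M N K≤m))))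

-- Cauchy products of sequences.

module Convolutions {c ℓ} (R : CommutativeRing c ℓ) where
  open CommutativeRing R
  open FiniteSums R
  open IntegerCoefficients R
  open SetoidReasoning setoid

  conv : (ℕ → Carrier) → (ℕ → Carrier) → ℕ → Carrier
  conv a b zero    = a 0 * b 0
  conv a b (suc n) = a 0 * b (suc n) + conv (a ∘ suc) b n

  -- The sum of a i * b j over i + j < n.
  tri : (ℕ → Carrier) → (ℕ → Carrier) → ℕ → Carrier
  tri a b zero    = 0#
  tri a b (suc n) = a 0 * Σ< (suc n) b + tri (a ∘ suc) b n

  conv-cong : ∀ {a a′ b b′} n → (∀ k → a k ≈ a′ k) → (∀ k → b k ≈ b′ k) → conv a b n ≈ conv a′ b′ n
  conv-cong zero    p q = *-cong (p 0) (q 0)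
  conv-cong (suc n) p q = +-cong (*-cong (p 0) (q (suc n))) (conv-cong n (p ∘ suc) q)

  conv-+ˡ : ∀ a a′ b n → conv (λ k → a k + a′ k) b n ≈ conv a b n + conv a′ b n
  conv-+ˡ a a′ b zero    = distribʳ _ _ _
  conv-+ˡ a a′ b (suc n) = trans (+-congˡ (conv-+ˡ (a ∘ suc) (a′ ∘ suc) b n))
    (solve 5 (λ x y z u v → (x :+ y) :* z :+ (u :+ v) := x :* z :+ u :+ (y :* z :+ v)) refl
      (a 0) (a′ 0) (b (suc n)) (conv (a ∘ suc) b n) (conv (a′ ∘ suc) b n))

  conv-scaleˡ : ∀ x a b n → conv (λ k → x * a k) b n ≈ x * conv a b n
  conv-scaleˡ x a b zero    = *-assoc _ _ _
  conv-scaleˡ x a b (suc n) = trans (+-cong (*-assoc _ _ _) (conv-scaleˡ x (a ∘ suc) b n)) (sym (distribˡ _ _ _))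

  conv-scaleʳ : ∀ x a b n → conv a (λ k → x * b k) n ≈ x * conv a b n
  conv-scaleʳ x a b zero    = solve 3 (λ x a b → a :* (x :* b) := x :* (a :* b)) refl x (a 0) (b 0)
  conv-scaleʳ x a b (suc n) = trans (+-congˡ (conv-scaleʳ x (a ∘ suc) b n))
    (solve 4 (λ x a b s → a :* (x :* b) :+ x :* s := x :* (a :* b :+ s)) refl x (a 0) (b (suc n)) (conv (a ∘ suc) b n))

  conv-last : ∀ a b n → conv a b (suc n) ≈ conv a (b ∘ suc) n + a (suc n) * b 0
  conv-last a b zero    = refl
  conv-last a b (suc n) = trans (+-congˡ (conv-last (a ∘ suc) b n)) (sym (+-assoc _ _ _))

  module _ (ν : ℕ → Carrier) (ν-zero : ν 0 ≈ 0#) (ν-suc : ∀ n → ν (suc n) ≈ 1# + ν n) where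

    θ : (ℕ → Carrier) → ℕ → Carrier
    θ a n = ν n * a n

    private
      θ-vanishes : ∀ a → θ a 0 ≈ 0#
      θ-vanishes a = trans (*-congʳ ν-zero) (zeroˡ _)

    -- θ is x d/dx on generating functions, so it is a derivation.
    conv-leibniz : ∀ a b n → ν n * conv a b n ≈ conv (θ a) b n + conv a (θ b) n
    conv-leibniz a b zero = begin
      ν 0 * (a 0 * b 0)                   ≈⟨ trans (*-congʳ ν-zero) (zeroˡ _) ⟩
      0#                                  ≈⟨ solve 2 (λ x y → con (+ 0) := con (+ 0) :* x :+ y :* con (+ 0)) refl (b 0) (a 0) ⟩
      0# * b 0 + a 0 * 0#                 ≈⟨ +-cong (*-congʳ (θ-vanishes a)) (*-congˡ (θ-vanishes b)) ⟨
      θ a 0 * b 0 + a 0 * θ b 0           ∎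
    conv-leibniz a b (suc n) = begin
      ν (suc n) * (x * y + C)                  ≈⟨ distribˡ _ _ _ ⟩
      ν (suc n) * (x * y) + ν (suc n) * C      ≈⟨ +-congˡ (*-congʳ (ν-suc n)) ⟩
      ν (suc n) * (x * y) + (1# + ν n) * C
        ≈⟨ solve 5 (λ k x y m C → k :* (x :* y) :+ (con (+ 1) :+ m) :* C := x :* (k :* y) :+ C :+ m :* C) refl (ν (suc n)) x y (ν n) C ⟩
      x * (ν (suc n) * y) + C + ν n * C        ≈⟨ +-congˡ (conv-leibniz (a ∘ suc) b n) ⟩
      x * (ν (suc n) * y) + C + (D + E)
        ≈⟨ solve 5 (λ p y C D E → p :+ C :+ (D :+ E) := con (+ 0) :* y :+ (D :+ C) :+ (p :+ E)) refl (x * (ν (suc n) * y)) y C D E ⟩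
      0# * y + (D + C) + (x * θ b (suc n) + E) ≈⟨ +-congʳ (+-cong (*-congʳ (θ-vanishes a)) shifted) ⟨
      θ a 0 * y + conv (θ a ∘ suc) b n + (x * θ b (suc n) + E) ∎
      where
      x = a 0
      y = b (suc n)
      C = conv (a ∘ suc) b n
      D = conv (θ (a ∘ suc)) b n
      E = conv (a ∘ suc) (θ b) n
      shifted : conv (θ a ∘ suc) b n ≈ D + C
      shifted = trans (conv-cong n (λ k → trans (*-congʳ (ν-suc k))
          (solve 2 (λ m x → (con (+ 1) :+ m) :* x := m :* x :+ x) refl (ν k) (a (suc k)))) (λ _ → refl))
        (conv-+ˡ (θ (a ∘ suc)) (a ∘ suc) b n)

    -- The hypothesis is the recursion (k + 1) aₖ₊₁ = x aₖ of the exponential series. The leading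
    -- product vanishes since ν 0 = 0, and the others are shifted by one index.
    conv-θˡ : ∀ {x} a b n → (∀ k → θ a (suc k) ≈ x * a k) → conv (θ a) b (suc n) ≈ x * conv a b n
    conv-θˡ a b n rec = trans (+-cong (trans (*-congʳ (θ-vanishes a)) (zeroˡ _))
      (trans (conv-cong n rec (λ _ → refl)) (conv-scaleˡ _ a b n))) (+-identityˡ _)

    conv-θʳ : ∀ {x} a b n → (∀ k → θ b (suc k) ≈ x * b k) → conv a (θ b) (suc n) ≈ x * conv a b n
    conv-θʳ a b n rec = trans (conv-last a (θ b) n) (trans (+-cong
      (trans (conv-cong n (λ _ → refl) rec) (conv-scaleʳ _ a b n))
      (trans (*-congˡ (θ-vanishes b)) (zeroʳ _))) (+-identityʳ _))

  tri-suc : ∀ a b n → tri a b (suc n) ≈ tri a b n + conv a b n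
  tri-suc a b zero    = solve 2 (λ a b → a :* (con (+ 0) :+ b) :+ con (+ 0) := con (+ 0) :+ a :* b) refl (a 0) (b 0)
  tri-suc a b (suc n) = trans (+-congˡ (tri-suc (a ∘ suc) b n))
    (solve 5 (λ a s b t c → a :* (s :+ b) :+ (t :+ c) := a :* s :+ t :+ (a :* b :+ c)) refl (a 0) (Σ< (suc n) b) (b (suc n))
      (tri (a ∘ suc) b n) (conv (a ∘ suc) b n))

  tri≈Σ<conv : ∀ a b n → tri a b n ≈ Σ< n (conv a b)
  tri≈Σ<conv a b zero    = refl
  tri≈Σ<conv a b (suc n) = trans (tri-suc a b n) (+-congʳ (tri≈Σ<conv a b n))

-- The terms of the exponential series, and the real series as a majorant.

module FactorialReciprocals {c ℓ₁ ℓ₂ ℓ₃} (R : RealNumbers c ℓ₁ ℓ₂ ℓ₃) where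
  open OrderedField R

  private
    cancel-factor : ∀ {N r s} n → 0# < N → (N * r ≈ 1#) → ((n · 1#) * N * s ≈ 1#) → (n · 1#) * s ≈ r
    cancel-factor {N} {r} {s} n 0<N Nr nNs = *-cancelˡ-≈ 0<N
      (trans (solve 3 (λ N n s → N :* (n :* s) := n :* N :* s) refl N (n · 1#) s) (trans nNs (sym Nr)))

  opaque
    recip-! : ℕ → ℝ
    recip-! n = recip (n !) {{n ℕₚ.!≢0}}

    recip-!≈recip : ∀ n → recip-! n ≈ recip (n !) {{n ℕₚ.!≢0}}
    recip-!≈recip n = refl

  recip-!-positive : ∀ n → 0# < recip-! n
  recip-!-positive n = <-respʳ-≈ (sym (recip-!≈recip n)) (recip-positive (n !) {{n ℕₚ.!≢0}})

  private
    *-recip-! : ∀ n → ((n !) · 1#) * recip-! n ≈ 1#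
    *-recip-! n = trans (*-congˡ (recip-!≈recip n)) (*-recip (n !) {{n ℕₚ.!≢0}})

  recip-!-zero : recip-! 0 ≈ 1#
  recip-!-zero = trans (trans (sym (*-identityˡ (recip-! 0))) (*-congʳ (sym (+-identityʳ 1#)))) (*-recip-! 0)

  recip-!-suc : ∀ n → (suc n · 1#) * recip-! (suc n) ≈ recip-! n
  recip-!-suc n = cancel-factor (suc n) (·-positive (n !) {{n ℕₚ.!≢0}}) (*-recip-! n)
    (trans (*-congʳ (sym (·-homo-* (suc n) (n !)))) (*-recip-! (suc n)))

module ExponentialSeries {c ℓ₁ ℓ₂ ℓ₃} (R : RealNumbers c ℓ₁ ℓ₂ ℓ₃) {a ℓ} (𝒜 : RealAlgebra R a ℓ) where
  open OrderedField R
  open FactorialReciprocals R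
  open RealAlgebra 𝒜
  open Convolutions algebra
  open IntegerCoefficients algebra using ()
    renaming (solve to solveᴬ; _:=_ to _⊜_; _:*_ to _⊗_)
  open RawSemiringDefs (RawRing.rawSemiring 𝔸.rawRing) using (_^_)
  open SetoidReasoning 𝔸.setoid

  term : A → ℕ → A
  term z n = ofℝ (recip-! n) *ᴬ z ^ n

  private
    ν : ℕ → A
    ν n = ofℝ (n · 1#)

    ν-suc : ∀ n → ν (suc n) ≈ᴬ 1ᴬ +ᴬ ν n
    ν-suc n = 𝔸.trans (ofℝ-+ _ _) (𝔸.+-congʳ ofℝ-1)

    ν-cancel : ∀ {x y} n → ν (suc n) *ᴬ x ≈ᴬ ν (suc n) *ᴬ y → x ≈ᴬ y
    ν-cancel {x} {y} n e = 𝔸.trans (𝔸.sym (unit x)) (𝔸.trans (𝔸.*-congˡ e) (unit y))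
      where
      unit : ∀ x → ofℝ (recip (suc n)) *ᴬ (ν (suc n) *ᴬ x) ≈ᴬ x
      unit x = begin
        ofℝ (recip (suc n)) *ᴬ (ν (suc n) *ᴬ x)   ≈⟨ 𝔸.*-assoc _ _ _ ⟨
        ofℝ (recip (suc n)) *ᴬ ν (suc n) *ᴬ x     ≈⟨ 𝔸.*-congʳ (ofℝ-* _ _) ⟨
        ofℝ (recip (suc n) * (suc n · 1#)) *ᴬ x   ≈⟨ 𝔸.*-congʳ (ofℝ-cong (trans (*-comm _ _) (*-recip (suc n)))) ⟩
        ofℝ 1# *ᴬ x                               ≈⟨ 𝔸.*-congʳ ofℝ-1 ⟩
        1ᴬ *ᴬ x                                   ≈⟨ 𝔸.*-identityˡ x ⟩
        x                                         ∎

  term-zero : ∀ z → term z 0 ≈ᴬ 1ᴬ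
  term-zero z = 𝔸.trans (𝔸.*-identityʳ _) (𝔸.trans (ofℝ-cong recip-!-zero) ofℝ-1)

  term-suc : ∀ z n → ofℝ (suc n · 1#) *ᴬ term z (suc n) ≈ᴬ z *ᴬ term z n
  term-suc z n = begin
    ν (suc n) *ᴬ (ofℝ (recip-! (suc n)) *ᴬ (z *ᴬ z ^ n))
      ≈⟨ solveᴬ 4 (λ m r z p → m ⊗ (r ⊗ (z ⊗ p)) ⊜ z ⊗ (m ⊗ r ⊗ p)) 𝔸.refl (ν (suc n)) (ofℝ (recip-! (suc n))) z (z ^ n) ⟩
    z *ᴬ (ν (suc n) *ᴬ ofℝ (recip-! (suc n)) *ᴬ z ^ n)
      ≈⟨ 𝔸.*-congˡ (𝔸.*-congʳ (𝔸.trans (𝔸.sym (ofℝ-* _ _)) (ofℝ-cong (recip-!-suc n)))) ⟩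
    z *ᴬ (ofℝ (recip-! n) *ᴬ z ^ n) ∎

  term-cong : ∀ {z w} n → z ≈ᴬ w → term z n ≈ᴬ term w n
  term-cong n z≈w = 𝔸.*-congˡ (^-congˡ n z≈w)
    where open SemiringExp 𝔸.semiring using (^-congˡ)

  -- Both sides satisfy (n + 1) x₍ₙ₊₁₎ = (z + w) xₙ.
  conv-term : ∀ z w n → conv (term z) (term w) n ≈ᴬ term (z +ᴬ w) n
  conv-term z w zero = 𝔸.trans (𝔸.*-cong (term-zero z) (term-zero w))
    (𝔸.trans (𝔸.*-identityˡ 1ᴬ) (𝔸.sym (term-zero (z +ᴬ w))))
  conv-term z w (suc n) = ν-cancel n (begin
    ν (suc n) *ᴬ conv (term z) (term w) (suc n)   ≈⟨ conv-leibniz ν ofℝ-0 ν-suc (term z) (term w) (suc n) ⟩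
    conv (θ′ (term z)) (term w) (suc n) +ᴬ conv (term z) (θ′ (term w)) (suc n)
      ≈⟨ 𝔸.+-cong (conv-θˡ ν ofℝ-0 ν-suc (term z) (term w) n (term-suc z)) (conv-θʳ ν ofℝ-0 ν-suc (term z) (term w) n (term-suc w)) ⟩
    z *ᴬ C +ᴬ w *ᴬ C                              ≈⟨ 𝔸.distribʳ C z w ⟨
    (z +ᴬ w) *ᴬ C                                 ≈⟨ 𝔸.*-congˡ (conv-term z w n) ⟩
    (z +ᴬ w) *ᴬ term (z +ᴬ w) n                   ≈⟨ term-suc (z +ᴬ w) n ⟨
    ν (suc n) *ᴬ term (z +ᴬ w) (suc n)            ∎)
    where
    C = conv (term z) (term w) n
    θ′ = θ ν ofℝ-0 ν-suc

ℝ-algebra : ∀ {c ℓ₁ ℓ₂ ℓ₃} (R : RealNumbers c ℓ₁ ℓ₂ ℓ₃) → RealAlgebra R c ℓ₁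
ℝ-algebra R = record
  { algebra = commutativeRing ; ofℝ = λ x → x ; ofℝ-cong = λ e → e
  ; ofℝ-+ = λ _ _ → refl ; ofℝ-* = λ _ _ → refl ; ofℝ-1 = refl }
  where open RealNumbers R

module RealExponentialSeries {c ℓ₁ ℓ₂ ℓ₃} (R : RealNumbers c ℓ₁ ℓ₂ ℓ₃) where
  open OrderedField R
  open FactorialReciprocals R
  open NullSequences R
  open FiniteSums commutativeRing
  open Convolutions commutativeRing
  open RawSemiringDefs (RawRing.rawSemiring rawRing) using (_^_)
  open ExponentialSeries R (ℝ-algebra R) public

  ^-nonneg : ∀ {x} n → 0# ≤ x → 0# ≤ x ^ n
  ^-nonneg zero    0≤x = <⇒≤ 0<1
  ^-nonneg (suc n) 0≤x = *-nonneg 0≤x (^-nonneg n 0≤x)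

  term-nonneg : ∀ {x} n → 0# ≤ x → 0# ≤ term x n
  term-nonneg n 0≤x = *-nonneg (<⇒≤ (recip-!-positive n)) (^-nonneg n 0≤x)

  module _ (k : ℕ) where
    private
      K = suc k · 1#
      M = suc k ℕ.+ suc k

    -- From n ≥ M = 2K on, the ratio K / (n + 1) of consecutive terms is at most 1/2.
    term-halves : ∀ n → M ℕ.≤ n → term K (suc n) + term K (suc n) ≤ term K n
    term-halves n M≤n = *-cancelˡ-≤ (suc-positive k) (≤-trans
      (≤-respˡ (trans (*-congʳ (·-homo-+ (suc k) (suc k))) (solve 2 (λ K t → (K :+ K) :* t := K :* (t :+ t)) refl K (term K (suc n))))
        (*-monoʳ-≤ (term-nonneg (suc n) (·-nonneg (suc k))) (·-mono-≤ (ℕₚ.m≤n⇒m≤1+n M≤n))))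
      (≤-reflexive (term-suc K n)))

    term-decreases : ∀ j → term K (j ℕ.+ M) ≤ term K M
    term-decreases zero    = ≤-refl
    term-decreases (suc j) = ≤-trans (≤-trans
      (≤-by (term K (suc (j ℕ.+ M))) (term-nonneg (suc (j ℕ.+ M)) (·-nonneg (suc k))) refl)
      (term-halves (j ℕ.+ M) (ℕₚ.m≤n+m M j))) (term-decreases j)

    term-null : Null (term K)
    term-null δ 0<δ =
      from-bound (Null-scale (*-nonneg (·-nonneg (suc k)) (term-nonneg M (·-nonneg (suc k)))) Null-recip δ 0<δ)
      where
      from-bound : ∃[ N ] (∀ n → N ℕ.≤ n → K * term K M * recip (suc n) ≤ δ) → ∃[ N ] ∀ n → N ℕ.≤ n → term K n ≤ δ
      from-bound (N , bound) = suc (M ℕ.⊔ N) , small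
        where
        small : ∀ n → suc (M ℕ.⊔ N) ℕ.≤ n → term K n ≤ δ
        small (suc n) (ℕ.s≤s p) = ≤-trans (*-cancelˡ-≤ (suc-positive n) (≤-respˡ (sym (term-suc K n))
            (≤-respʳ e (*-monoˡ-≤ (·-nonneg (suc k)) decreased))))
            (bound n (ℕₚ.m⊔n≤o⇒n≤o M N p))
          where
          decreased : term K n ≤ term K M
          decreased = ≡.subst (λ n → term K n ≤ term K M) (ℕₚ.m∸n+n≡m (ℕₚ.m⊔n≤o⇒m≤o M N p)) (term-decreases (n ℕ.∸ M))
          e : K * term K M ≈ (suc n · 1#) * (K * term K M * recip (suc n))
          e = trans (sym (*-identityʳ _)) (trans (*-congˡ (sym (*-recip (suc n))))
            (solve 3 (λ x n r → x :* (n :* r) := n :* (x :* r)) refl (K * term K M) (suc n · 1#) (recip (suc n))))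

    -- A nonnegative series whose terms at least halve has its remainder from n on bounded by twice
    -- the n-th term. Halving also says that the n-th term is at most the drop of `tail`, which
    -- makes it a telescoping majorant.
    tail : ℕ → ℝ
    tail n = term K n + term K n

    tail-nonneg : ∀ n → 0# ≤ tail n
    tail-nonneg n = +-nonneg (term-nonneg n (·-nonneg (suc k))) (term-nonneg n (·-nonneg (suc k)))

    tail-null : Null tail
    tail-null = Null-≤ (λ n → ≤-reflexive (solve 1 (λ t → t :+ t := (con (+ 1) :+ con (+ 1)) :* t) refl (term K n)))
      (Null-scale (+-nonneg (<⇒≤ 0<1) (<⇒≤ 0<1)) term-null)

    term≤tail-difference : ∀ n → M ℕ.≤ n → term K n ≤ tail n - tail (suc n)
    term≤tail-difference n M≤n = ≤-by (t - (s + s)) (0≤y-x (term-halves n M≤n))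
      (solve 2 (λ t s → t :+ t :- (s :+ s) := t :+ (t :- (s :+ s))) refl t s)
      where
      t = term K n
      s = term K (suc n)

    Σ<-tail-bound : ∀ n j → M ℕ.≤ n → Σ< (j ℕ.+ n) (term K) - Σ< n (term K) ≤ tail n
    Σ<-tail-bound n j M≤n = ≤-trans (telescope j) (≤-by (tail (j ℕ.+ n)) (tail-nonneg (j ℕ.+ n))
        (solve 2 (λ x y → x := x :- y :+ y) refl (tail n) (tail (j ℕ.+ n))))
      where
      telescope : ∀ j → Σ< (j ℕ.+ n) (term K) - Σ< n (term K) ≤ tail n - tail (j ℕ.+ n)
      telescope zero = ≤-reflexive (trans (-‿inverseʳ _) (sym (-‿inverseʳ _)))
      telescope (suc j) = ≤-respˡ (solve 3 (λ x t y → x :- y :+ t := x :+ t :- y) refl (Σ< (j ℕ.+ n) (term K)) (term K (j ℕ.+ n)) (Σ< n (term K)))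
        (≤-respʳ (solve 3 (λ x y z → x :- y :+ (y :- z) := x :- z) refl (tail n) (tail (j ℕ.+ n)) (tail (suc (j ℕ.+ n))))
          (+-mono-≤ (telescope j) (term≤tail-difference (j ℕ.+ n) (ℕₚ.≤-trans M≤n (ℕₚ.m≤n+m n j)))))

  Σ<-nonneg : ∀ {f} n → (∀ k → 0# ≤ f k) → 0# ≤ Σ< n f
  Σ<-nonneg zero    0≤f = ≤-refl
  Σ<-nonneg (suc n) 0≤f = +-nonneg (Σ<-nonneg n 0≤f) (0≤f n)

  Σ<-mono : ∀ {f} n j → (∀ k → 0# ≤ f k) → Σ< n f ≤ Σ< (j ℕ.+ n) f
  Σ<-mono n zero    0≤f = ≤-refl
  Σ<-mono n (suc j) 0≤f = ≤-trans (Σ<-mono n j 0≤f) (≤-by _ (0≤f (j ℕ.+ n)) refl)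

  tri-nonneg : ∀ {f g} n → (∀ k → 0# ≤ f k) → (∀ k → 0# ≤ g k) → 0# ≤ tri f g n
  tri-nonneg zero    0≤f 0≤g = ≤-refl
  tri-nonneg (suc n) 0≤f 0≤g = +-nonneg (*-nonneg (0≤f 0) (Σ<-nonneg (suc n) 0≤g)) (tri-nonneg n (0≤f ∘ suc) 0≤g)

  -- Indices i < n and j < m satisfy i + j < n + m, and the additional products in the triangle are
  -- nonnegative.
  rectangle≤tri : ∀ {f g} n m → (∀ k → 0# ≤ f k) → (∀ k → 0# ≤ g k) → Σ< n f * Σ< m g ≤ tri f g (n ℕ.+ m)
  rectangle≤tri zero m 0≤f 0≤g = ≤-respˡ (sym (zeroˡ _)) (tri-nonneg m 0≤f 0≤g)
  rectangle≤tri {f} {g} (suc n) m 0≤f 0≤g = ≤-respˡ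
    (trans (sym (distribʳ _ _ _)) (*-congʳ (sym (Σ<-front n f))))
    (+-mono-≤ (*-monoˡ-≤ (0≤f 0) (Σ<-mono m (suc n) 0≤g)) (rectangle≤tri n m (0≤f ∘ suc) 0≤g))

-- The exponential function of a complete normed algebra and its addition formula.

module Exponential {c ℓ₁ ℓ₂ ℓ₃} (R : RealNumbers c ℓ₁ ℓ₂ ℓ₃) {a ℓ m} (𝒜 : NormedAlgebra R a ℓ m) where
  open OrderedField R
  open FactorialReciprocals R
  open NormedAlgebra 𝒜
  open Limits R 𝒜
  open FiniteSums algebra
  open Convolutions algebra
  open IntegerCoefficients algebra using ()
    renaming (solve to solveᴬ; _:=_ to _⊜_; _:+_ to _⊕_; _:*_ to _⊗_; _:-_ to _⊖_; :-_ to ⊝_; con to κ)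
  open RawSemiringDefs (RawRing.rawSemiring 𝔸.rawRing) using (_^_)
  open RawSemiringDefs (RawRing.rawSemiring rawRing) using () renaming (_^_ to _^ᴿ_)
  open ExponentialSeries R realAlgebra
  module ℝΣ = FiniteSums commutativeRing
  module ℝC = Convolutions commutativeRing
  module ℝE = RealExponentialSeries R

  ⊑-^ : ∀ {z b} n → z ⊑ b → z ^ n ⊑ b ^ᴿ n
  ⊑-^ zero    z⊑b = ⊑-resp-≈ ofℝ-1 (⊑-ofℝ (<⇒≤ 0<1))
  ⊑-^ (suc n) z⊑b = ⊑-* z⊑b (⊑-^ n z⊑b)

  term-⊑ : ∀ {z b} n → z ⊑ b → term z n ⊑ ℝE.term b n
  term-⊑ n z⊑b = ⊑-* (⊑-ofℝ (<⇒≤ (recip-!-positive n))) (⊑-^ n z⊑b)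

  Σ<-⊑ : ∀ {f g} m j → (∀ k → f k ⊑ g k) → Σ< (j ℕ.+ m) f -ᴬ Σ< m f ⊑ ℝΣ.Σ< (j ℕ.+ m) g - ℝΣ.Σ< m g
  Σ<-⊑ {f} {g} m zero f⊑g = ⊑-resp-≈ (𝔸.sym (𝔸.-‿inverseʳ (Σ< m f))) (⊑-zero (≤-reflexive (sym (-‿inverseʳ (ℝΣ.Σ< m g)))))
  Σ<-⊑ {f} {g} m (suc j) f⊑g = ⊑-resp-≈
    (solveᴬ 3 (λ s a t → (s ⊖ t) ⊕ a ⊜ s ⊕ a ⊖ t) 𝔸.refl (Σ< (j ℕ.+ m) f) (f (j ℕ.+ m)) (Σ< m f))
    (⊑-weaken (≤-reflexive (solve 3 (λ s a t → s :- t :+ a := s :+ a :- t) refl (ℝΣ.Σ< (j ℕ.+ m) g) (g (j ℕ.+ m)) (ℝΣ.Σ< m g)))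
      (⊑-+ (Σ<-⊑ m j f⊑g) (f⊑g (j ℕ.+ m))))

  -- The rectangle contains the triangle, so the difference is a sum of products f i g j, each
  -- dominated by f* i g* j. Removing the first row shortens the triangle but not the rows of the
  -- rectangle; the surplus width `j` makes the induction go through.
  rectangle-tri-⊑ : ∀ {f f* g g*} n j → (∀ k → f k ⊑ f* k) → (∀ k → g k ⊑ g* k) →
    Σ< n f *ᴬ Σ< (j ℕ.+ n) g -ᴬ tri f g n ⊑ ℝΣ.Σ< n f* * ℝΣ.Σ< (j ℕ.+ n) g* - ℝC.tri f* g* n
  rectangle-tri-⊑ {f} {f*} {g} {g*} zero j f⊑ g⊑ =
    ⊑-resp-≈ (solveᴬ 1 (λ s → κ (+ 0) ⊜ κ (+ 0) ⊗ s ⊖ κ (+ 0)) 𝔸.refl (Σ< (j ℕ.+ 0) g))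
      (⊑-zero (≤-reflexive (solve 1 (λ s → con (+ 0) := con (+ 0) :* s :- con (+ 0)) refl (ℝΣ.Σ< (j ℕ.+ 0) g*))))
  rectangle-tri-⊑ {f} {f*} {g} {g*} (suc n) j f⊑ g⊑ = ⊑-resp-≈
    (𝔸.trans (solveᴬ 5 (λ a s u t v → a ⊗ (s ⊖ u) ⊕ (t ⊗ s ⊖ v) ⊜ (a ⊕ t) ⊗ s ⊖ (a ⊗ u ⊕ v)) 𝔸.refl
      (f 0) (Σ< (j ℕ.+ suc n) g) (Σ< (suc n) g) (Σ< n (f ∘ suc)) (tri (f ∘ suc) g n))
      (𝔸.+-congʳ (𝔸.*-congʳ (𝔸.sym (Σ<-front n f)))))
    (⊑-weaken (≤-reflexive (trans (solve 5 (λ a s u t v → a :* (s :- u) :+ (t :* s :- v) := (a :+ t) :* s :- (a :* u :+ v)) refl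
      (f* 0) (ℝΣ.Σ< (j ℕ.+ suc n) g*) (ℝΣ.Σ< (suc n) g*) (ℝΣ.Σ< n (f* ∘ suc)) (ℝC.tri (f* ∘ suc) g* n))
      (+-congʳ (*-congʳ (sym (ℝΣ.Σ<-front n f*))))))
      (⊑-+ (⊑-* (f⊑ 0) (Σ<-⊑ (suc n) j g⊑))
        (≡.subst (λ k → Σ< n (f ∘ suc) *ᴬ Σ< k g -ᴬ tri (f ∘ suc) g n ⊑ ℝΣ.Σ< n (f* ∘ suc) * ℝΣ.Σ< k g* - ℝC.tri (f* ∘ suc) g* n)
          (≡.sym (ℕₚ.+-suc j n)) (rectangle-tri-⊑ n (suc j) (f⊑ ∘ suc) g⊑))))

  ofℝ-^ : ∀ x n → ofℝ (x ^ᴿ n) ≈ᴬ ofℝ x ^ n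
  ofℝ-^ x zero    = ofℝ-1
  ofℝ-^ x (suc n) = 𝔸.trans (ofℝ-* x (x ^ᴿ n)) (𝔸.*-congˡ (ofℝ-^ x n))

  ofℝ-term : ∀ x n → ofℝ (ℝE.term x n) ≈ᴬ term (ofℝ x) n
  ofℝ-term x n = 𝔸.trans (ofℝ-* (recip-! n) (x ^ᴿ n)) (𝔸.*-congˡ (ofℝ-^ x n))

  ofℝ-Σ<-term : ∀ x n → ofℝ (ℝΣ.Σ< n (ℝE.term x)) ≈ᴬ Σ< n (term (ofℝ x))
  ofℝ-Σ<-term x zero    = ofℝ-0
  ofℝ-Σ<-term x (suc n) = 𝔸.trans (ofℝ-+ _ _) (𝔸.+-cong (ofℝ-Σ<-term x n) (ofℝ-term x n))

  HasExp : A → A → Set (c ⊔ ℓ₃ ⊔ m)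
  HasExp z w = Lim (λ n → Σ< n (term z)) w

  opaque
    exp-exists : ∀ z → ∃[ w ] HasExp z w
    exp-exists z with ⊑-exists z
    ... | k , z⊑K = telescoping-series (suc k ℕ.+ suc k)
      (λ n M≤n → ⊑-weaken (ℝE.term≤tail-difference k n M≤n) (term-⊑ n z⊑K))
      (ℝE.tail-nonneg k) (ℝE.tail-null k)

  opaque
    exp : A → A
    exp z = proj₁ (exp-exists z)

    exp-series : ∀ z → HasExp z (exp z)
    exp-series z = proj₂ (exp-exists z)

  HasExp⇒≈exp : ∀ {z w} → HasExp z w → w ≈ᴬ exp z
  HasExp⇒≈exp {z} h = Lim-unique h (exp-series z)

  exp-cong : ∀ {z w} → z ≈ᴬ w → exp z ≈ᴬ exp w
  exp-cong {z} {w} z≈w = HasExp⇒≈exp (Lim-cong (λ n → Σ<-cong n (λ k → term-cong k z≈w)) (exp-series z))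

  private
    -- For the majorants, the rectangle is at most the triangle of size 2n. By the binomial identity
    -- over the reals both triangles are partial sums of one exponential series, at the sum of the
    -- two bounds, so their difference is a piece of its tail.
    rectangle-bound : ∀ {z w} j k → z ⊑ suc j · 1# → w ⊑ suc k · 1# →
      Lim (λ n → Σ< n (term z) *ᴬ Σ< n (term w) -ᴬ tri (term z) (term w) n) 0ᴬ
    rectangle-bound {z} {w} j k z⊑ w⊑ = squeeze (suc l ℕ.+ suc l) (ℝE.tail-null l) λ n M≤n →
        ⊑-resp-≈ (solveᴬ 1 (λ x → x ⊜ x ⊖ κ (+ 0)) 𝔸.refl _)
          (⊑-weaken (≤-trans (≤-trans
              (+-monoˡ-≤ (- ℝC.tri f* g* n) (ℝE.rectangle≤tri n n (λ i → ℝE.term-nonneg i (·-nonneg (suc j))) (λ i → ℝE.term-nonneg i (·-nonneg (suc k)))))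
              (≤-reflexive (+-cong (tri≈ (n ℕ.+ n)) (-‿cong (tri≈ n)))))
              (ℝE.Σ<-tail-bound l n n M≤n))
            (rectangle-tri-⊑ n 0 (λ i → term-⊑ i z⊑) (λ i → term-⊑ i w⊑)))
      where
      l = j ℕ.+ suc k
      f* = ℝE.term (suc j · 1#)
      g* = ℝE.term (suc k · 1#)
      tri≈ : ∀ n → ℝC.tri f* g* n ≈ ℝΣ.Σ< n (ℝE.term (suc l · 1#))
      tri≈ n = trans (ℝC.tri≈Σ<conv f* g* n) (ℝΣ.Σ<-cong n λ i →
        trans (ℝE.conv-term (suc j · 1#) (suc k · 1#) i) (ℝE.term-cong i (sym (·-homo-+ (suc j) (suc k)))))

  opaque
    exp-+ : ∀ z w → exp (z +ᴬ w) ≈ᴬ exp z *ᴬ exp w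
    exp-+ z w with ⊑-exists z | ⊑-exists w
    ... | j , z⊑ | k , w⊑ = 𝔸.sym (HasExp⇒≈exp (Lim-congʳ (solveᴬ 1 (λ x → x ⊕ ⊝ κ (+ 0) ⊜ x) 𝔸.refl (exp z *ᴬ exp w))
        (Lim-cong triangle (Lim-+ (Lim-* (exp-series z) (exp-series w)) (Lim-neg (rectangle-bound j k z⊑ w⊑))))))
      where
      triangle : ∀ n → Σ< n (term z) *ᴬ Σ< n (term w) +ᴬ -ᴬ (Σ< n (term z) *ᴬ Σ< n (term w) -ᴬ tri (term z) (term w) n)
        ≈ᴬ Σ< n (term (z +ᴬ w))
      triangle n = 𝔸.trans (solveᴬ 2 (λ x t → x ⊕ ⊝ (x ⊖ t) ⊜ t) 𝔸.refl (Σ< n (term z) *ᴬ Σ< n (term w)) (tri (term z) (term w) n))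
        (𝔸.trans (tri≈Σ<conv (term z) (term w) n) (Σ<-cong n (conv-term z w)))

  exp-0 : exp 0ᴬ ≈ᴬ 1ᴬ
  exp-0 = 𝔸.sym (HasExp⇒≈exp (λ δ 0<δ → 1 , λ n 1≤n → ⊑-resp-≈ (partial n 1≤n) (⊑-zero (<⇒≤ 0<δ))))
    where
    vanishes : ∀ n → term 0ᴬ (suc n) ≈ᴬ 0ᴬ
    vanishes n = solveᴬ 2 (λ r p → r ⊗ (κ (+ 0) ⊗ p) ⊜ κ (+ 0)) 𝔸.refl (ofℝ (recip-! (suc n))) (0ᴬ ^ n)
    total : ∀ n → Σ< (suc n) (term 0ᴬ) ≈ᴬ 1ᴬ
    total zero    = 𝔸.trans (𝔸.+-identityˡ _) (term-zero 0ᴬ)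
    total (suc n) = 𝔸.trans (𝔸.+-cong (total n) (vanishes n)) (𝔸.+-identityʳ 1ᴬ)
    partial : ∀ n → 1 ℕ.≤ n → 0ᴬ ≈ᴬ Σ< n (term 0ᴬ) -ᴬ 1ᴬ
    partial (suc n) _ = 𝔸.sym (𝔸.trans (𝔸.+-congʳ (total n)) (𝔸.-‿inverseʳ 1ᴬ))

-- Completeness of the complex numbers.

module ComplexNormedAlgebra {c ℓ₁ ℓ₂ ℓ₃} (R : RealNumbers c ℓ₁ ℓ₂ ℓ₃) where
  open ComplexNumbers R

  Limℂ : (ℕ → ℂ) → ℂ → Set (c ⊔ ℓ₃)
  Limℂ s l = ∀ δ → 0# < δ → ∃[ N ] ∀ n → N ℕ.≤ n → s n -ℂ l ⊑ δ

  private
    Converges-≤ : (ℕ → ℝ) → ℝ → Set (c ⊔ ℓ₃)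
    Converges-≤ s l = ∀ δ → 0# < δ → ∃[ N ] ∀ n → N ℕ.≤ n → (- δ ≤ s n - l) × (s n - l ≤ δ)

    real-limit : ∀ (s : ℕ → ℝ) → (∀ δ → 0# < δ → ∃[ N ] ∀ m n → N ℕ.≤ m → N ℕ.≤ n → (- δ ≤ s m - s n) × (s m - s n ≤ δ)) →
      ∃[ l ] Converges-≤ s l
    real-limit s cauchy = weaken (complete s strict)
      where
      strict : Cauchy s
      strict δ 0<δ with <-dense 0<δ
      ... | η , 0<η , η<δ with cauchy η 0<η
      ... | N , bound = N , λ m n N≤m N≤n →
        <-≤-trans (neg-mono-< η<δ) (proj₁ (bound m n N≤m N≤n)) , ≤-<-trans (proj₂ (bound m n N≤m N≤n)) η<δ
      weaken : ∃[ l ] Converges s l → ∃[ l ] Converges-≤ s l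
      weaken (l , s→l) = l , λ δ 0<δ → proj₁ (s→l δ 0<δ) , λ n N≤n →
        <⇒≤ (proj₁ (proj₂ (s→l δ 0<δ) n N≤n)) , <⇒≤ (proj₂ (proj₂ (s→l δ 0<δ) n N≤n))

    components : ∀ {s : ℕ → ℂ} {x y} → Converges-≤ (re ∘ s) x → Converges-≤ (im ∘ s) y → Limℂ s (x +i y)
    components re→x im→y δ 0<δ with halve 0<δ
    ... | η , 0<η , η+η≈δ with re→x η 0<η | im→y η 0<η
    ... | M , x-bound | N , y-bound = M ℕ.⊔ N , λ n p →
      let M≤n = ℕₚ.m⊔n≤o⇒m≤o M N p ; N≤n = ℕₚ.m⊔n≤o⇒n≤o M N p in
      ⊑-weaken (≤-reflexive η+η≈δ) (⊑-components (<⇒≤ 0<η)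
        (proj₁ (x-bound n M≤n)) (proj₂ (x-bound n M≤n)) (proj₁ (y-bound n N≤n)) (proj₂ (y-bound n N≤n)))

  opaque
    completeℂ : ∀ s → (∀ δ → 0# < δ → ∃[ N ] ∀ m n → N ℕ.≤ m → N ℕ.≤ n → s m -ℂ s n ⊑ δ) → ∃[ l ] Limℂ s l
    completeℂ s cauchy = join
        (real-limit (re ∘ s) λ δ 0<δ → proj₁ (cauchy δ 0<δ) , λ m n N≤m N≤n →
          ⊑-re⁻ (proj₂ (cauchy δ 0<δ) m n N≤m N≤n) , ⊑-re (proj₂ (cauchy δ 0<δ) m n N≤m N≤n))
        (real-limit (im ∘ s) λ δ 0<δ → proj₁ (cauchy δ 0<δ) , λ m n N≤m N≤n →
          ⊑-im⁻ (proj₂ (cauchy δ 0<δ) m n N≤m N≤n) , ⊑-im (proj₂ (cauchy δ 0<δ) m n N≤m N≤n))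
      where
      join : ∃[ x ] Converges-≤ (re ∘ s) x → ∃[ y ] Converges-≤ (im ∘ s) y → ∃[ l ] Limℂ s l
      join (x , re→x) (y , im→y) = x +i y , components re→x im→y

  ℂ-realAlgebra : RealAlgebra R c ℓ₁
  ℂ-realAlgebra = record
    { algebra = ℂ-commutativeRing
    ; ofℝ = ↑_
    ; ofℝ-cong = λ e → e , refl
    ; ofℝ-+ = λ x y → refl , sym (+-identityˡ 0#)
    ; ofℝ-* = λ x y → solve 2 (λ x y → x :* y := x :* y :- con (+ 0) :* con (+ 0)) refl x y
                    , solve 2 (λ x y → con (+ 0) := x :* con (+ 0) :+ con (+ 0) :* y) refl x y
    ; ofℝ-1 = refl , refl }

  ℂ-normedAlgebra : NormedAlgebra R c ℓ₁ ℓ₃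
  ℂ-normedAlgebra = record
    { realAlgebra = ℂ-realAlgebra ; _⊑_ = _⊑_ ; ⊑-nonneg = _⊑_.nonneg ; ⊑-resp-≈ = ⊑-resp-≈ ; ⊑-weaken = ⊑-weaken
    ; ⊑-zero = ⊑-zero ; ⊑-neg = ⊑-neg ; ⊑-+ = ⊑-+ ; ⊑-* = ⊑-* ; ⊑-exists = ⊑-exists ; ⊑-limit = ⊑-limit
    ; ⊑-ofℝ = ⊑-↑ ; completeᴬ = completeℂ }

-- The sums of the statement as limits of partial sums.

module ComplexSeries {c ℓ₁ ℓ₂ ℓ₃} (R : RealNumbers c ℓ₁ ℓ₂ ℓ₃) where
  open ComplexNumbers R
  open ComplexNormedAlgebra R
  open FiniteSums ℂ-commutativeRing

  sum≈Σ< : ∀ n a → sum {n} (λ k → a (toℕ k)) ≈ℂ Σ< n a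
  sum≈Σ< zero    a = ℂR.refl
  sum≈Σ< (suc n) a = ℂR.trans {a 0 +ℂ sum {n} (λ k → a (suc (toℕ k)))} {a 0 +ℂ Σ< n (a ∘ suc)} {Σ< (suc n) a}
    (ℂR.+-cong {a 0} {a 0} {sum {n} (λ k → a (suc (toℕ k)))} {Σ< n (a ∘ suc)} (refl , refl) (sum≈Σ< n (a ∘ suc)))
    (ℂR.sym {Σ< (suc n) a} {a 0 +ℂ Σ< n (a ∘ suc)} (Σ<-front n a))

  Lim⇒HasSumℕ : ∀ {a s} → Limℂ (λ n → Σ< n a) s → HasSumℕ a s
  Lim⇒HasSumℕ {a} {s} a→s δ 0<δ with <-dense 0<δ
  ... | η , 0<η , η<δ with a→s η 0<η
  ... | N , bound = N , λ n N≤n → ⊑⇒Within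
    (⊑-resp-≈ (ℂR.+-congʳ {x = -ℂ s} (ℂR.sym {sum {n} (λ k → a (toℕ k))} {Σ< n a} (sum≈Σ< n a))) (bound n N≤n)) η<δ

  HasSumℕ⇒Lim : ∀ {a s} → HasSumℕ a s → Limℂ (λ n → Σ< n a) s
  HasSumℕ⇒Lim {a} {s} a→s δ 0<δ = proj₁ (a→s δ 0<δ) , λ n N≤n →
    ⊑-resp-≈ (ℂR.+-congʳ {x = -ℂ s} (sum≈Σ< n a)) (Within⇒⊑ 0<δ (proj₂ (a→s δ 0<δ) n N≤n))

  Lim⇒HasSumℤ : ∀ {a s t} → Limℂ (λ n → Σ< n (λ k → a -[1+ k ])) s → Limℂ (λ n → Σ< n (λ k → a (+ k))) t →
    HasSumℤ a (s +ℂ t)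
  Lim⇒HasSumℤ {a} {s} {t} a⁻→s a⁺→t δ 0<δ with <-dense 0<δ
  ... | η , 0<η , η<δ with halve 0<η
  ... | η′ , 0<η′ , η′+η′≈η with a⁻→s η′ 0<η′ | a⁺→t η′ 0<η′
  ... | M , s-bound | N , t-bound = M ℕ.⊔ N , λ m n p q → ⊑⇒Within
      (⊑-resp-≈ (ℂR.trans {(S m -ℂ s) +ℂ (T n -ℂ t)} {S m +ℂ T n -ℂ (s +ℂ t)} {partialSumℤ a m n -ℂ (s +ℂ t)}
          (solveℂ 4 (λ x y s t → (x ⊖ s) ⊕ (y ⊖ t) ⊜ x ⊕ y ⊖ (s ⊕ t)) ℂR.refl (S m) (T n) s t)
          (ℂR.+-congʳ {x = -ℂ (s +ℂ t)} (ℂR.sym {partialSumℤ a m n} {S m +ℂ T n} (partialSum≈ m n))))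
        (⊑-weaken (≤-reflexive η′+η′≈η) (⊑-+
          (s-bound m (ℕₚ.m⊔n≤o⇒m≤o M N p)) (t-bound (suc n) (ℕₚ.m≤n⇒m≤1+n (ℕₚ.m⊔n≤o⇒n≤o M N q))))))
      η<δ
    where
    S T : ℕ → ℂ
    S m = Σ< m (λ k → a -[1+ k ])
    T n = Σ< (suc n) (λ k → a (+ k))
    partialSum≈ : ∀ m n → partialSumℤ a m n ≈ℂ S m +ℂ T n
    partialSum≈ m n = ℂR.+-cong {sum {m} (λ k → a -[1+ toℕ k ])} {S m} {sum {suc n} (λ k → a (+ toℕ k))} {T n}
      (sum≈Σ< m (λ k → a -[1+ k ])) (sum≈Σ< (suc n) (λ k → a (+ k)))

  -- The two ends are made equal: the identity is proved on symmetric partial sums over -n , ... ,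
  -- n, whose fifth powers are sums over a cube.
  HasSumℤ⇒Lim : ∀ {a s} → HasSumℤ a s → Limℂ (λ n → Σ< n (λ k → a -[1+ k ]) +ℂ Σ< (suc n) (λ k → a (+ k))) s
  HasSumℤ⇒Lim {a} {s} a→s δ 0<δ = proj₁ (a→s δ 0<δ) , λ n N≤n → ⊑-resp-≈
    (ℂR.+-congʳ {x = -ℂ s} (ℂR.+-cong {sum {n} (λ k → a -[1+ toℕ k ])} {Σ< n (λ k → a -[1+ k ])} {sum {suc n} (λ k → a (+ toℕ k))} {Σ< (suc n) (λ k → a (+ k))}
      (sum≈Σ< n (λ k → a -[1+ k ])) (sum≈Σ< (suc n) (λ k → a (+ k)))))
    (Within⇒⊑ {z = partialSumℤ a n n} 0<δ (proj₂ (a→s δ 0<δ) n n N≤n N≤n))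

-- The complex exponential: modulus, decay, and its values related to π.

module ComplexExponential {c ℓ₁ ℓ₂ ℓ₃} (R : RealNumbers c ℓ₁ ℓ₂ ℓ₃) where
  open ComplexNumbers R
  open FactorialReciprocals R
  open ComplexNormedAlgebra R
  open ComplexSeries R
  open FiniteSums ℂ-commutativeRing
  open Limits R ℂ-normedAlgebra
  open ExponentialSeries R ℂ-realAlgebra using (term)
  open Exponential R ℂ-normedAlgebra using (exp; exp-cong; exp-+; exp-0; exp-series; HasExp; HasExp⇒≈exp; ofℝ-Σ<-term)
  module ℝE = RealExponentialSeries R

  private
    term≈ : ∀ z n → term z n ≈ℂ ↑ (recip (n !) {{n ℕₚ.!≢0}}) *ℂ z ^ n
    term≈ z n = ℂR.*-congʳ {x = z ^ n} {↑ recip-! n} {↑ (recip (n !) {{n ℕₚ.!≢0}})} (recip-!≈recip n , refl)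

  HasExp⇒IsExp : ∀ {z w} → HasExp z w → IsExp z w
  HasExp⇒IsExp {z} {w} h = Lim⇒HasSumℕ (Lim-cong {λ n → Σ< n (term z)} {_} {w} (λ n → Σ<-cong n (term≈ z)) h)

  IsExp⇒≈exp : ∀ {z w} → IsExp z w → w ≈ℂ exp z
  IsExp⇒≈exp {z} {w} h = HasExp⇒≈exp {z} {w} (Lim-cong {_} {λ n → Σ< n (term z)} {w}
    (λ n → Σ<-cong n (λ k → ℂR.sym {term z k} (term≈ z k))) (HasSumℕ⇒Lim h))

  exp-isExp : ∀ z → IsExp z (exp z)
  exp-isExp z = HasExp⇒IsExp (exp-series z)

  ≈exp⇒IsExp : ∀ {z w} → exp z ≈ℂ w → IsExp z w
  ≈exp⇒IsExp {z} {w} e = HasExp⇒IsExp (Lim-congʳ {λ n → Σ< n (term z)} {exp z} {w} e (exp-series z))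

  conj-+ : ∀ z w → conj (z +ℂ w) ≈ℂ conj z +ℂ conj w
  conj-+ (a +i b) (a′ +i b′) = refl , solve 2 (λ x y → :- (x :+ y) := :- x :+ :- y) refl b b′

  conj-* : ∀ z w → conj (z *ℂ w) ≈ℂ conj z *ℂ conj w
  conj-* (a +i b) (a′ +i b′) = solve 4 (λ a b c d → a :* c :- b :* d := a :* c :- :- b :* :- d) refl a b a′ b′ ,
    solve 4 (λ a b c d → :- (a :* d :+ b :* c) := a :* :- d :+ :- b :* c) refl a b a′ b′

  conj-↑ : ∀ x → conj (↑ x) ≈ℂ ↑ x
  conj-↑ x = refl , solve 0 (:- con (+ 0) := con (+ 0)) refl

  conj-^ : ∀ z n → conj (z ^ n) ≈ℂ conj z ^ n
  conj-^ z zero    = conj-↑ 1#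
  conj-^ z (suc n) = ℂR.trans {conj (z *ℂ z ^ n)} {conj z *ℂ conj (z ^ n)} {conj z *ℂ conj z ^ n}
    (conj-* z (z ^ n)) (ℂR.*-congˡ {conj z} {conj (z ^ n)} {conj z ^ n} (conj-^ z n))

  conj-⊑ : ∀ {z b} → z ⊑ b → conj z ⊑ b
  conj-⊑ {x +i y} (bounded 0≤b p) = bounded 0≤b (≤-respˡ (solve 2 (λ x y → x :* x :+ y :* y := x :* x :+ :- y :* :- y) refl x y) p)

  conj-term : ∀ z n → conj (term z n) ≈ℂ term (conj z) n
  conj-term z n = ℂR.trans {conj (term z n)} {conj (↑ recip-! n) *ℂ conj (z ^ n)} {term (conj z) n}
    (conj-* (↑ recip-! n) (z ^ n))
    (ℂR.*-cong {conj (↑ recip-! n)} {↑ recip-! n} {conj (z ^ n)} {conj z ^ n} (conj-↑ (recip-! n)) (conj-^ z n))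

  conj-Σ< : ∀ n f → conj (Σ< n f) ≈ℂ Σ< n (conj ∘ f)
  conj-Σ< zero    f = conj-↑ 0#
  conj-Σ< (suc n) f = ℂR.trans {conj (Σ< n f +ℂ f n)} {conj (Σ< n f) +ℂ conj (f n)} {Σ< n (conj ∘ f) +ℂ conj (f n)}
    (conj-+ (Σ< n f) (f n)) (ℂR.+-congʳ {conj (f n)} {conj (Σ< n f)} {Σ< n (conj ∘ f)} (conj-Σ< n f))

  Lim-conj : ∀ {s l} → Limℂ s l → Limℂ (conj ∘ s) (conj l)
  Lim-conj {s} {l} s→l δ 0<δ with s→l δ 0<δ
  ... | N , bound = N , λ n N≤n → ⊑-resp-≈ (conj-+ (s n) (-ℂ l)) (conj-⊑ (bound n N≤n))

  -- The series has real coefficients, and conjugation preserves norm bounds, hence limits. With the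
  -- addition formula this gives |exp z|² = exp (z + conj z).
  exp-conj : ∀ z → exp (conj z) ≈ℂ conj (exp z)
  exp-conj z = ℂR.sym {conj (exp z)} {exp (conj z)} (HasExp⇒≈exp {conj z} {conj (exp z)}
    (Lim-cong {λ n → conj (Σ< n (term z))} {λ n → Σ< n (term (conj z))} {conj (exp z)}
      (λ n → ℂR.trans {conj (Σ< n (term z))} {Σ< n (conj ∘ term z)} {Σ< n (term (conj z))}
        (conj-Σ< n (term z)) (Σ<-cong n (conj-term z)))
      (Lim-conj (exp-series z))))

  *-conj : ∀ z → z *ℂ conj z ≈ℂ ↑ ∣ z ∣²
  *-conj (a +i b) = solve 2 (λ a b → a :* a :- b :* :- b := a :* a :+ b :* b) refl a b ,
    solve 2 (λ a b → a :* :- b :+ b :* a := con (+ 0)) refl a b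

  exp-norm : ∀ z → exp (↑ (re z + re z)) ≈ℂ ↑ ∣ exp z ∣²
  exp-norm z = begin
    exp (↑ (re z + re z))   ≈⟨ exp-cong {z +ℂ conj z} {↑ (re z + re z)} (refl , -‿inverseʳ (im z)) ⟨
    exp (z +ℂ conj z)       ≈⟨ exp-+ z (conj z) ⟩
    exp z *ℂ exp (conj z)   ≈⟨ ℂR.*-congˡ {exp z} {exp (conj z)} {conj (exp z)} (exp-conj z) ⟩
    exp z *ℂ conj (exp z)   ≈⟨ *-conj (exp z) ⟩
    ↑ ∣ exp z ∣²            ∎
    where open SetoidReasoning ℂR.setoid

  exp-real : ∀ x → im (exp (↑ x)) ≈ 0#
  exp-real x = *-cancelˡ-≈ 0<2 (trans
      (trans (solve 1 (λ y → (con (+ 1) :+ con (+ 1)) :* y := y :+ y) refl y) (trans (+-congˡ y≈-y) (-‿inverseʳ y)))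
      (sym (zeroʳ _)))
    where
    y = im (exp (↑ x))
    0<2 : 0# < 1# + 1#
    0<2 = <-trans 0<1 (<-by 1# 0<1 refl)
    y≈-y : y ≈ - y
    y≈-y = trans (proj₂ (exp-cong {↑ x} {conj (↑ x)} (ℂR.sym {conj (↑ x)} {↑ x} (conj-↑ x)))) (proj₂ (exp-conj (↑ x)))

  -- The first two terms are 1 + x and the others are nonnegative, so every later partial sum is at
  -- least 1 + x. The decay estimates below rest on this bound.
  1+x≤exp : ∀ {x} → 0# ≤ x → 1# + x ≤ re (exp (↑ x))
  1+x≤exp {x} 0≤x = ≤-limit lower
    where
    two-terms : 1# + x ≈ ℝΣ.Σ< 2 (ℝE.term x)
    two-terms = sym (+-cong (trans (+-identityˡ _) (ℝE.term-zero x))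
      (trans (sym (trans (*-congʳ (+-identityʳ 1#)) (*-identityˡ _)))
        (trans (ℝE.term-suc x 0) (trans (*-congˡ (ℝE.term-zero x)) (*-identityʳ x)))))
    partial : ∀ n → 1# + x ≤ re (Σ< (n ℕ.+ 2) (term (↑ x)))
    partial n = ≤-trans (≤-respˡ (sym two-terms) (ℝE.Σ<-mono 2 n (λ k → ℝE.term-nonneg k 0≤x)))
      (≤-reflexive (proj₁ (ofℝ-Σ<-term x (n ℕ.+ 2))))
    lower : ∀ δ → 0# < δ → 1# + x ≤ re (exp (↑ x)) + δ
    lower δ 0<δ with exp-series (↑ x) δ 0<δ
    ... | N , bound = ≤-trans (partial N) (≤-respˡ (solve 2 (λ s l → s :- l :+ l := s) refl (re (Σ< (N ℕ.+ 2) (term (↑ x)))) (re (exp (↑ x))))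
      (≤-respʳ (+-comm δ _) (+-monoˡ-≤ (re (exp (↑ x))) (⊑-re (bound (N ℕ.+ 2) (ℕₚ.m≤m+n N 2))))))

  exp-double : ∀ x → ∣ exp (↑ x) ∣² ≈ re (exp (↑ x)) * re (exp (↑ x))
  exp-double x = trans (+-congˡ (trans (*-congʳ (exp-real x)) (zeroˡ _))) (+-identityʳ _)

  exp-inverse-norm : ∀ z → ∣ exp z ∣² * ∣ exp (-ℂ z) ∣² ≈ 1#
  exp-inverse-norm z = trans (sym (∣∣²-* (exp z) (exp (-ℂ z)))) (trans (∣∣²-cong e)
      (solve 0 (con (+ 1) :* con (+ 1) :+ con (+ 0) :* con (+ 0) := con (+ 1)) refl))
    where
    e : exp z *ℂ exp (-ℂ z) ≈ℂ 1ℂ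
    e = ℂR.trans {exp z *ℂ exp (-ℂ z)} {exp (z +ℂ (-ℂ z))} {1ℂ} (ℂR.sym {exp (z +ℂ (-ℂ z))} (exp-+ z (-ℂ z)))
      (ℂR.trans {exp (z +ℂ (-ℂ z))} {exp 0ℂ} {1ℂ} (exp-cong {z +ℂ (-ℂ z)} {0ℂ} (ℂR.-‿inverseʳ z)) exp-0)

  exp-norm-re : ∀ z → ∣ exp z ∣² ≈ ∣ exp (↑ re z) ∣²
  exp-norm-re z = trans (sym (proj₁ (exp-norm z))) (proj₁ (exp-norm (↑ re z)))

  exp-lower : ∀ {z u} → 0# ≤ u → u ≤ re z → (1# + u) * (1# + u) ≤ ∣ exp z ∣²
  exp-lower {z} {u} 0≤u u≤re = ≤-respʳ (trans (sym (exp-double (re z))) (sym (exp-norm-re z)))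
    (square-mono-≤ (+-nonneg (<⇒≤ 0<1) 0≤u) (≤-trans (+-mono-≤ ≤-refl u≤re) (1+x≤exp (≤-trans 0≤u u≤re))))

  -- |exp z|² |exp (-z)|² = 1, and the second factor is at least (1 + u)².
  exp-decay : ∀ {z u r} → 0# ≤ u → u ≤ - re z → (1# + u) * r ≈ 1# → exp z ⊑ r
  exp-decay {z} {u} {r} 0≤u u≤-re e = bounded (<⇒≤ (inverse-positive 0<1+u e)) (*-cancelˡ-≤ (*-positive 0<1+u 0<1+u)
      (≤-respʳ (trans (sym (*-identityʳ 1#)) (trans (*-cong (sym e) (sym e)) (solve 2 (λ u r → u :* r :* (u :* r) := u :* u :* (r :* r)) refl (1# + u) r)))
      (≤-respʳ (exp-inverse-norm z) (≤-respʳ (*-comm (∣ exp (-ℂ z) ∣²) (∣ exp z ∣²))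
        (*-monoʳ-≤ (∣∣²-nonneg (exp z)) (exp-lower 0≤u u≤-re))))))
    where
    0<1+u : 0# < 1# + u
    0<1+u = <-≤-trans 0<1 (≤-by u 0≤u refl)

  exp-imaginary-⊑ : ∀ {z} → re z ≈ 0# → exp z ⊑ 1#
  exp-imaginary-⊑ {z} re≈0 = exp-decay ≤-refl
    (≤-reflexive (trans (solve 0 (con (+ 0) := :- con (+ 0)) refl) (-‿cong (sym re≈0))))
    (solve 0 ((con (+ 1) :+ con (+ 0)) :* con (+ 1) := con (+ 1)) refl)

  exp-imaginary-norm : ∀ {z} → re z ≈ 0# → ∣ exp z ∣² ≈ 1#
  exp-imaginary-norm {z} re≈0 = trans (sym (proj₁ (exp-norm z)))
    (trans (proj₁ (exp-cong {↑ (re z + re z)} {0ℂ} (trans (+-cong re≈0 re≈0) (+-identityˡ 0#) , refl))) (proj₁ exp-0))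

  -- A mere negation does not make `x` apart from 0, hence invertible. Since equality is stable, the
  -- sign of `x` may nevertheless be distinguished.
  product-zero : ∀ {x y} → x * y ≈ 0# → ¬ (x ≈ 0#) → y ≈ 0#
  product-zero {x} {y} xy≈0 x≉0 = ≈-stable λ y≉0 → ¬¬-trichotomy 0# x λ where
      (inj₁ 0<x)        → y≉0 (*-cancelˡ-≈ 0<x (trans xy≈0 (sym (zeroʳ x))))
      (inj₂ (inj₁ 0≈x)) → x≉0 (sym 0≈x)
      (inj₂ (inj₂ x<0)) → y≉0 (*-cancelˡ-≈ (neg-positive x<0)
        (trans (solve 2 (λ x y → :- x :* y := :- (x :* y)) refl x y) (trans (-‿cong xy≈0) (solve 1 (λ x → :- con (+ 0) := :- x :* con (+ 0)) refl x))))

  module _ {π : ℝ} (isPi : IsPi π) where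

    sin≉0 : ∀ {x} → 0# < x → x < π → ¬ (im (exp (𝕚 *ℂ ↑ x)) ≈ 0#)
    sin≉0 {x} 0<x x<π im≈0 = proj₂ (proj₂ isPi) x 0<x x<π
      (re (exp (𝕚 *ℂ ↑ x)) , ≈exp⇒IsExp {𝕚 *ℂ ↑ x} (refl , im≈0))

    -- With h = π / 2: 0 = sin π = 2 sin h cos h, and sin h is nonzero because π is the least
    -- positive zero. Hence cos h = 0, sin² h = 1 and cos π = cos² h - sin² h = -1.
    exp-iπ : exp (𝕚 *ℂ ↑ π) ≈ℂ -ℂ 1ℂ
    exp-iπ with halve (proj₁ isPi)
    ... | h , 0<h , h+h≈π = re≈ , trans (sym (proj₂ (IsExp⇒≈exp {𝕚 *ℂ ↑ π} (proj₂ (proj₁ (proj₂ isPi)))))) (solve 0 (con (+ 0) := :- con (+ 0)) refl)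
      where
      u = exp (𝕚 *ℂ ↑ h)
      u*u≈ : u *ℂ u ≈ℂ exp (𝕚 *ℂ ↑ π)
      u*u≈ = ℂR.trans {u *ℂ u} {exp (𝕚 *ℂ ↑ h +ℂ 𝕚 *ℂ ↑ h)} {exp (𝕚 *ℂ ↑ π)} (ℂR.sym {exp (𝕚 *ℂ ↑ h +ℂ 𝕚 *ℂ ↑ h)} (exp-+ (𝕚 *ℂ ↑ h) (𝕚 *ℂ ↑ h)))
        (exp-cong {𝕚 *ℂ ↑ h +ℂ 𝕚 *ℂ ↑ h} {𝕚 *ℂ ↑ π}
          (solve 2 (λ h p → con (+ 0) :* h :- con (+ 1) :* con (+ 0) :+ (con (+ 0) :* h :- con (+ 1) :* con (+ 0)) := con (+ 0) :* p :- con (+ 1) :* con (+ 0)) refl h π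
          , trans (solve 1 (λ h → con (+ 0) :* con (+ 0) :+ con (+ 1) :* h :+ (con (+ 0) :* con (+ 0) :+ con (+ 1) :* h) := con (+ 0) :* con (+ 0) :+ con (+ 1) :* (h :+ h)) refl h)
             (+-congˡ (*-congˡ h+h≈π))))
      h<π : h < π
      h<π = <-by h 0<h (sym h+h≈π)
      sin-double : im u * re u ≈ 0#
      sin-double = *-cancelˡ-≈ 0<2 (trans (solve 2 (λ x y → (con (+ 1) :+ con (+ 1)) :* (y :* x) := x :* y :+ y :* x) refl (re u) (im u))
          (trans (trans (proj₂ u*u≈) (sym (proj₂ (IsExp⇒≈exp {𝕚 *ℂ ↑ π} (proj₂ (proj₁ (proj₂ isPi))))))) (sym (zeroʳ _))))
        where
        0<2 : 0# < 1# + 1#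
        0<2 = <-trans 0<1 (<-by 1# 0<1 refl)
      cos≈0 : re u ≈ 0#
      cos≈0 = product-zero sin-double (sin≉0 0<h h<π)
      sin²≈1 : im u * im u ≈ 1#
      sin²≈1 = trans (solve 2 (λ x y → y :* y := x :* x :+ y :* y :- x :* x) refl (re u) (im u))
        (trans (+-cong (exp-imaginary-norm {𝕚 *ℂ ↑ h} (solve 1 (λ h → con (+ 0) :* h :- con (+ 1) :* con (+ 0) := con (+ 0)) refl h))
          (-‿cong (trans (*-congʳ cos≈0) (zeroˡ _)))) (solve 0 (con (+ 1) :- con (+ 0) := con (+ 1)) refl))
      re≈ : re (exp (𝕚 *ℂ ↑ π)) ≈ - 1#
      re≈ = trans (sym (proj₁ u*u≈)) (trans (+-cong (trans (*-congʳ cos≈0) (zeroˡ _)) (-‿cong sin²≈1)) (+-identityˡ _))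

    -- The imaginary part of exp (ix) - 1 is sin x, which is not 0 for 0 < x < π. Taking |·|², which
    -- is multiplicative, reduces the cancellation to the reals.
    exp-roots-of-unity : ∀ {x s} → 0# < x → x < π → (exp (𝕚 *ℂ ↑ x) -ℂ 1ℂ) *ℂ s ≈ℂ 0ℂ → s ≈ℂ 0ℂ
    exp-roots-of-unity {x} {s} 0<x x<π e = ∣∣²≈0⇒≈0 (product-zero {∣ exp (𝕚 *ℂ ↑ x) -ℂ 1ℂ ∣²}
      (trans (sym (∣∣²-* (exp (𝕚 *ℂ ↑ x) -ℂ 1ℂ) s)) (trans (∣∣²-cong e) (solve 0 (con (+ 0) :* con (+ 0) :+ con (+ 0) :* con (+ 0) := con (+ 0)) refl)))
      λ norm≈0 → sin≉0 0<x x<π (trans (solve 1 (λ y → y := y :- con (+ 0)) refl (im (exp (𝕚 *ℂ ↑ x))))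
        (proj₂ (∣∣²≈0⇒≈0 {exp (𝕚 *ℂ ↑ x) -ℂ 1ℂ} norm≈0))))

-- Convergence of the theta series for every characteristic.

module ThetaSeries {c ℓ₁ ℓ₂ ℓ₃} (R : RealNumbers c ℓ₁ ℓ₂ ℓ₃) where
  open ComplexNumbers R
  open NullSequences R
  open ComplexNormedAlgebra R
  open ComplexSeries R
  open FiniteSums ℂ-commutativeRing
  open Limits R ℂ-normedAlgebra
  open Exponential R ℂ-normedAlgebra using (exp; exp-cong; exp-+)
  open ComplexExponential R
  open Theta R using (ℍ²; point; positive; exponent; IsTheta; ThetaFunction)

  -- The offset `d` left over from completing the square has no definite sign; it is split off as
  -- the constant factor exp d.
  exp-decay-shifted : ∀ {z u d r F} → 0# ≤ u → u - d ≤ - re z → (1# + u) * r ≈ 1# → exp (↑ d) ⊑ F → exp z ⊑ r * F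
  exp-decay-shifted {z} {u} {d} {r} {F} 0≤u u-d≤ e d⊑F = ⊑-resp-≈ {exp (z -ℂ ↑ d) *ℂ exp (↑ d)} {exp z}
    (ℂR.trans {exp (z -ℂ ↑ d) *ℂ exp (↑ d)} {exp (z -ℂ ↑ d +ℂ ↑ d)} {exp z}
      (ℂR.sym {exp (z -ℂ ↑ d +ℂ ↑ d)} (exp-+ (z -ℂ ↑ d) (↑ d)))
      (exp-cong {z -ℂ ↑ d +ℂ ↑ d} {z} (solveℂ 2 (λ z d → z ⊖ d ⊕ d ⊜ z) ℂR.refl z (↑ d))))
    (⊑-* (exp-decay 0≤u (≤-respˡ (solve 2 (λ u d → u :- d :+ d := u) refl u d)
      (≤-respʳ (solve 2 (λ x d → :- x :+ d := :- (x :- d)) refl (re z) d) (+-monoˡ-≤ d u-d≤))) e) d⊑F)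

  private
    -- The 6 comes from (m + 1)(m + 2) ≤ 6 m² for m ≥ 1.
    reciprocal-bound : ∀ j {c c⁻¹ r s t} (let m = suc j · 1#) → 0# < c → c * c⁻¹ ≈ 1# →
      0# < s → 0# < t → (1# + m) * s ≈ 1# → (1# + (1# + m)) * t ≈ 1# → (1# + c * (m * m)) * r ≈ 1# →
      r ≤ (ι (+ 6) * c⁻¹) * (s * t)
    reciprocal-bound j {c} {c⁻¹} {r} {s} {t} 0<c cc⁻¹ 0<s 0<t es et er = *-cancelˡ-≤ 0<1+cmm (≤-respˡ (sym er) bound)
      where
      n = j · 1#
      m = 1# + n
      0<1+cmm : 0# < 1# + c * (m * m)
      0<1+cmm = <-≤-trans 0<1 (≤-by (c * (m * m)) (*-nonneg (<⇒≤ 0<c) (square-nonneg m)) refl)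
      0≤6c⁻¹st : 0# ≤ ι (+ 6) * c⁻¹ * (s * t)
      0≤6c⁻¹st = *-nonneg (*-nonneg (≤-respʳ (solve 0 ((con (+ 1) :+ (con (+ 1) :+ (con (+ 1) :+ (con (+ 1) :+ (con (+ 1) :+ (con (+ 1) :+ con (+ 0))))))) := con (+ 6)) refl) (·-nonneg 6))
        (<⇒≤ (inverse-positive 0<c cc⁻¹))) (<⇒≤ (*-positive 0<s 0<t))
      bound : 1# ≤ (1# + c * (m * m)) * (ι (+ 6) * c⁻¹ * (s * t))
      bound = ≤-by (ι (+ 6) * c⁻¹ * (s * t) + s * t * (n * (ι (+ 5) * n + ι (+ 7))))
        (+-nonneg 0≤6c⁻¹st (*-nonneg (<⇒≤ (*-positive 0<s 0<t)) (*-nonneg (·-nonneg j)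
          (+-nonneg (*-nonneg (≤-respʳ (solve 0 ((con (+ 1) :+ (con (+ 1) :+ (con (+ 1) :+ (con (+ 1) :+ (con (+ 1) :+ con (+ 0)))))) := con (+ 5)) refl) (·-nonneg 5)) (·-nonneg j))
            (≤-respʳ (solve 0 ((con (+ 1) :+ (con (+ 1) :+ (con (+ 1) :+ (con (+ 1) :+ (con (+ 1) :+ (con (+ 1) :+ (con (+ 1) :+ con (+ 0)))))))) := con (+ 7)) refl) (·-nonneg 7))))))
        (trans (solve 5 (λ c d n s t → (con (+ 1) :+ c :* ((con (+ 1) :+ n) :* (con (+ 1) :+ n))) :* (con (+ 6) :* d :* (s :* t))
            := con (+ 6) :* d :* (s :* t) :+ c :* d :* (con (+ 6) :* ((con (+ 1) :+ n) :* (con (+ 1) :+ n)) :* (s :* t))) refl c c⁻¹ n s t)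
        (trans (+-congˡ (trans (*-congʳ cc⁻¹)
          (solve 3 (λ n s t → con (+ 1) :* (con (+ 6) :* ((con (+ 1) :+ n) :* (con (+ 1) :+ n)) :* (s :* t)) :=
            ((con (+ 1) :+ (con (+ 1) :+ n)) :* s) :* ((con (+ 1) :+ (con (+ 1) :+ (con (+ 1) :+ n))) :* t) :+ s :* t :* (n :* (con (+ 5) :* n :+ con (+ 7)))) refl n s t)))
        (trans (+-congˡ (+-congʳ (*-cong es et)))
          (solve 2 (λ p q → p :+ (con (+ 1) :* con (+ 1) :+ q) := con (+ 1) :+ (p :+ q)) refl (ι (+ 6) * c⁻¹ * (s * t)) (s * t * (n * (ι (+ 5) * n + ι (+ 7))))))))

    -- 1 / ((m + 1)(m + 2)) = 1 / (m + 1) - 1 / (m + 2), which turns a bound of order m⁻² into a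
    -- telescoping one.
    reciprocal-difference : ∀ m {s t} → (1# + m) * s ≈ 1# → (1# + (1# + m)) * t ≈ 1# → s * t ≈ s - t
    reciprocal-difference m {s} {t} es et = trans (solve 3 (λ m s t → s :* t := s :* ((con (+ 1) :+ (con (+ 1) :+ m)) :* t) :- ((con (+ 1) :+ m) :* s) :* t) refl m s t)
      (trans (+-cong (trans (*-congˡ et) (*-identityʳ s)) (-‿cong (trans (*-congʳ es) (*-identityˡ t)))) refl)

  opaque
    gaussian-summable : ∀ {z : ℕ → ℂ} {c d} → 0# < c →
      (∀ k → c * ((k · 1#) * (k · 1#)) - d ≤ - re (z k)) → ∃[ s ] Limℂ (λ n → Σ< n (exp ∘ z)) s
    gaussian-summable {z} {c} {d} 0<c bound = from (⊑-exists (exp (↑ d))) (positive-inverse 0<c)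
      where
      from : ∃[ k ] exp (↑ d) ⊑ suc k · 1# → ∃[ y ] 0# < y × c * y ≈ 1# → ∃[ s ] Limℂ (λ n → Σ< n (exp ∘ z)) s
      -- The comparison starts at index 1, since (m + 1)(m + 2) ≤ 6 m² fails for m = 0.
      from (k , d⊑F) (c⁻¹ , 0<c⁻¹ , cc⁻¹) = telescoping-series {exp ∘ z} {b} 1 dominated
          (λ m → *-nonneg 0≤G (<⇒≤ (recip-positive (suc m)))) (Null-scale 0≤G Null-recip)
        where
        F G : ℝ
        F = suc k · 1#
        G = ι (+ 6) * c⁻¹ * F
        b : ℕ → ℝ
        b m = G * recip (suc m)
        0≤G : 0# ≤ G
        0≤G = *-nonneg (*-nonneg (≤-respʳ (solve 0 ((con (+ 1) :+ (con (+ 1) :+ (con (+ 1) :+ (con (+ 1) :+ (con (+ 1) :+ (con (+ 1) :+ con (+ 0))))))) := con (+ 6)) refl) (·-nonneg 6)) (<⇒≤ 0<c⁻¹)) (·-nonneg (suc k))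
        dominated-by : ∀ j {r s t} (let m = suc j · 1#) → 0# < s → 0# < t → (1# + m) * s ≈ 1# → (1# + (1# + m)) * t ≈ 1# →
          (1# + c * (m * m)) * r ≈ 1# → exp (z (suc j)) ⊑ G * s - G * t
        dominated-by j {r} {s} {t} 0<s 0<t es et er = ⊑-weaken
          (≤-respʳ (trans (solve 4 (λ x F s t → (x :* (s :* t)) :* F := x :* F :* (s :* t)) refl (ι (+ 6) * c⁻¹) F s t)
            (trans (*-congˡ (reciprocal-difference (suc j · 1#) es et)) (solve 3 (λ G s t → G :* (s :- t) := G :* s :- G :* t) refl G s t)))
            (*-monoʳ-≤ (·-nonneg (suc k)) (reciprocal-bound j 0<c cc⁻¹ 0<s 0<t es et er)))
          (exp-decay-shifted (*-nonneg (<⇒≤ 0<c) (square-nonneg _)) (bound (suc j)) er d⊑F)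
        dominated : ∀ m → 1 ℕ.≤ m → exp (z m) ⊑ b m - b (suc m)
        dominated (suc j) _ = dominated-by j (recip-positive (suc (suc j))) (recip-positive (suc (suc (suc j))))
          (*-recip (suc (suc j))) (*-recip (suc (suc (suc j)))) (proj₂ (proj₂ (positive-inverse
            (<-≤-trans 0<1 (≤-by (c * (suc j · 1# * (suc j · 1#))) (*-nonneg (<⇒≤ 0<c) (square-nonneg _)) refl)))))

  private
    re-exponent : ∀ P H a e (τ ζ : ℂ) →
      - re (↑ P *ℂ 𝕚 *ℂ (↑ H *ℂ (↑ a) ^ 2 *ℂ τ +ℂ ↑ a *ℂ (ζ +ℂ ↑ e))) ≈ P * (H * (a * a) * im τ + a * im ζ)
    re-exponent P H a e (t +i y) (z +i η) = solve 8 (λ P H a e t y z η →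
        :- proj₁ ((⟨ P ⟩ ⊠ (con (+ 0) , con (+ 1))) ⊠ (((⟨ H ⟩ ⊠ (⟨ a ⟩ ⊠ (⟨ a ⟩ ⊠ ⟨ con (+ 1) ⟩))) ⊠ (t , y)) ⊞ (⟨ a ⟩ ⊠ ((z , η) ⊞ ⟨ e ⟩))))
          := P :* (H :* (a :* a) :* y :+ a :* η)) refl P H a e t y z η
      where
      -- Complex numbers are modelled as pairs of real polynomials, so that the solver for the reals
      -- can compute a real part.
      ⟨_⟩ : Polynomial 8 → Polynomial 8 × Polynomial 8
      ⟨ x ⟩ = x , con (+ 0)
      _⊠_ _⊞_ : (z w : Polynomial 8 × Polynomial 8) → Polynomial 8 × Polynomial 8
      (x , y) ⊠ (u , v) = x :* u :- y :* v , x :* v :+ y :* u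
      (x , y) ⊞ (u , v) = x :+ u , y :+ v

    -- Completing the square.
    quadratic-bound : ∀ {A A⁻¹ h N} B β x → 0# < A → A * A⁻¹ ≈ 1# → h + h ≈ 1# → 0# < h → - (A * (β * β) + B * β) ≤ N →
      let D = (A + A) * β + B in
      A * h * (x * x) - (D * D * A⁻¹ * h + N) ≤ A * ((x + β) * (x + β)) + B * (x + β)
    quadratic-bound {A} {A⁻¹} {h} {N} B β x 0<A AA⁻¹ h+h 0<h E≤N = ≤-by
      (A * h * ((x + D * A⁻¹) * (x + D * A⁻¹)) + (N - - E))
      (+-nonneg (*-nonneg (<⇒≤ (*-positive 0<A 0<h)) (square-nonneg _)) (0≤y-x E≤N))
      (trans (solve 4 (λ A B x b → A :* ((x :+ b) :* (x :+ b)) :+ B :* (x :+ b) := A :* (x :* x) :* con (+ 1) :+ ((A :+ A) :* b :+ B) :* x :* con (+ 1) :* con (+ 1) :+ (A :* (b :* b) :+ B :* b)) refl A B x β)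
      (trans (+-congʳ (+-cong (*-congˡ (sym h+h)) (*-cong (*-congˡ (sym h+h)) (sym AA⁻¹))))
        (trans (solve 7 (λ A i h D x E N → A :* (x :* x) :* (h :+ h) :+ D :* x :* (h :+ h) :* (A :* i) :+ E
          := A :* h :* (x :* x) :- (D :* D :* i :* h :+ N) :+ (A :* h :* (x :* x) :+ D :* x :* (h :+ h) :* (A :* i) :+ D :* D :* i :* h :* con (+ 1) :+ (N :- :- E))) refl A A⁻¹ h D x E N)
        (+-congˡ (+-congʳ (trans (+-congˡ (*-congˡ (sym AA⁻¹)))
          (solve 5 (λ A i h D x → A :* h :* (x :* x) :+ D :* x :* (h :+ h) :* (A :* i) :+ D :* D :* i :* h :* (A :* i)
            := A :* h :* ((x :+ D :* i) :* (x :+ D :* i))) refl A A⁻¹ h D x)))))))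
      where
      D = (A + A) * β + B
      E = A * (β * β) + B * β

  module _ {π : ℝ} (0<π : 0# < π) where

    opaque
      -- The real part is a quadratic polynomial in n with leading coefficient -A, where A = π Im τ.
      -- Half of A absorbs the linear term coming from ε and Im ζ, and c is the other half. Real ε′
      -- changes only the imaginary part.
      exponent-bound : ∀ ε ε′ ζ τ → ∃[ c ] ∃[ d ] 0# < c × (∀ n → c * (fromℤ n * fromℤ n) - d ≤ - re (exponent π ε ε′ ζ τ n))
      exponent-bound ε ε′ ζ τ = from (1 // 2) (2 // 1 * π) (*-positive 0<1·1 (recip-positive 2)) 0<P half
        where
        0<1·1 : 0# < 1 · 1#
        0<1·1 = suc-positive 0
        0<P : 0# < 2 // 1 * π
        0<P = *-positive (*-positive (suc-positive 1) (recip-positive 1)) 0<π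
        half : 1 // 2 + 1 // 2 ≈ 1#
        half = halves (recip 2) (*-recip 2)
          where
          halves : ∀ r → (2 · 1#) * r ≈ 1# → (1 · 1#) * r + (1 · 1#) * r ≈ 1#
          halves r e = trans (solve 1 (λ r → (con (+ 1) :+ con (+ 0)) :* r :+ (con (+ 1) :+ con (+ 0)) :* r := (con (+ 1) :+ (con (+ 1) :+ con (+ 0))) :* r) refl r) e
        from : ∀ h P → 0# < h → 0# < P → h + h ≈ 1# → ∃[ c ] ∃[ d ] 0# < c ×
          (∀ n → c * (fromℤ n * fromℤ n) - d ≤ - re (↑ P *ℂ 𝕚 *ℂ (↑ h *ℂ (↑ (fromℤ n + ε * h)) ^ 2 *ℂ point τ +ℂ ↑ (fromℤ n + ε * h) *ℂ (ζ +ℂ ↑ (ε′ * h)))))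
        from h P 0<h 0<P h+h≈1 with positive-inverse (*-positive (*-positive 0<P 0<h) (positive τ))
          | archimedean (- (P * h * im (point τ) * (ε * h * (ε * h)) + P * im ζ * (ε * h)))
        ... | A⁻¹ , 0<A⁻¹ , AA⁻¹ | N , E<N = P * h * im (point τ) * h , _ , *-positive 0<A 0<h , λ n →
            ≤-respʳ (sym (trans (re-exponent P h (fromℤ n + ε * h) (ε′ * h) (point τ) ζ)
                (solve 5 (λ P h a y η → P :* (h :* (a :* a) :* y :+ a :* η) := P :* h :* y :* (a :* a) :+ P :* η :* a) refl P h (fromℤ n + ε * h) (im (point τ)) (im ζ))))
              (quadratic-bound (P * im ζ) (ε * h) (fromℤ n) 0<A AA⁻¹ h+h≈1 0<h (<⇒≤ E<N))
          where
          0<A : 0# < P * h * im (point τ)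
          0<A = *-positive (*-positive 0<P 0<h) (positive τ)

    opaque
      theta-exists : ∀ ε ε′ ζ τ → ∃[ t ] IsTheta π ε ε′ ζ τ t
      theta-exists ε ε′ ζ τ = join (negative-half (exponent-bound ε ε′ ζ τ)) (positive-half (exponent-bound ε ε′ ζ τ))
        where
        z : ℤ → ℂ
        z = exponent π ε ε′ ζ τ
        Bound : Set (c ⊔ ℓ₃)
        Bound = ∃[ c ] ∃[ d ] 0# < c × (∀ n → c * (fromℤ n * fromℤ n) - d ≤ - re (z n))
        -- The k-th negative index is -(k + 1). As k² ≤ (k + 1)², both halves satisfy the same bound
        -- in k.
        shifted : ∀ {c} d k → 0# < c → c * ((k · 1#) * (k · 1#)) - d ≤ c * (- (suc k · 1#) * - (suc k · 1#)) - d
        shifted d k 0<c = +-monoˡ-≤ (- d) (*-monoˡ-≤ (<⇒≤ 0<c) (≤-respʳ (solve 1 (λ x → x :* x := :- x :* :- x) refl (suc k · 1#))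
          (square-mono-≤ (·-nonneg k) (≤-by 1# (<⇒≤ 0<1) (+-comm 1# (k · 1#))))))
        negative-half : Bound → ∃[ s ] Limℂ (λ n → Σ< n (λ k → exp (z -[1+ k ]))) s
        negative-half (c , d , 0<c , bound) =
          gaussian-summable {λ k → z -[1+ k ]} {c} {d} 0<c (λ k → ≤-trans (shifted d k 0<c) (bound -[1+ k ]))
        positive-half : Bound → ∃[ t ] Limℂ (λ n → Σ< n (λ k → exp (z (+ k)))) t
        positive-half (c , d , 0<c , bound) = gaussian-summable {λ k → z (+ k)} {c} {d} 0<c (λ k → bound (+ k))
        join : ∃[ s ] Limℂ (λ n → Σ< n (λ k → exp (z -[1+ k ]))) s → ∃[ t ] Limℂ (λ n → Σ< n (λ k → exp (z (+ k)))) t →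
          ∃[ t ] IsTheta π ε ε′ ζ τ t
        join (s , s-lim) (t , t-lim) = s +ℂ t , exp ∘ z , (λ n → exp-isExp (z n)) , Lim⇒HasSumℤ {exp ∘ z} s-lim t-lim

    thetaFunction : ThetaFunction π
    thetaFunction = record
      { θ = λ ε ε′ ζ τ → proj₁ (theta-exists ε ε′ ζ τ) ; isTheta = λ ε ε′ ζ τ → proj₂ (theta-exists ε ε′ ζ τ) }

-- Sums over boxes, products over coordinates, and indicators.

module BoxSums {c ℓ} (B : CommutativeRing c ℓ) where
  open CommutativeRing B
  open FiniteSums B
  open IntegerCoefficients B
  open RawSemiringDefs (RawRing.rawSemiring rawRing) using (_^_)

  Σ∈ : {X : Set} → List X → (X → Carrier) → Carrier
  Σ∈ []       f = 0#
  Σ∈ (x ∷ xs) f = f x + Σ∈ xs f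

  Σ∈-cong : {X : Set} (xs : List X) {f g : X → Carrier} → (∀ x → f x ≈ g x) → Σ∈ xs f ≈ Σ∈ xs g
  Σ∈-cong []       f≈g = refl
  Σ∈-cong (x ∷ xs) f≈g = +-cong (f≈g x) (Σ∈-cong xs f≈g)

  Σ∈-zero : {X : Set} (xs : List X) → Σ∈ xs (λ _ → 0#) ≈ 0#
  Σ∈-zero []       = refl
  Σ∈-zero (x ∷ xs) = trans (+-identityˡ _) (Σ∈-zero xs)

  Σ∈-+ : {X : Set} (xs : List X) (f g : X → Carrier) → Σ∈ xs (λ x → f x + g x) ≈ Σ∈ xs f + Σ∈ xs g
  Σ∈-+ []       f g = sym (+-identityˡ 0#)
  Σ∈-+ (x ∷ xs) f g = trans (+-congˡ (Σ∈-+ xs f g))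
    (solve 4 (λ a b s t → a :+ b :+ (s :+ t) := a :+ s :+ (b :+ t)) refl (f x) (g x) (Σ∈ xs f) (Σ∈ xs g))

  Σ∈-*ˡ : {X : Set} (xs : List X) (a : Carrier) (f : X → Carrier) → Σ∈ xs (λ x → a * f x) ≈ a * Σ∈ xs f
  Σ∈-*ˡ []       a f = sym (zeroʳ a)
  Σ∈-*ˡ (x ∷ xs) a f = trans (+-congˡ (Σ∈-*ˡ xs a f)) (sym (distribˡ _ _ _))

  Σ∈-*ʳ : {X : Set} (xs : List X) (a : Carrier) (f : X → Carrier) → Σ∈ xs (λ x → f x * a) ≈ Σ∈ xs f * a
  Σ∈-*ʳ []       a f = sym (zeroˡ a)
  Σ∈-*ʳ (x ∷ xs) a f = trans (+-congˡ (Σ∈-*ʳ xs a f)) (sym (distribʳ _ _ _))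

  Σ∈-++ : {X : Set} (xs ys : List X) (f : X → Carrier) → Σ∈ (xs ++ ys) f ≈ Σ∈ xs f + Σ∈ ys f
  Σ∈-++ []       ys f = sym (+-identityˡ _)
  Σ∈-++ (x ∷ xs) ys f = trans (+-congˡ (Σ∈-++ xs ys f)) (sym (+-assoc _ _ _))

  Σ∈-applyUpTo : {X : Set} (g : ℕ → X) (n : ℕ) (f : X → Carrier) → Σ∈ (applyUpTo g n) f ≈ Σ< n (f ∘ g)
  Σ∈-applyUpTo g zero    f = refl
  Σ∈-applyUpTo g (suc n) f = trans (+-congˡ (Σ∈-applyUpTo (g ∘ suc) n f)) (sym (Σ<-front n (f ∘ g)))

  Σbox : {X : Set} (d : ℕ) → List X → (Vec X d → Carrier) → Carrier
  Σbox zero    xs f = f []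
  Σbox (suc d) xs f = Σ∈ xs λ x → Σbox d xs λ v → f (x ∷ v)

  module _ {X : Set} (xs : List X) where

    Σbox-cong : ∀ d {f g : Vec X d → Carrier} → (∀ v → f v ≈ g v) → Σbox d xs f ≈ Σbox d xs g
    Σbox-cong zero    f≈g = f≈g []
    Σbox-cong (suc d) f≈g = Σ∈-cong xs λ x → Σbox-cong d λ v → f≈g (x ∷ v)

    Σbox-+ : ∀ d (f g : Vec X d → Carrier) → Σbox d xs (λ v → f v + g v) ≈ Σbox d xs f + Σbox d xs g
    Σbox-+ zero    f g = refl
    Σbox-+ (suc d) f g = trans (Σ∈-cong xs λ x → Σbox-+ d _ _) (Σ∈-+ xs _ _)

    Σbox-*ˡ : ∀ d a (f : Vec X d → Carrier) → Σbox d xs (λ v → a * f v) ≈ a * Σbox d xs f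
    Σbox-*ˡ zero    a f = refl
    Σbox-*ˡ (suc d) a f = trans (Σ∈-cong xs λ x → Σbox-*ˡ d a _) (Σ∈-*ˡ xs a _)

    Σbox-neg : ∀ d (f : Vec X d → Carrier) → Σbox d xs (λ v → - f v) ≈ - Σbox d xs f
    Σbox-neg d f = trans (Σbox-cong d λ v → solve 1 (λ x → :- x := :- con (+ 1) :* x) refl (f v))
      (trans (Σbox-*ˡ d (- 1#) f) (solve 1 (λ x → :- con (+ 1) :* x := :- x) refl (Σbox d xs f)))

    Σbox-zero : ∀ d → Σbox d xs (λ _ → 0#) ≈ 0#
    Σbox-zero zero    = refl
    Σbox-zero (suc d) = trans (Σ∈-cong xs λ x → Σbox-zero d) (Σ∈-zero xs)

    Σbox-Σ∈ : {Y : Set} (ys : List Y) → ∀ d (F : Vec X d → Y → Carrier) →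
      Σbox d xs (λ v → Σ∈ ys (F v)) ≈ Σ∈ ys (λ y → Σbox d xs (λ v → F v y))
    Σbox-Σ∈ []       d F = Σbox-zero d
    Σbox-Σ∈ (y ∷ ys) d F = trans (Σbox-+ d _ _) (+-congˡ (Σbox-Σ∈ ys d F))

    Σbox-swap : ∀ d e (F : Vec X d → Vec X e → Carrier) →
      Σbox d xs (λ v → Σbox e xs (F v)) ≈ Σbox e xs (λ w → Σbox d xs (λ v → F v w))
    Σbox-swap d zero    F = refl
    Σbox-swap d (suc e) F = trans (Σbox-Σ∈ xs d _) (Σ∈-cong xs λ x → Σbox-swap d e (λ v w → F v (x ∷ w)))

  ∏ : ∀ {d} → Vec Carrier d → Carrier
  ∏ []       = 1#
  ∏ (x ∷ xs) = x * ∏ xs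

  Σbox-power : {X : Set} (xs : List X) → ∀ d (g : X → Carrier) → Σbox d xs (λ v → ∏ (Vec.map g v)) ≈ Σ∈ xs g ^ d
  Σbox-power xs zero    g = refl
  Σbox-power xs (suc d) g = trans (Σ∈-cong xs λ x → trans (Σbox-*ˡ xs d (g x) _) (*-congˡ (Σbox-power xs d g)))
    (Σ∈-*ʳ xs _ g)

  -- Distributivity with a different factor in each coordinate. It lets the reflections of a point
  -- be counted coordinate by coordinate.
  Σbox-∏ : {X Y : Set} (xs : List X) (G : Y → X → Carrier) → ∀ {d} (ys : Vec Y d) →
    Σbox d xs (λ v → ∏ (Vec.zipWith G ys v)) ≈ ∏ (Vec.map (λ y → Σ∈ xs (G y)) ys)
  Σbox-∏ xs G [] = refl
  Σbox-∏ xs G {suc d} (y ∷ ys) = trans (Σ∈-cong xs λ x → trans (Σbox-*ˡ xs d (G y x) _) (*-congˡ (Σbox-∏ xs G ys)))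
    (Σ∈-*ʳ xs _ (G y))

  𝟙 : {P : Set} → Dec P → Carrier
  𝟙 (yes _) = 1#
  𝟙 (no _)  = 0#

  -- With at most one solution and no repetitions in the list, the count is 0 or 1. The value 0
  -- comes with the evidence that no entry is a solution, which the size estimate needs.
  count-solutions : {X : Set} {P : X → Set} (P? : ∀ x → Dec (P x)) → (∀ {x y} → P x → P y → x ≡ y) →
    ∀ {xs} → Unique xs → (Any P xs × Σ∈ xs (λ x → 𝟙 (P? x)) ≈ 1#) ⊎ (All (λ x → ¬ P x) xs × Σ∈ xs (λ x → 𝟙 (P? x)) ≈ 0#)
  count-solutions P? unique [] = inj₂ ([] , refl)
  count-solutions P? unique {x ∷ xs} (x∉xs ∷ xs!) with P? x | count-solutions P? unique xs!
  ... | yes px | inj₁ (any , _)  = ⊥-elim (All.lookupWith (λ x≢y py → x≢y (unique px py)) x∉xs any)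
  ... | yes px | inj₂ (_ , Σ≈0)  = inj₁ (here px , trans (+-congˡ Σ≈0) (+-identityʳ 1#))
  ... | no ¬px | inj₁ (any , Σ≈1) = inj₁ (there any , trans (+-identityˡ _) Σ≈1)
  ... | no ¬px | inj₂ (all , Σ≈0) = inj₂ (¬px ∷ all , trans (+-identityˡ _) Σ≈0)

  pointwise-indicator : {X Y : Set} {_∼_ : X → Y → Set} (_∼?_ : ∀ x y → Dec (x ∼ y)) → ∀ {d} (xs : Vec X d) (ys : Vec Y d) →
    (Pointwise _∼_ xs ys × ∏ (Vec.zipWith (λ x y → 𝟙 (x ∼? y)) xs ys) ≈ 1#)
    ⊎ (¬ Pointwise _∼_ xs ys × ∏ (Vec.zipWith (λ x y → 𝟙 (x ∼? y)) xs ys) ≈ 0#)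
  pointwise-indicator _∼?_ [] [] = inj₁ ([] , refl)
  pointwise-indicator _∼?_ (x ∷ xs) (y ∷ ys) with x ∼? y | pointwise-indicator _∼?_ xs ys
  ... | no x≁y  | _ = inj₂ ((λ { (x∼y ∷ _) → x≁y x∼y }) , zeroˡ _)
  ... | yes x∼y | inj₁ (p , ∏≈1) = inj₁ (x∼y ∷ p , trans (*-identityˡ _) ∏≈1)
  ... | yes x∼y | inj₂ (¬p , ∏≈0) = inj₂ ((λ { (_ ∷ p) → ¬p p }) , trans (*-identityˡ _) ∏≈0)

  ∏-zero-one : {X : Set} {P : X → Set} {g : X → Carrier} → (∀ x → g x ≈ 1# ⊎ (P x × g x ≈ 0#)) → ∀ {d} (v : Vec X d) →
    ∏ (Vec.map g v) ≈ 1# ⊎ (VecAny.Any P v × ∏ (Vec.map g v) ≈ 0#)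
  ∏-zero-one dichotomy [] = inj₁ refl
  ∏-zero-one {g = g} dichotomy (x ∷ v) with dichotomy x | ∏-zero-one dichotomy v
  ... | inj₂ (px , g≈0) | _ = inj₂ (here px , trans (*-congʳ g≈0) (zeroˡ _))
  ... | inj₁ g≈1 | inj₁ ∏≈1 = inj₁ (trans (*-cong g≈1 ∏≈1) (*-identityˡ 1#))
  ... | inj₁ g≈1 | inj₂ (any , ∏≈0) = inj₂ (there any , trans (*-congˡ ∏≈0) (zeroʳ _))

-- Integer boxes, the shifted lattice and its reflection.

-- Listed as -1 , -2 , ... and then 0 , 1 , ..., in the same two halves as `partialSumℤ`.
interval : ℕ → List ℤ
interval L = applyUpTo -[1+_] L ++ applyUpTo +_ (suc L)

∈-interval : ∀ {L} c → ℤ.∣ c ∣ ℕ.≤ L → c ∈ interval L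
∈-interval {L} (+ n)    n≤L = ∈-++⁺ʳ (applyUpTo -[1+_] L) (∈-applyUpTo⁺ +_ (ℕ.s≤s n≤L))
∈-interval {L} -[1+ n ] n<L = ∈-++⁺ˡ (∈-applyUpTo⁺ -[1+_] n<L)

interval-unique : ∀ L → Unique (interval L)
interval-unique L = Uniqueₚ.++⁺
  (Uniqueₚ.applyUpTo⁺₁ -[1+_] L (λ i<j _ e → ℕₚ.<⇒≢ i<j (ℤₚ.-[1+-injective e)))
  (Uniqueₚ.applyUpTo⁺₁ +_ (suc L) (λ i<j _ e → ℕₚ.<⇒≢ i<j (ℤₚ.+-injective e)))
  λ { (p , q) → disjoint p q }
  where
  disjoint : ∀ {x} → x ∈ applyUpTo -[1+_] L → x ∈ applyUpTo +_ (suc L) → ⊥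
  disjoint p q with ∈-applyUpTo⁻ -[1+_] p | ∈-applyUpTo⁻ +_ q
  ... | _ , _ , ≡.refl | _ , _ , ()

length-interval : ∀ L → length (interval L) ≡ L ℕ.+ suc L
length-interval L = ≡.trans (Listₚ.length-++ (applyUpTo -[1+_] L))
  (≡.cong₂ ℕ._+_ (Listₚ.length-applyUpTo -[1+_] L) (Listₚ.length-applyUpTo +_ (suc L)))

∣i∣*∣i∣≡i*i : ∀ i → + (ℤ.∣ i ∣ ℕ.* ℤ.∣ i ∣) ≡ i ℤ.* i
∣i∣*∣i∣≡i*i (+ n)    = ℤₚ.pos-* n n
∣i∣*∣i∣≡i*i -[1+ n ] = ≡.refl

sumℤ : ∀ {d} → Vec ℤ d → ℤ
sumℤ []      = + 0
sumℤ (x ∷ v) = x ℤ.+ sumℤ v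

sumℕ : ∀ {d} → Vec ℕ d → ℕ
sumℕ []      = 0
sumℕ (x ∷ v) = x ℕ.+ sumℕ v

-- For the characteristic ε = p / 5 the lattice is 10 ℤ + p, scaled by 1 / 10.
module ShiftedLattice (p : ℕ) where
  open +-*-Solver

  point : ℤ → ℤ
  point n = + 10 ℤ.* n ℤ.+ + p

  sq : ℤ → ℕ
  sq n = ℤ.∣ point n ∣ ℕ.* ℤ.∣ point n ∣

  norm : ∀ {d} → Vec ℤ d → ℕ
  norm v = sumℕ (Vec.map sq v)

  -- For d = 5 this is the number X of the overview: the coordinates x are `point n` / 10, and 2 (10
  -- Σn + 5p) / 10 = 2 Σn + p. It is odd exactly when `p` is.
  trace : ∀ {d} → Vec ℤ d → ℤ
  trace v = + 2 ℤ.* sumℤ v ℤ.+ + p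

  private
    +norm : ∀ {d} (v : Vec ℤ d) → + norm v ≡ sumℤ (Vec.map (λ n → point n ℤ.* point n) v)
    +norm []      = ≡.refl
    +norm (x ∷ v) = ≡.trans (ℤₚ.pos-+ (sq x) (norm v)) (≡.cong₂ ℤ._+_ (∣i∣*∣i∣≡i*i (point x)) (+norm v))

  sum-points : (v : Vec ℤ 5) → sumℤ (Vec.map point v) ≡ + 5 ℤ.* trace v
  sum-points (a ∷ b ∷ c ∷ d ∷ e ∷ []) = solve 6 (λ a b c d e p →
    con (+ 10) :* a :+ p :+ (con (+ 10) :* b :+ p :+ (con (+ 10) :* c :+ p :+ (con (+ 10) :* d :+ p :+ (con (+ 10) :* e :+ p :+ con (+ 0)))))
    := con (+ 5) :* (con (+ 2) :* (a :+ (b :+ (c :+ (d :+ (e :+ con (+ 0)))))) :+ p)) ≡.refl a b c d e (+ p)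

  Shifted : ∀ {d} → ℤ → Vec ℤ d → Vec ℤ d → Set
  Shifted t = Pointwise (λ a c → a ≡ c ℤ.+ t)

  -- For x = trace v this is one coordinate of the reflection, c = a - x / 5, in a form without division.
  Reflects : ℤ → ℤ → ℤ → Set
  Reflects x a c = + 5 ℤ.* c ℤ.+ x ≡ + 5 ℤ.* a

  trace-reflection : ∀ t {v w : Vec ℤ 5} → Shifted t v w → trace v ≡ + 5 ℤ.* t → trace w ≡ + 5 ℤ.* (ℤ.- t)
  trace-reflection t {w = a ∷ b ∷ c ∷ d ∷ e ∷ []} (≡.refl ∷ ≡.refl ∷ ≡.refl ∷ ≡.refl ∷ ≡.refl ∷ []) tr = ≡.trans
    (solve 7 (λ a b c d e p t → con (+ 2) :* (a :+ (b :+ (c :+ (d :+ (e :+ con (+ 0)))))) :+ p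
      := con (+ 2) :* (a :+ t :+ (b :+ t :+ (c :+ t :+ (d :+ t :+ (e :+ t :+ con (+ 0)))))) :+ p :- con (+ 10) :* t) ≡.refl a b c d e (+ p) t)
    (≡.trans (≡.cong (ℤ._- (+ 10 ℤ.* t)) tr) (solve 1 (λ t → con (+ 5) :* t :- con (+ 10) :* t := con (+ 5) :* (:- t)) ≡.refl t))

  -- Expanding the squares, norm v - norm w = 100 t (trace w + 5t), and the bracket vanishes because
  -- reflection changes the sign of the trace.
  norm-reflection : ∀ t {v w : Vec ℤ 5} → Shifted t v w → trace v ≡ + 5 ℤ.* t → norm v ≡ norm w
  norm-reflection t {v} {w} s tr = ℤₚ.+-injective (≡.trans (+norm v) (≡.trans (squares s (trace-reflection t s tr)) (≡.sym (+norm w))))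
    where
    squares : ∀ {v w : Vec ℤ 5} → Shifted t v w → trace w ≡ + 5 ℤ.* (ℤ.- t) →
      sumℤ (Vec.map (λ n → point n ℤ.* point n) v) ≡ sumℤ (Vec.map (λ n → point n ℤ.* point n) w)
    squares {w = a ∷ b ∷ c ∷ d ∷ e ∷ []} (≡.refl ∷ ≡.refl ∷ ≡.refl ∷ ≡.refl ∷ ≡.refl ∷ []) tr′ = ≡.trans
      (solve 7 (λ a b c d e p t →
        let P = λ x → (con (+ 10) :* x :+ p) :* (con (+ 10) :* x :+ p) in
        P (a :+ t) :+ (P (b :+ t) :+ (P (c :+ t) :+ (P (d :+ t) :+ (P (e :+ t) :+ con (+ 0)))))
        := P a :+ (P b :+ (P c :+ (P d :+ (P e :+ con (+ 0))))) :+ con (+ 100) :* t :* (con (+ 2) :* (a :+ (b :+ (c :+ (d :+ (e :+ con (+ 0)))))) :+ p :+ con (+ 5) :* t))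
        ≡.refl a b c d e (+ p) t)
      (≡.trans (≡.cong (λ x → S ℤ.+ + 100 ℤ.* t ℤ.* (x ℤ.+ + 5 ℤ.* t)) tr′)
        (solve 2 (λ s t → s :+ con (+ 100) :* t :* (con (+ 5) :* (:- t) :+ con (+ 5) :* t) := s) ≡.refl S t))
      where S = sumℤ (Vec.map (λ n → point n ℤ.* point n) (a ∷ b ∷ c ∷ d ∷ e ∷ []))

  Reflects⇒Shifted : ∀ {x} t → x ≡ + 5 ℤ.* t → ∀ {d} {v w : Vec ℤ d} → Pointwise (Reflects x) v w → Shifted t v w
  Reflects⇒Shifted t ≡.refl = Pointwise.map λ {a} {c} e → ℤₚ.*-cancelˡ-≡ (+ 5) a (c ℤ.+ t) (≡.trans (≡.sym e)
    (solve 2 (λ c t → con (+ 5) :* c :+ con (+ 5) :* t := con (+ 5) :* (c :+ t)) ≡.refl c t))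

  -- One coordinate suffices to see that 5 divides `x`: the quotient is the difference a - c.
  reflection-trace : ∀ {x d} {v w : Vec ℤ (suc d)} → Pointwise (Reflects x) v w → ∃[ t ] x ≡ + 5 ℤ.* t
  reflection-trace {x} {v = a ∷ _} {c ∷ _} (e ∷ _) = a ℤ.- c , ≡.trans
    (solve 2 (λ c x → x := con (+ 5) :* c :+ x :- con (+ 5) :* c) ≡.refl c x)
    (≡.trans (≡.cong (ℤ._- (+ 5 ℤ.* c)) e) (solve 2 (λ a c → con (+ 5) :* a :- con (+ 5) :* c := con (+ 5) :* (a :- c)) ≡.refl a c))

  Shifted⇒Reflects : ∀ {x} t → x ≡ + 5 ℤ.* (ℤ.- t) → ∀ {d} {v w : Vec ℤ d} → Shifted t v w → Pointwise (Reflects x) w v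
  Shifted⇒Reflects t ≡.refl []           = []
  Shifted⇒Reflects t ≡.refl {w = c ∷ _} (≡.refl ∷ s) =
    solve 2 (λ c t → con (+ 5) :* (c :+ t) :+ con (+ 5) :* (:- t) := con (+ 5) :* c) ≡.refl c t ∷ Shifted⇒Reflects t ≡.refl s

  Reflects-unique : ∀ {x a c c′} → Reflects x a c → Reflects x a c′ → c ≡ c′
  Reflects-unique {x} {a} {c} {c′} e e′ = ℤₚ.*-cancelˡ-≡ (+ 5) c c′ (RingProperties.+-cancelʳ ℤₚ.+-*-ring x (+ 5 ℤ.* c) (+ 5 ℤ.* c′) (≡.trans e (≡.sym e′)))

  -- |10c + p| ≥ 10 (L + 1) - p, so the loss due to the shift is at most one step of the lattice.
  10L≤∣point∣ : p ℕ.≤ 10 → ∀ {L} c → L ℕ.< ℤ.∣ c ∣ → 10 ℕ.* L ℕ.≤ ℤ.∣ point c ∣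
  10L≤∣point∣ p≤10 {L} c L<c = ℕₚ.+-cancelʳ-≤ 10 (10 ℕ.* L) ℤ.∣ point c ∣ (begin
    10 ℕ.* L ℕ.+ 10                  ≡⟨ ℕₚ.+-comm (10 ℕ.* L) 10 ⟩
    10 ℕ.+ 10 ℕ.* L                  ≡⟨ ℕₚ.*-suc 10 L ⟨
    10 ℕ.* suc L                     ≤⟨ ℕₚ.*-monoʳ-≤ 10 L<c ⟩
    10 ℕ.* ℤ.∣ c ∣                   ≡⟨ ℤₚ.abs-* (+ 10) c ⟨
    ℤ.∣ + 10 ℤ.* c ∣                 ≡⟨ ≡.cong ℤ.∣_∣ (solve 2 (λ c p → con (+ 10) :* c := con (+ 10) :* c :+ p :- p) ≡.refl c (+ p)) ⟩
    ℤ.∣ point c ℤ.- + p ∣            ≤⟨ ℤₚ.∣i-j∣≤∣i∣+∣j∣ (point c) (+ p) ⟩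
    ℤ.∣ point c ∣ ℕ.+ p              ≤⟨ ℕₚ.+-monoʳ-≤ ℤ.∣ point c ∣ p≤10 ⟩
    ℤ.∣ point c ∣ ℕ.+ 10             ∎)
    where open ℕₚ.≤-Reasoning

  norm-≥ : ∀ {K t d} {v w : Vec ℤ d} → Shifted t v w → VecAny.Any (λ a → K ℕ.≤ sq (a ℤ.- t)) v → K ℕ.≤ norm w
  norm-≥ {K} {t} {w = c ∷ w} (≡.refl ∷ s) (here K≤) = ℕₚ.≤-trans
    (≡.subst (λ n → K ℕ.≤ sq n) (solve 2 (λ c t → c :+ t :- t := c) ≡.refl c t) K≤) (ℕₚ.m≤m+n (sq c) (norm w))
  norm-≥ {w = c ∷ w} (_ ∷ s) (there any) = ℕₚ.≤-trans (norm-≥ s any) (ℕₚ.m≤n+m (norm w) (sq c))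

  shift-back : ∀ t {d} (v : Vec ℤ d) → Shifted t v (Vec.map (ℤ._- t) v)
  shift-back t []      = []
  shift-back t (a ∷ v) = solve 2 (λ a t → a := a :- t :+ t) ≡.refl a t ∷ shift-back t v

  -- The point `v` itself may be small in every coordinate that fails; but its reflection has a
  -- coordinate beyond L, hence a large norm, and reflection preserves the norm.
  norm-outside-box : p ℕ.≤ 10 → ∀ {L} t (v : Vec ℤ 5) → trace v ≡ + 5 ℤ.* t →
    VecAny.Any (λ a → All (λ c → ¬ Reflects (trace v) a c) (interval L)) v → (10 ℕ.* L) ℕ.* (10 ℕ.* L) ℕ.≤ norm v
  norm-outside-box p≤10 {L} t v tr any = ≡.subst (_ ℕ.≤_) (≡.sym (norm-reflection t (shift-back t v) tr))
    (norm-≥ (shift-back t v) (VecAny.map far any))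
    where
    far : ∀ {a} → All (λ c → ¬ Reflects (trace v) a c) (interval L) → (10 ℕ.* L) ℕ.* (10 ℕ.* L) ℕ.≤ sq (a ℤ.- t)
    far {a} none = ℕₚ.*-mono-≤ 10L≤ 10L≤
      where
      L<∣a-t∣ : L ℕ.< ℤ.∣ a ℤ.- t ∣
      L<∣a-t∣ = ℕₚ.≰⇒> λ ∣a-t∣≤L → All.lookup none (∈-interval (a ℤ.- t) ∣a-t∣≤L)
        (≡.trans (≡.cong (λ x → + 5 ℤ.* (a ℤ.- t) ℤ.+ x) tr) (solve 2 (λ a t → con (+ 5) :* (a :- t) :+ con (+ 5) :* t := con (+ 5) :* a) ≡.refl a t))
      10L≤ = 10L≤∣point∣ p≤10 (a ℤ.- t) L<∣a-t∣

-- Powers of a primitive 20th root of unity and their alternating sums.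

module Characters {c ℓ₁ ℓ₂ ℓ₃} (R : RealNumbers c ℓ₁ ℓ₂ ℓ₃) {a ℓ m} (𝒜 : NormedAlgebra R a ℓ m) where
  open OrderedField R using (0#; 1#)
  open NormedAlgebra 𝒜
  open Exponential R 𝒜 using (exp; exp-cong; exp-+; exp-0)
  open IntegerCoefficients algebra using ()
    renaming (solve to solveᴬ; _:=_ to _⊜_; _:+_ to _⊕_; _:*_ to _⊗_; _:-_ to _⊖_; :-_ to ⊝_; con to κ; ι to ιᴬ; ι-+ to ιᴬ-+)

  -- For z = πi / 10 these are the powers of ω. With z = πiτ / 100 the same function, evaluated at
  -- the integral norm of a lattice point, is the Gaussian factor.
  character : A → ℤ → A
  character z m = exp (ιᴬ m *ᴬ z)

  character-+ : ∀ z m n → character z (m ℤ.+ n) ≈ᴬ character z m *ᴬ character z n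
  character-+ z m n = 𝔸.trans (exp-cong (𝔸.trans (𝔸.*-congʳ (ιᴬ-+ m n)) (𝔸.distribʳ z _ _))) (exp-+ _ _)

  character-0 : ∀ z → character z (+ 0) ≈ᴬ 1ᴬ
  character-0 z = 𝔸.trans (exp-cong (𝔸.zeroˡ z)) exp-0

  module _ (z : A) (E10 : character z (+ 10) ≈ᴬ -ᴬ 1ᴬ) where
    private
      E : ℤ → A
      E = character z

    -E : ∀ m → -ᴬ E m ≈ᴬ E (m ℤ.+ + 10)
    -E m = 𝔸.sym (𝔸.trans (character-+ z m (+ 10)) (𝔸.trans (𝔸.*-congˡ E10) (solveᴬ 1 (λ x → x ⊗ ⊝ κ (+ 1) ⊜ ⊝ x) 𝔸.refl (E m))))

    private
      E20 : E (+ 20) ≈ᴬ 1ᴬ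
      E20 = 𝔸.trans (𝔸.sym (-E (+ 10))) (𝔸.trans (𝔸.-‿cong E10) (solveᴬ 0 (⊝ ⊝ κ (+ 1) ⊜ κ (+ 1)) 𝔸.refl))

      E20n : ∀ n → E (+ 20 ℤ.* + n) ≈ᴬ 1ᴬ
      E20n zero    = character-0 z
      E20n (suc n) = 𝔸.trans (𝔸.reflexive (≡.cong E (ℤₚ.*-distribˡ-+ (+ 20) (+ 1) (+ n))))
        (𝔸.trans (character-+ z (+ 20) (+ 20 ℤ.* + n)) (𝔸.trans (𝔸.*-cong E20 (E20n n)) (𝔸.*-identityˡ 1ᴬ)))

      E20m : ∀ m → E (+ 20 ℤ.* m) ≈ᴬ 1ᴬ
      E20m (+ n)    = E20n n
      E20m -[1+ n ] = 𝔸.trans (𝔸.sym (𝔸.*-identityʳ _)) (𝔸.trans (𝔸.*-congˡ (𝔸.sym (E20n (suc n))))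
        (𝔸.trans (𝔸.sym (character-+ z (+ 20 ℤ.* -[1+ n ]) (+ 20 ℤ.* + suc n)))
          (𝔸.trans (𝔸.reflexive (≡.cong E (ℤₚ.+-inverseˡ (+ 20 ℤ.* + suc n)))) (character-0 z))))

    E-periodic : ∀ {x} y m → x ≡ y ℤ.+ + 20 ℤ.* m → E x ≈ᴬ E y
    E-periodic y m ≡.refl = 𝔸.trans (character-+ z y (+ 20 ℤ.* m)) (𝔸.trans (𝔸.*-congˡ (E20m m)) (𝔸.*-identityʳ _))

    alternatingSum : ℤ → A
    alternatingSum x = E (+ 1 ℤ.* x) -ᴬ E (+ 3 ℤ.* x) +ᴬ E (+ 5 ℤ.* x) -ᴬ E (+ 7 ℤ.* x) +ᴬ E (+ 9 ℤ.* x)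

    private
      open +-*-Solver

      -- Put l = 2j + 1. The sign contributes ω¹⁰, and the exponents 5lt + 10 and -5lt differ by 10
      -- (lt + 1). This is a multiple of 20 because l and t are odd.
      E-flip : ∀ {x y} j t k → x ≡ + 5 ℤ.* t → y ≡ + 5 ℤ.* (ℤ.- t) → x ≡ + 2 ℤ.* k ℤ.+ + 1 →
        E ((+ 2 ℤ.* j ℤ.+ + 1) ℤ.* y) ≈ᴬ -ᴬ E ((+ 2 ℤ.* j ℤ.+ + 1) ℤ.* x)
      E-flip j t k ≡.refl ≡.refl e = 𝔸.sym (𝔸.trans (-E ((+ 2 ℤ.* j ℤ.+ + 1) ℤ.* (+ 5 ℤ.* t)))
        (E-periodic ((+ 2 ℤ.* j ℤ.+ + 1) ℤ.* (+ 5 ℤ.* (ℤ.- t))) (+ 2 ℤ.* j ℤ.* s ℤ.+ s ℤ.+ j ℤ.+ + 1)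
        (≡.subst (λ t → (+ 2 ℤ.* j ℤ.+ + 1) ℤ.* (+ 5 ℤ.* t) ℤ.+ + 10
            ≡ (+ 2 ℤ.* j ℤ.+ + 1) ℤ.* (+ 5 ℤ.* (ℤ.- t)) ℤ.+ + 20 ℤ.* (+ 2 ℤ.* j ℤ.* s ℤ.+ s ℤ.+ j ℤ.+ + 1)) (≡.sym t-odd)
          (solve 2 (λ j s → (con (+ 2) :* j :+ con (+ 1)) :* (con (+ 5) :* (con (+ 2) :* s :+ con (+ 1))) :+ con (+ 10)
            := (con (+ 2) :* j :+ con (+ 1)) :* (con (+ 5) :* (:- (con (+ 2) :* s :+ con (+ 1)))) :+ con (+ 20) :* (con (+ 2) :* j :* s :+ s :+ j :+ con (+ 1))) ≡.refl j s))))
        where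
        s = k ℤ.- + 2 ℤ.* t
        t-odd : t ≡ + 2 ℤ.* s ℤ.+ + 1
        t-odd = ≡.trans (solve 1 (λ t → t := con (+ 5) :* t :- con (+ 4) :* t) ≡.refl t) (≡.trans (≡.cong (ℤ._- + 4 ℤ.* t) e)
          (solve 2 (λ k t → con (+ 2) :* k :+ con (+ 1) :- con (+ 4) :* t := con (+ 2) :* (k :- con (+ 2) :* t) :+ con (+ 1)) ≡.refl k t))

    alternatingSum-odd : ∀ {x y} t k → x ≡ + 5 ℤ.* t → y ≡ + 5 ℤ.* (ℤ.- t) → x ≡ + 2 ℤ.* k ℤ.+ + 1 →
      alternatingSum y ≈ᴬ -ᴬ alternatingSum x
    alternatingSum-odd {x} t k p q e = 𝔸.trans
      (𝔸.+-cong (𝔸.+-cong (𝔸.+-cong (𝔸.+-cong (E-flip (+ 0) t k p q e) (𝔸.-‿cong (E-flip (+ 1) t k p q e))) (E-flip (+ 2) t k p q e)) (𝔸.-‿cong (E-flip (+ 3) t k p q e))) (E-flip (+ 4) t k p q e))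
      (solveᴬ 5 (λ a b c d e → ⊝ a ⊖ ⊝ b ⊕ ⊝ c ⊖ ⊝ d ⊕ ⊝ e ⊜ ⊝ (a ⊖ b ⊕ c ⊖ d ⊕ e)) 𝔸.refl
        (E (+ 1 ℤ.* x)) (E (+ 3 ℤ.* x)) (E (+ 5 ℤ.* x)) (E (+ 7 ℤ.* x)) (E (+ 9 ℤ.* x)))

    module _ (roots : E (+ 0) +ᴬ E (+ 4) +ᴬ E (+ 8) +ᴬ E (+ 12) +ᴬ E (+ 16) ≈ᴬ 0ᴬ) where

      private
        geometric : ∀ x → A
        geometric r = E (+ 0) +ᴬ E (+ 4 ℤ.* r) +ᴬ E (+ 8 ℤ.* r) +ᴬ E (+ 12 ℤ.* r) +ᴬ E (+ 16 ℤ.* r)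

        -- Writing -1 as ω¹⁰, the ratio of consecutive terms is ω to the power 2x + 10 = 4 (k + 3).
        -- This is the origin of the 3; replacing k + 3 by its residue r modulo 5 changes the
        -- exponents by multiples of 20.
        alternating≈geometric : ∀ k r q → k ℤ.+ + 3 ≡ r ℤ.+ q ℤ.* + 5 → let x = + 2 ℤ.* k ℤ.+ + 1 in
          alternatingSum x ≈ᴬ E x *ᴬ geometric r
        alternating≈geometric k r q e = 𝔸.trans
          (𝔸.+-cong (𝔸.+-cong (𝔸.+-cong (𝔸.+-cong
            (term (+ 0) (+ 0) (solve 2 (λ x r → con (+ 1) :* x := x :+ con (+ 0) :+ con (+ 20) :* con (+ 0)) ≡.refl x r))
            (𝔸.trans (-E (+ 3 ℤ.* x)) (term (+ 4 ℤ.* r) q (by-k (λ k → + 3 ℤ.* (+ 2 ℤ.* k ℤ.+ + 1) ℤ.+ + 10 ≡ + 2 ℤ.* k ℤ.+ + 1 ℤ.+ + 4 ℤ.* r ℤ.+ + 20 ℤ.* q)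
              (solve 2 (λ r q → let k = r :+ q :* con (+ 5) :- con (+ 3) in con (+ 3) :* (con (+ 2) :* k :+ con (+ 1)) :+ con (+ 10)
                := con (+ 2) :* k :+ con (+ 1) :+ con (+ 4) :* r :+ con (+ 20) :* q) ≡.refl r q)))))
            (term (+ 8 ℤ.* r) (+ 2 ℤ.* q ℤ.- + 1) (by-k (λ k → + 5 ℤ.* (+ 2 ℤ.* k ℤ.+ + 1) ≡ + 2 ℤ.* k ℤ.+ + 1 ℤ.+ + 8 ℤ.* r ℤ.+ + 20 ℤ.* (+ 2 ℤ.* q ℤ.- + 1))
              (solve 2 (λ r q → let k = r :+ q :* con (+ 5) :- con (+ 3) in con (+ 5) :* (con (+ 2) :* k :+ con (+ 1))
                := con (+ 2) :* k :+ con (+ 1) :+ con (+ 8) :* r :+ con (+ 20) :* (con (+ 2) :* q :- con (+ 1))) ≡.refl r q))))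
            (𝔸.trans (-E (+ 7 ℤ.* x)) (term (+ 12 ℤ.* r) (+ 3 ℤ.* q ℤ.- + 1) (by-k (λ k → + 7 ℤ.* (+ 2 ℤ.* k ℤ.+ + 1) ℤ.+ + 10 ≡ + 2 ℤ.* k ℤ.+ + 1 ℤ.+ + 12 ℤ.* r ℤ.+ + 20 ℤ.* (+ 3 ℤ.* q ℤ.- + 1))
              (solve 2 (λ r q → let k = r :+ q :* con (+ 5) :- con (+ 3) in con (+ 7) :* (con (+ 2) :* k :+ con (+ 1)) :+ con (+ 10)
                := con (+ 2) :* k :+ con (+ 1) :+ con (+ 12) :* r :+ con (+ 20) :* (con (+ 3) :* q :- con (+ 1))) ≡.refl r q)))))
            (term (+ 16 ℤ.* r) (+ 4 ℤ.* q ℤ.- + 2) (by-k (λ k → + 9 ℤ.* (+ 2 ℤ.* k ℤ.+ + 1) ≡ + 2 ℤ.* k ℤ.+ + 1 ℤ.+ + 16 ℤ.* r ℤ.+ + 20 ℤ.* (+ 4 ℤ.* q ℤ.- + 2))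
              (solve 2 (λ r q → let k = r :+ q :* con (+ 5) :- con (+ 3) in con (+ 9) :* (con (+ 2) :* k :+ con (+ 1))
                := con (+ 2) :* k :+ con (+ 1) :+ con (+ 16) :* r :+ con (+ 20) :* (con (+ 4) :* q :- con (+ 2))) ≡.refl r q))))
          (solveᴬ 6 (λ x a b c d e → x ⊗ a ⊕ x ⊗ b ⊕ x ⊗ c ⊕ x ⊗ d ⊕ x ⊗ e ⊜ x ⊗ (a ⊕ b ⊕ c ⊕ d ⊕ e)) 𝔸.refl
            (E x) (E (+ 0)) (E (+ 4 ℤ.* r)) (E (+ 8 ℤ.* r)) (E (+ 12 ℤ.* r)) (E (+ 16 ℤ.* r)))
          where
          x = + 2 ℤ.* k ℤ.+ + 1
          by-k : (P : ℤ → Set) → P (r ℤ.+ q ℤ.* + 5 ℤ.- + 3) → P k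
          by-k P = ≡.subst P (≡.trans (≡.cong (ℤ._- + 3) (≡.sym e)) (solve 1 (λ k → k :+ con (+ 3) :- con (+ 3) := k) ≡.refl k))
          term : ∀ {u} y m → u ≡ x ℤ.+ y ℤ.+ + 20 ℤ.* m → E u ≈ᴬ E x *ᴬ E y
          term y m e = 𝔸.trans (E-periodic (x ℤ.+ y) m e) (character-+ z x y)

        -- For r prime to 5, multiplication by r permutes the exponents 0, 4, 8, 12, 16 modulo 20,
        -- so the sum is again that of all fifth roots of unity.
        geometric-zero : ∀ r → r ℕ.< 5 → r ≡ 0 ⊎ geometric (+ r) ≈ᴬ 0ᴬ
        geometric-zero 0 _ = inj₁ ≡.refl
        geometric-zero 1 _ = inj₂ roots
        geometric-zero 2 _ = inj₂ (𝔸.trans (𝔸.+-cong (𝔸.+-congˡ (E-periodic (+ 4) (+ 1) ≡.refl)) (E-periodic (+ 12) (+ 1) ≡.refl))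
          (𝔸.trans (solveᴬ 5 (λ a b c d e → a ⊕ c ⊕ e ⊕ b ⊕ d ⊜ a ⊕ b ⊕ c ⊕ d ⊕ e) 𝔸.refl (E (+ 0)) (E (+ 4)) (E (+ 8)) (E (+ 12)) (E (+ 16))) roots))
        geometric-zero 3 _ = inj₂ (𝔸.trans (𝔸.+-cong (𝔸.+-cong (𝔸.+-congˡ (E-periodic (+ 4) (+ 1) ≡.refl)) (E-periodic (+ 16) (+ 1) ≡.refl)) (E-periodic (+ 8) (+ 2) ≡.refl))
          (𝔸.trans (solveᴬ 5 (λ a b c d e → a ⊕ d ⊕ b ⊕ e ⊕ c ⊜ a ⊕ b ⊕ c ⊕ d ⊕ e) 𝔸.refl (E (+ 0)) (E (+ 4)) (E (+ 8)) (E (+ 12)) (E (+ 16))) roots))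
        geometric-zero 4 _ = inj₂ (𝔸.trans (𝔸.+-cong (𝔸.+-cong (𝔸.+-congˡ (E-periodic (+ 12) (+ 1) ≡.refl)) (E-periodic (+ 8) (+ 2) ≡.refl)) (E-periodic (+ 4) (+ 3) ≡.refl))
          (𝔸.trans (solveᴬ 5 (λ a b c d e → a ⊕ e ⊕ d ⊕ c ⊕ b ⊜ a ⊕ b ⊕ c ⊕ d ⊕ e) 𝔸.refl (E (+ 0)) (E (+ 4)) (E (+ 8)) (E (+ 12)) (E (+ 16))) roots))
        geometric-zero (suc (suc (suc (suc (suc _))))) (ℕ.s≤s (ℕ.s≤s (ℕ.s≤s (ℕ.s≤s (ℕ.s≤s ())))))

      alternatingSum-zero : ∀ k → let x = + 2 ℤ.* k ℤ.+ + 1 in (∃[ t ] x ≡ + 5 ℤ.* t) ⊎ alternatingSum x ≈ᴬ 0ᴬ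
      alternatingSum-zero k = from (geometric-zero r (ℤDivMod.n%ℕd<d (k ℤ.+ + 3) 5))
        where
        r = (k ℤ.+ + 3) ℤDivMod.%ℕ 5
        q = (k ℤ.+ + 3) ℤDivMod./ℕ 5
        division : k ℤ.+ + 3 ≡ + r ℤ.+ q ℤ.* + 5
        division = ℤDivMod.a≡a%ℕn+[a/ℕn]*n (k ℤ.+ + 3) 5
        from : r ≡ 0 ⊎ geometric (+ r) ≈ᴬ 0ᴬ → (∃[ t ] + 2 ℤ.* k ℤ.+ + 1 ≡ + 5 ℤ.* t) ⊎ alternatingSum (+ 2 ℤ.* k ℤ.+ + 1) ≈ᴬ 0ᴬ
        from (inj₂ G≈0) = inj₂ (𝔸.trans (alternating≈geometric k (+ r) q division) (𝔸.trans (𝔸.*-congˡ G≈0) (𝔸.zeroʳ _)))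
        -- Here k + 3 = 5q, and 2k + 1 = 2 (k + 3) - 5 = 5 (2q - 1).
        from (inj₁ r≡0) = inj₁ (+ 2 ℤ.* q ℤ.- + 1 , ≡.trans
          (solve 1 (λ k → con (+ 2) :* k :+ con (+ 1) := con (+ 2) :* (k :+ con (+ 3)) :- con (+ 5)) ≡.refl k)
          (≡.trans (≡.cong (λ y → + 2 ℤ.* y ℤ.- + 5) (≡.trans division (≡.cong (λ r → + r ℤ.+ q ℤ.* + 5) r≡0)))
            (solve 1 (λ q → con (+ 2) :* (con (+ 0) :+ q :* con (+ 5)) :- con (+ 5) := con (+ 5) :* (con (+ 2) :* q :- con (+ 1))) ≡.refl q)))

    alternatingSum-⊑ : (∀ m → E m ⊑ 1#) → ∀ x → alternatingSum x ⊑ OrderedField.ι R (+ 5)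
    alternatingSum-⊑ unit x = ⊑-+ (⊑-+ (⊑-+ (⊑-+ (unit (+ 1 ℤ.* x)) (⊑-neg (unit (+ 3 ℤ.* x)))) (unit (+ 5 ℤ.* x))) (⊑-neg (unit (+ 7 ℤ.* x)))) (unit (+ 9 ℤ.* x))

-- Cancellation under the reflection, and the limit of the box sums.

module AlternatingFifthPowers {c ℓ₁ ℓ₂ ℓ₃} (R : RealNumbers c ℓ₁ ℓ₂ ℓ₃) {a ℓ m} (𝒜 : NormedAlgebra R a ℓ m) where
  open OrderedField R
  open NullSequences R
  open NormedAlgebra 𝒜
  open Limits R 𝒜
  open FiniteSums algebra
  open BoxSums algebra
  open Exponential R 𝒜 using (exp; exp-cong; exp-+; exp-0)
  open Characters R 𝒜
  open IntegerCoefficients algebra using ()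
    renaming (solve to solveᴬ; _:=_ to _⊜_; _:+_ to _⊕_; _:*_ to _⊗_; _:-_ to _⊖_; :-_ to ⊝_; con to κ; ι to ιᴬ; ι-+ to ιᴬ-+; ι-* to ιᴬ-*)
  open RawSemiringDefs (RawRing.rawSemiring 𝔸.rawRing) using (_^_)
  open RawSemiringDefs (RawRing.rawSemiring rawRing) using () renaming (_^_ to _^ᴿ_)

  double-cancel : ∀ {x} → x ≈ᴬ -ᴬ x → x ≈ᴬ 0ᴬ
  double-cancel {x} x≈-x = 𝔸.trans (𝔸.sym (𝔸.*-identityˡ x)) (𝔸.trans (𝔸.*-congʳ (𝔸.sym 2h≈1))
    (𝔸.trans (solveᴬ 2 (λ h x → (h ⊕ h) ⊗ x ⊜ h ⊗ (x ⊕ x)) 𝔸.refl (ofℝ h) x)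
      (𝔸.trans (𝔸.*-congˡ (𝔸.trans (𝔸.+-congˡ x≈-x) (𝔸.-‿inverseʳ x))) (𝔸.zeroʳ _))))
    where
    h = proj₁ (halve 0<1)
    2h≈1 : ofℝ h +ᴬ ofℝ h ≈ᴬ 1ᴬ
    2h≈1 = 𝔸.trans (𝔸.sym (ofℝ-+ h h)) (𝔸.trans (ofℝ-cong (proj₂ (proj₂ (halve 0<1)))) ofℝ-1)

  Σ∈-⊑ : {X : Set} (xs : List X) {f : X → A} {b : ℝ} → (∀ x → f x ⊑ b) → Σ∈ xs f ⊑ (length xs · 1#) * b
  Σ∈-⊑ []       {b = b} f⊑b = ⊑-zero (≤-reflexive (sym (zeroˡ b)))
  Σ∈-⊑ (x ∷ xs) {b = b} f⊑b = ⊑-weaken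
    (≤-reflexive (solve 2 (λ n b → b :+ n :* b := (con (+ 1) :+ n) :* b) refl (length xs · 1#) b)) (⊑-+ (f⊑b x) (Σ∈-⊑ xs f⊑b))

  Σbox-⊑ : {X : Set} (xs : List X) → ∀ d {f : Vec X d → A} {b : ℝ} → (∀ v → f v ⊑ b) → Σbox d xs f ⊑ (length xs · 1#) ^ᴿ d * b
  Σbox-⊑ xs zero    {b = b} f⊑b = ⊑-weaken (≤-reflexive (sym (*-identityˡ b))) (f⊑b [])
  Σbox-⊑ xs (suc d) {b = b} f⊑b = ⊑-weaken (≤-reflexive (sym (*-assoc _ _ _)))
    (Σ∈-⊑ xs λ x → Σbox-⊑ xs d λ v → f⊑b (x ∷ v))

  Σbox-alternating : {X : Set} (xs : List X) → ∀ d (f₀ f₁ f₂ f₃ f₄ : Vec X d → A) →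
    Σbox d xs f₀ -ᴬ Σbox d xs f₁ +ᴬ Σbox d xs f₂ -ᴬ Σbox d xs f₃ +ᴬ Σbox d xs f₄
    ≈ᴬ Σbox d xs (λ v → f₀ v -ᴬ f₁ v +ᴬ f₂ v -ᴬ f₃ v +ᴬ f₄ v)
  Σbox-alternating xs d f₀ f₁ f₂ f₃ f₄ = 𝔸.sym (add (sub (add (sub 𝔸.refl))))
    where
    add : ∀ {f g s} → Σbox d xs f ≈ᴬ s → Σbox d xs (λ v → f v +ᴬ g v) ≈ᴬ s +ᴬ Σbox d xs g
    add {f} {g} e = 𝔸.trans (Σbox-+ xs d f g) (𝔸.+-congʳ e)
    sub : ∀ {f g s} → Σbox d xs f ≈ᴬ s → Σbox d xs (λ v → f v -ᴬ g v) ≈ᴬ s -ᴬ Σbox d xs g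
    sub {f} {g} e = 𝔸.trans (Σbox-+ xs d f (λ v → -ᴬ g v)) (𝔸.+-cong e (Σbox-neg xs d g))

  -- p = 5ε is given as 1 + 2h, which makes every trace odd. The analysis enters through
  -- assumptions: `E10`, `roots` and `unit` describe ω = exp (5β), while `decay` and `null` bound
  -- the Gaussian factors outside the box.
  module _ (h : ℕ) (p≤10 : 1 ℕ.+ 2 ℕ.* h ℕ.≤ 10) (α β : A)
    (E10 : character (ιᴬ (+ 5) *ᴬ β) (+ 10) ≈ᴬ -ᴬ 1ᴬ)
    (roots : character (ιᴬ (+ 5) *ᴬ β) (+ 0) +ᴬ character (ιᴬ (+ 5) *ᴬ β) (+ 4) +ᴬ character (ιᴬ (+ 5) *ᴬ β) (+ 8)
      +ᴬ character (ιᴬ (+ 5) *ᴬ β) (+ 12) +ᴬ character (ιᴬ (+ 5) *ᴬ β) (+ 16) ≈ᴬ 0ᴬ)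
    (unit : ∀ m → character (ιᴬ (+ 5) *ᴬ β) m ⊑ 1#)
    (r : ℕ → ℝ) (decay : ∀ L m → (10 ℕ.* L) ℕ.* (10 ℕ.* L) ℕ.≤ m → character α (+ m) ⊑ r L)
    (null : Null (λ L → ((L ℕ.+ suc L) · 1#) ^ᴿ 5 * (r L * ι (+ 5))))
    where

    open ShiftedLattice (1 ℕ.+ 2 ℕ.* h)

    γ : A
    γ = ιᴬ (+ 5) *ᴬ β

    C : ℤ → A
    C = alternatingSum γ E10

    summand : Vec ℤ 5 → A
    summand v = character α (+ norm v) *ᴬ C (trace v)

    private
      half-trace : Vec ℤ 5 → ℤ
      half-trace v = sumℤ v ℤ.+ + h

      trace-odd : ∀ v → trace v ≡ + 2 ℤ.* half-trace v ℤ.+ + 1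
      trace-odd v = ≡.trans (≡.cong (λ y → + 2 ℤ.* sumℤ v ℤ.+ y) (≡.trans (ℤₚ.pos-+ 1 (2 ℕ.* h)) (≡.cong (λ y → + 1 ℤ.+ y) (ℤₚ.pos-* 2 h))))
          (S.solve 2 (λ s h → S.con (+ 2) S.:* s S.:+ (S.con (+ 1) S.:+ S.con (+ 2) S.:* h) S.:= S.con (+ 2) S.:* (s S.:+ h) S.:+ S.con (+ 1)) ≡.refl (sumℤ v) (+ h))
        where module S = +-*-Solver

      Reflects? : ∀ x a c → Dec (Reflects x a c)
      Reflects? x a c = (+ 5 ℤ.* c ℤ.+ x) ℤₚ.≟ (+ 5 ℤ.* a)

      -- The indicator of the graph of the reflection. It is 0 for every `w` when the reflection of
      -- `v` is not a lattice point.
      kernel : Vec ℤ 5 → Vec ℤ 5 → A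
      kernel v w = ∏ (Vec.zipWith (λ a c → 𝟙 (Reflects? (trace v) a c)) v w)

      reflect : ∀ {v w : Vec ℤ 5} → Pointwise (Reflects (trace v)) v w →
        Pointwise (Reflects (trace w)) w v × summand w ≈ᴬ -ᴬ summand v
      reflect {v} {w} v∼w = from (reflection-trace v∼w)
        where
        from : ∃[ t ] trace v ≡ + 5 ℤ.* t → Pointwise (Reflects (trace w)) w v × summand w ≈ᴬ -ᴬ summand v
        from (t , tr) = Shifted⇒Reflects t tr′ s , 𝔸.trans
            (𝔸.*-cong (𝔸.reflexive (≡.cong (λ k → character α (+ k)) (≡.sym (norm-reflection t s tr))))
              (alternatingSum-odd γ E10 t (half-trace v) tr tr′ (trace-odd v)))
            (solveᴬ 2 (λ x y → x ⊗ ⊝ y ⊜ ⊝ (x ⊗ y)) 𝔸.refl (character α (+ norm v)) (C (trace v)))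
          where
          s = Reflects⇒Shifted t tr v∼w
          tr′ = trace-reflection t s tr

      -- The reflection is an involution, so both indicators agree; where they are 1, the norm is
      -- unchanged and the alternating sum changes sign.
      kernel-antisymmetric : ∀ v w → summand v *ᴬ kernel v w ≈ᴬ -ᴬ (summand w *ᴬ kernel w v)
      kernel-antisymmetric v w = from (pointwise-indicator (Reflects? (trace v)) v w) (pointwise-indicator (Reflects? (trace w)) w v)
        where
        from : (Pointwise (Reflects (trace v)) v w × kernel v w ≈ᴬ 1ᴬ) ⊎ (¬ Pointwise (Reflects (trace v)) v w × kernel v w ≈ᴬ 0ᴬ) →
          (Pointwise (Reflects (trace w)) w v × kernel w v ≈ᴬ 1ᴬ) ⊎ (¬ Pointwise (Reflects (trace w)) w v × kernel w v ≈ᴬ 0ᴬ) →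
          summand v *ᴬ kernel v w ≈ᴬ -ᴬ (summand w *ᴬ kernel w v)
        from (inj₁ (v∼w , k≈1)) (inj₁ (_ , k′≈1)) = 𝔸.trans (𝔸.*-congˡ k≈1)
          (𝔸.trans (solveᴬ 1 (λ x → x ⊗ κ (+ 1) ⊜ ⊝ (⊝ x ⊗ κ (+ 1))) 𝔸.refl (summand v))
            (𝔸.-‿cong (𝔸.*-cong (𝔸.sym (proj₂ (reflect v∼w))) (𝔸.sym k′≈1))))
        from (inj₁ (v∼w , _)) (inj₂ (w≁v , _)) = ⊥-elim (w≁v (proj₁ (reflect v∼w)))
        from (inj₂ (v≁w , _)) (inj₁ (w∼v , _)) = ⊥-elim (v≁w (proj₁ (reflect w∼v)))
        from (inj₂ (_ , k≈0)) (inj₂ (_ , k′≈0)) = 𝔸.trans (𝔸.*-congˡ k≈0)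
          (𝔸.trans (solveᴬ 2 (λ x y → x ⊗ κ (+ 0) ⊜ ⊝ (y ⊗ κ (+ 0))) 𝔸.refl (summand v) (summand w)) (𝔸.-‿cong (𝔸.*-congˡ (𝔸.sym k′≈0))))

      module _ (L : ℕ) where
        I : List ℤ
        I = interval L

        -- The number, 0 or 1, of reflections of `v` inside the box. It factors over coordinates
        -- because, once the trace is fixed, the reflection acts on each coordinate separately.
        multiplicity : Vec ℤ 5 → A
        multiplicity v = ∏ (Vec.map (λ a → Σ∈ I (λ c → 𝟙 (Reflects? (trace v) a c))) v)

        -- The terms of the box whose reflections are in the box cancel in pairs.
        reflected-sum : Σbox 5 I (λ v → summand v *ᴬ multiplicity v) ≈ᴬ 0ᴬ
        reflected-sum = 𝔸.trans (𝔸.sym expand) (double-cancel antisymmetric)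
          where
          D = Σbox 5 I (λ v → Σbox 5 I (λ w → summand v *ᴬ kernel v w))
          expand : D ≈ᴬ Σbox 5 I (λ v → summand v *ᴬ multiplicity v)
          expand = Σbox-cong I 5 λ v → 𝔸.trans (Σbox-*ˡ I 5 (summand v) (kernel v))
            (𝔸.*-congˡ (Σbox-∏ I (λ a c → 𝟙 (Reflects? (trace v) a c)) v))
          antisymmetric : D ≈ᴬ -ᴬ D
          antisymmetric = 𝔸.trans (Σbox-swap I 5 5 (λ v w → summand v *ᴬ kernel v w))
            (𝔸.trans (Σbox-cong I 5 λ w → 𝔸.trans (Σbox-cong I 5 λ v → kernel-antisymmetric v w) (Σbox-neg I 5 (λ v → summand w *ᴬ kernel w v)))
              (Σbox-neg I 5 (λ w → Σbox 5 I (λ v → summand w *ᴬ kernel w v))))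

        -- If the reflection is in the box, the difference is 0. If 5 does not divide the trace, the
        -- summand is 0. Otherwise the reflection is a lattice point outside the box, so the norm is
        -- at least (10 L)² and `decay` applies; the 5 bounds a sum of five numbers of modulus at
        -- most 1.
        remainder-⊑ : ∀ v → summand v -ᴬ summand v *ᴬ multiplicity v ⊑ r L * ι (+ 5)
        remainder-⊑ v = from (∏-zero-one dichotomy v) (alternatingSum-zero γ E10 roots (half-trace v))
          where
          Outside : ℤ → Set
          Outside a = All (λ c → ¬ Reflects (trace v) a c) I
          dichotomy : ∀ a → Σ∈ I (λ c → 𝟙 (Reflects? (trace v) a c)) ≈ᴬ 1ᴬ ⊎ (Outside a × Σ∈ I (λ c → 𝟙 (Reflects? (trace v) a c)) ≈ᴬ 0ᴬ)
          dichotomy a with count-solutions (Reflects? (trace v) a) (Reflects-unique {trace v} {a}) (interval-unique L)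
          ... | inj₁ (_ , Σ≈1)    = inj₁ Σ≈1
          ... | inj₂ (none , Σ≈0) = inj₂ (none , Σ≈0)
          0≤bound : 0# ≤ r L * ι (+ 5)
          0≤bound = *-nonneg (⊑-nonneg (decay L _ ℕₚ.≤-refl)) (⊑-nonneg (alternatingSum-⊑ γ E10 unit (+ 0)))
          from : multiplicity v ≈ᴬ 1ᴬ ⊎ (VecAny.Any Outside v × multiplicity v ≈ᴬ 0ᴬ) →
            (∃[ t ] + 2 ℤ.* half-trace v ℤ.+ + 1 ≡ + 5 ℤ.* t) ⊎ C (+ 2 ℤ.* half-trace v ℤ.+ + 1) ≈ᴬ 0ᴬ →
            summand v -ᴬ summand v *ᴬ multiplicity v ⊑ r L * ι (+ 5)
          from (inj₁ μ≈1) _ = ⊑-resp-≈ (𝔸.sym (𝔸.trans (𝔸.+-congˡ (𝔸.-‿cong (𝔸.*-congˡ μ≈1)))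
            (solveᴬ 1 (λ x → x ⊖ x ⊗ κ (+ 1) ⊜ κ (+ 0)) 𝔸.refl (summand v)))) (⊑-zero 0≤bound)
          from (inj₂ _) (inj₂ C≈0) = ⊑-resp-≈ (𝔸.sym (𝔸.trans (𝔸.+-cong s≈0 (𝔸.-‿cong (𝔸.*-congʳ s≈0)))
            (solveᴬ 1 (λ x → κ (+ 0) ⊖ κ (+ 0) ⊗ x ⊜ κ (+ 0)) 𝔸.refl (multiplicity v)))) (⊑-zero 0≤bound)
            where
            s≈0 : summand v ≈ᴬ 0ᴬ
            s≈0 = 𝔸.trans (𝔸.*-congˡ (𝔸.trans (𝔸.reflexive (≡.cong C (trace-odd v))) C≈0)) (𝔸.zeroʳ _)
          from (inj₂ (any , μ≈0)) (inj₁ (t , tr)) = ⊑-resp-≈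
            (𝔸.sym (𝔸.trans (𝔸.+-congˡ (𝔸.-‿cong (𝔸.*-congˡ μ≈0))) (solveᴬ 1 (λ x → x ⊖ x ⊗ κ (+ 0) ⊜ x) 𝔸.refl (summand v))))
            (⊑-* (decay L (norm v) (norm-outside-box p≤10 t v (≡.trans (trace-odd v) tr) any)) (alternatingSum-⊑ γ E10 unit (trace v)))

        box-sum-⊑ : Σbox 5 I summand ⊑ ((L ℕ.+ suc L) · 1#) ^ᴿ 5 * (r L * ι (+ 5))
        box-sum-⊑ = ⊑-resp-≈ remainder (≡.subst (λ n → Σbox 5 I rest ⊑ (n · 1#) ^ᴿ 5 * (r L * ι (+ 5))) (length-interval L) (Σbox-⊑ I 5 remainder-⊑))
          where
          rest : Vec ℤ 5 → A
          rest v = summand v -ᴬ summand v *ᴬ multiplicity v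
          remainder : Σbox 5 I rest ≈ᴬ Σbox 5 I summand
          remainder = 𝔸.trans (Σbox-+ I 5 summand (λ v → -ᴬ (summand v *ᴬ multiplicity v)))
            (𝔸.trans (𝔸.+-congˡ (𝔸.trans (Σbox-neg I 5 (λ v → summand v *ᴬ multiplicity v)) (𝔸.-‿cong reflected-sum)))
              (solveᴬ 1 (λ x → x ⊖ κ (+ 0) ⊜ x) 𝔸.refl (Σbox 5 I summand)))

    IsThetaTerm : ℤ → (ℤ → A) → Set ℓ
    IsThetaTerm k e = ∀ n → e n ≈ᴬ exp (ιᴬ (+ sq n) *ᴬ α +ᴬ ιᴬ (k ℤ.* point n) *ᴬ β)

    private
      ∏-terms : ∀ k {e} → IsThetaTerm k e → ∀ {d} (v : Vec ℤ d) →
        ∏ (Vec.map e v) ≈ᴬ exp (ιᴬ (+ norm v) *ᴬ α +ᴬ ιᴬ (k ℤ.* sumℤ (Vec.map point v)) *ᴬ β)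
      ∏-terms k isTerm [] = 𝔸.sym (𝔸.trans (exp-cong (𝔸.trans (𝔸.+-congˡ (𝔸.*-congʳ (𝔸.reflexive (≡.cong ιᴬ (ℤₚ.*-zeroʳ k)))))
        (solveᴬ 2 (λ a b → κ (+ 0) ⊗ a ⊕ κ (+ 0) ⊗ b ⊜ κ (+ 0)) 𝔸.refl α β))) exp-0)
      ∏-terms k {e} isTerm (n ∷ v) = 𝔸.trans (𝔸.*-cong (isTerm n) (∏-terms k isTerm v)) (𝔸.trans (𝔸.sym (exp-+ _ _)) (exp-cong
        (𝔸.trans (solveᴬ 6 (λ s s′ t t′ a b → (s ⊗ a ⊕ t ⊗ b) ⊕ (s′ ⊗ a ⊕ t′ ⊗ b) ⊜ (s ⊕ s′) ⊗ a ⊕ (t ⊕ t′) ⊗ b) 𝔸.refl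
            (ιᴬ (+ sq n)) (ιᴬ (+ norm v)) (ιᴬ (k ℤ.* point n)) (ιᴬ (k ℤ.* sumℤ (Vec.map point v))) α β)
          (𝔸.+-cong (𝔸.*-congʳ (𝔸.sym (ιᴬ-+ (+ sq n) (+ norm v))))
            (𝔸.*-congʳ (𝔸.trans (𝔸.sym (ιᴬ-+ (k ℤ.* point n) _)) (𝔸.reflexive (≡.cong ιᴬ (≡.sym (ℤₚ.*-distribˡ-+ k (point n) _))))))))))

      -- The sum of five points is 5 times the trace. Moving this 5 from the exponent to β turns the
      -- linear factor into a power of ω = exp γ.
      ∏-terms₅ : ∀ k {e} → IsThetaTerm k e → ∀ (v : Vec ℤ 5) →
        ∏ (Vec.map e v) ≈ᴬ character α (+ norm v) *ᴬ character γ (k ℤ.* trace v)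
      ∏-terms₅ k {e} isTerm v = 𝔸.trans (∏-terms k isTerm v) (𝔸.trans (exp-+ _ _) (𝔸.*-congˡ (exp-cong
        (𝔸.trans (𝔸.*-congʳ (𝔸.trans (𝔸.reflexive (≡.cong ιᴬ (≡.trans (≡.cong (k ℤ.*_) (sum-points v))
            (S.solve 2 (λ k x → k S.:* (S.con (+ 5) S.:* x) S.:= (k S.:* x) S.:* S.con (+ 5)) ≡.refl k (trace v)))))
            (ιᴬ-* (k ℤ.* trace v) (+ 5))))
          (𝔸.*-assoc _ _ _)))))
        where module S = +-*-Solver

    -- At each stage L the same combination of fifth powers of partial sums is exactly the box sum
    -- of `summand`, and this tends to 0.
    alternating-fifth-powers : ∀ {e₀ e₁ e₂ e₃ e₄ θ₀ θ₁ θ₂ θ₃ θ₄} →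
      IsThetaTerm (+ 1) e₀ → IsThetaTerm (+ 3) e₁ → IsThetaTerm (+ 5) e₂ → IsThetaTerm (+ 7) e₃ → IsThetaTerm (+ 9) e₄ →
      (let S = λ (e : ℤ → A) L → Σ< L (λ k → e -[1+ k ]) +ᴬ Σ< (suc L) (λ k → e (+ k))) →
      Lim (S e₀) θ₀ → Lim (S e₁) θ₁ → Lim (S e₂) θ₂ → Lim (S e₃) θ₃ → Lim (S e₄) θ₄ →
      θ₀ ^ 5 -ᴬ θ₁ ^ 5 +ᴬ θ₂ ^ 5 -ᴬ θ₃ ^ 5 +ᴬ θ₄ ^ 5 ≈ᴬ 0ᴬ
    alternating-fifth-powers {e₀} {e₁} {e₂} {e₃} {e₄} t₀ t₁ t₂ t₃ t₄ l₀ l₁ l₂ l₃ l₄ = Lim-zero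
        (Lim-+ (Lim-+ (Lim-+ (Lim-+ (Lim-^ 5 l₀) (Lim-neg (Lim-^ 5 l₁))) (Lim-^ 5 l₂)) (Lim-neg (Lim-^ 5 l₃))) (Lim-^ 5 l₄))
        null (λ L → ⊑-resp-≈ (𝔸.sym (box L)) (box-sum-⊑ L))
      where
      open SemiringExp 𝔸.semiring using (^-congˡ)
      S : (ℤ → A) → ℕ → A
      S e L = Σ< L (λ k → e -[1+ k ]) +ᴬ Σ< (suc L) (λ k → e (+ k))
      power : ∀ L e → S e L ^ 5 ≈ᴬ Σbox 5 (interval L) (λ v → ∏ (Vec.map e v))
      power L e = 𝔸.trans (^-congˡ 5 (𝔸.sym (𝔸.trans (Σ∈-++ (applyUpTo -[1+_] L) (applyUpTo +_ (suc L)) e)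
          (𝔸.+-cong (Σ∈-applyUpTo -[1+_] L e) (Σ∈-applyUpTo +_ (suc L) e)))))
        (𝔸.sym (Σbox-power (interval L) 5 e))
      box : ∀ L → S e₀ L ^ 5 -ᴬ S e₁ L ^ 5 +ᴬ S e₂ L ^ 5 -ᴬ S e₃ L ^ 5 +ᴬ S e₄ L ^ 5 ≈ᴬ Σbox 5 (interval L) summand
      box L = 𝔸.trans (𝔸.+-cong (𝔸.+-cong (𝔸.+-cong (𝔸.+-cong (power L e₀) (𝔸.-‿cong (power L e₁))) (power L e₂)) (𝔸.-‿cong (power L e₃))) (power L e₄))
        (𝔸.trans (Σbox-alternating (interval L) 5 (∏ ∘ Vec.map e₀) (∏ ∘ Vec.map e₁) (∏ ∘ Vec.map e₂) (∏ ∘ Vec.map e₃) (∏ ∘ Vec.map e₄)) (Σbox-cong (interval L) 5 λ v → 𝔸.trans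
          (𝔸.+-cong (𝔸.+-cong (𝔸.+-cong (𝔸.+-cong (∏-terms₅ (+ 1) t₀ v) (𝔸.-‿cong (∏-terms₅ (+ 3) t₁ v))) (∏-terms₅ (+ 5) t₂ v)) (𝔸.-‿cong (∏-terms₅ (+ 7) t₃ v))) (∏-terms₅ (+ 9) t₄ v))
          (solveᴬ 6 (λ q a b c d e → q ⊗ a ⊖ q ⊗ b ⊕ q ⊗ c ⊖ q ⊗ d ⊕ q ⊗ e ⊜ q ⊗ (a ⊖ b ⊕ c ⊖ d ⊕ e)) 𝔸.refl
            (character α (+ norm v)) (character γ (+ 1 ℤ.* trace v)) (character γ (+ 3 ℤ.* trace v)) (character γ (+ 5 ℤ.* trace v))
            (character γ (+ 7 ℤ.* trace v)) (character γ (+ 9 ℤ.* trace v)))))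

-- The decay of the remainder against the number of points in the box.

module GaussianDecay {c ℓ₁ ℓ₂ ℓ₃} (R : RealNumbers c ℓ₁ ℓ₂ ℓ₃) where
  open OrderedField R
  open NullSequences R
  open RawSemiringDefs (RawRing.rawSemiring rawRing) using () renaming (_^_ to _^ᴿ_)

  ·≈ι : ∀ n → n · 1# ≈ ι (+ n)
  ·≈ι n = ×ᵤ≈× n 1#
    where open SemiringMultTC (CommutativeRing.semiring commutativeRing) using (×ᵤ≈×)

  fromℤ≈ι : ∀ n → fromℤ n ≈ ι n
  fromℤ≈ι (+ n)    = ·≈ι n
  fromℤ≈ι -[1+ n ] = -‿cong (·≈ι (suc n))

  ι-nonneg : ∀ n → 0# ≤ ι (+ n)
  ι-nonneg n = ≤-respʳ (·≈ι n) (·-nonneg n)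

  module _ {κ : ℝ} (0<κ : 0# < κ) where

    private
      0<1+κL² : ∀ L → 0# < 1# + κ * (L · 1# * (L · 1#))
      0<1+κL² L = <-≤-trans 0<1 (≤-by _ (*-nonneg (<⇒≤ 0<κ) (square-nonneg _)) refl)

    opaque
      decay-factor : ∀ L → ∃[ r ] 0# < r × (1# + κ * (L · 1# * (L · 1#))) * r ≈ 1#
      decay-factor L = positive-inverse (0<1+κL² L)

    private
      module _ {κ⁻¹ l n r u : ℝ} (κκ⁻¹ : κ * κ⁻¹ ≈ 1#) (n≈ : n ≈ l + (1# + l)) (0≤l : 0# ≤ l) (0<r : 0# < r)
        (er : (1# + κ * (l * l)) * r ≈ 1#) (eu : (1# + l) * u ≈ 1#) where

        -- A bound for n² r with n = 2l + 1 and r = 1 / (1 + κ l²): it comes from 2 + 8 l² = (2l +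
        -- 1)² + (2l - 1)², with 8 l² written as 8 κ⁻¹ (κ l²).
        G : ℝ
        G = ι (+ 2) + ι (+ 8) * κ⁻¹

        0≤κ⁻¹ : 0# ≤ κ⁻¹
        0≤κ⁻¹ = <⇒≤ (inverse-positive 0<κ κκ⁻¹)
        0≤G : 0# ≤ G
        0≤G = +-nonneg (ι-nonneg 2) (*-nonneg (ι-nonneg 8) 0≤κ⁻¹)
        0<1+l : 0# < 1# + l
        0<1+l = <-≤-trans 0<1 (≤-by l 0≤l refl)
        0≤u : 0# ≤ u
        0≤u = <⇒≤ (inverse-positive 0<1+l eu)
        0≤n : 0# ≤ n
        0≤n = ≤-respʳ (sym n≈) (+-nonneg 0≤l (<⇒≤ 0<1+l))

        n²r≤G : n * n * r ≤ G
        n²r≤G = ≤-respʳ (trans (*-assoc _ _ _) (trans (*-congˡ er) (*-identityʳ G))) (*-monoʳ-≤ (<⇒≤ 0<r)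
          (≤-by ((ι (+ 2) * l - 1#) * (ι (+ 2) * l - 1#) + (ι (+ 8) * κ⁻¹ + ι (+ 2) * (κ * (l * l))))
            (+-nonneg (square-nonneg _) (+-nonneg (*-nonneg (ι-nonneg 8) 0≤κ⁻¹) (*-nonneg (ι-nonneg 2) (*-nonneg (<⇒≤ 0<κ) (square-nonneg l)))))
            (trans (solve 3 (λ k i l → (con (+ 2) :+ con (+ 8) :* i) :* (con (+ 1) :+ k :* (l :* l))
                := con (+ 2) :+ con (+ 8) :* i :+ con (+ 2) :* (k :* (l :* l)) :+ con (+ 8) :* (l :* l) :* (k :* i)) refl κ κ⁻¹ l)
              (trans (+-congˡ (trans (*-congˡ κκ⁻¹) (*-identityʳ _)))
                (trans (solve 3 (λ k i l → con (+ 2) :+ con (+ 8) :* i :+ con (+ 2) :* (k :* (l :* l)) :+ con (+ 8) :* (l :* l)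
                  := (l :+ (con (+ 1) :+ l)) :* (l :+ (con (+ 1) :+ l)) :+ ((con (+ 2) :* l :- con (+ 1)) :* (con (+ 2) :* l :- con (+ 1)) :+ (con (+ 8) :* i :+ con (+ 2) :* (k :* (l :* l))))) refl κ κ⁻¹ l)
                  (+-congʳ (sym (*-cong n≈ n≈))))))))

        1≤nu : 1# ≤ n * u
        1≤nu = ≤-respˡ eu (*-monoʳ-≤ 0≤u (≤-respʳ (sym n≈) (≤-by l 0≤l (+-comm _ _))))

        -- A sixth factor n is supplied at the price of u = 1 / (1 + l), using 1 ≤ n u. Then n⁶ r³ =
        -- (n² r)³ ≤ G³, and u tends to 0.
        n⁵r³-bound : n ^ᴿ 5 * (r * r * r * ι (+ 5)) ≤ ι (+ 5) * (G * G * G) * u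
        n⁵r³-bound = ≤-trans (≤-respˡ (*-identityʳ _) (*-monoˡ-≤ 0≤X 1≤nu))
          (≤-respˡ (solve 4 (λ n r u f → f :* ((n :* n :* r) :* (n :* n :* r) :* (n :* n :* r)) :* u
              := n :* (n :* (n :* (n :* (n :* con (+ 1))))) :* (r :* r :* r :* f) :* (n :* u)) refl n r u (ι (+ 5)))
            (*-monoʳ-≤ 0≤u (*-monoˡ-≤ (ι-nonneg 5) (*-mono-≤ (*-nonneg 0≤n²r 0≤n²r) 0≤G (*-mono-≤ 0≤n²r 0≤G n²r≤G n²r≤G) n²r≤G))))
          where
          0≤n²r : 0# ≤ n * n * r
          0≤n²r = *-nonneg (square-nonneg n) (<⇒≤ 0<r)
          0≤X : 0# ≤ n ^ᴿ 5 * (r * r * r * ι (+ 5))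
          0≤X = *-nonneg (*-nonneg 0≤n (*-nonneg 0≤n (*-nonneg 0≤n (*-nonneg 0≤n (*-nonneg 0≤n (<⇒≤ 0<1))))))
            (*-nonneg (*-nonneg (*-nonneg (<⇒≤ 0<r) (<⇒≤ 0<r)) (<⇒≤ 0<r)) (ι-nonneg 5))

    decay-bound : ℕ → ℝ
    decay-bound L = proj₁ (decay-factor L) * proj₁ (decay-factor L) * proj₁ (decay-factor L)

    box-remainder-null : Null (λ L → ((L ℕ.+ suc L) · 1#) ^ᴿ 5 * (decay-bound L * ι (+ 5)))
    box-remainder-null = from (positive-inverse 0<κ)
      where
      from : ∃[ y ] 0# < y × κ * y ≈ 1# → Null (λ L → ((L ℕ.+ suc L) · 1#) ^ᴿ 5 * (decay-bound L * ι (+ 5)))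
      from (κ⁻¹ , 0<κ⁻¹ , κκ⁻¹) = Null-≤
        (λ L → n⁵r³-bound κκ⁻¹ (·-homo-+ L (suc L)) (·-nonneg L) (proj₁ (proj₂ (decay-factor L))) (proj₂ (proj₂ (decay-factor L))) (*-recip (suc L)))
        (Null-scale (*-nonneg (ι-nonneg 5) (*-nonneg (*-nonneg 0≤G′ 0≤G′) 0≤G′)) Null-recip)
        where
        0≤G′ : 0# ≤ ι (+ 2) + ι (+ 8) * κ⁻¹
        0≤G′ = +-nonneg (ι-nonneg 2) (*-nonneg (ι-nonneg 8) (<⇒≤ 0<κ⁻¹))

-- Algebraic identities for the exponents of theta terms.

module _ {c ℓ₁ ℓ₂ ℓ₃} (R : RealNumbers c ℓ₁ ℓ₂ ℓ₃) {a ℓ} (𝒜 : RealAlgebra R a ℓ) where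
  open OrderedField R using (-_; -‿inverseˡ; ι; ι-+; ι-neg; refl)
  open RealAlgebra 𝒜
  open IntegerCoefficients algebra using () renaming (ι to ιᴬ; ι-+ to ιᴬ-+)

  ofℝ-ι : ∀ m → ofℝ (ι m) ≈ᴬ ιᴬ m
  ofℝ-ι (+ n)    = natural n
    where
    natural : ∀ n → ofℝ (ι (+ n)) ≈ᴬ ιᴬ (+ n)
    natural zero    = ofℝ-0
    natural (suc n) = 𝔸.trans (ofℝ-cong (ι-+ (+ 1) (+ n))) (𝔸.trans (ofℝ-+ _ _)
      (𝔸.trans (𝔸.+-cong ofℝ-1 (natural n)) (𝔸.sym (ιᴬ-+ (+ 1) (+ n)))))
  ofℝ-ι -[1+ n ] = inverseˡ-unique _ _ (𝔸.trans (𝔸.+-congˡ (𝔸.sym (ofℝ-ι (+ suc n))))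
    (𝔸.trans (𝔸.sym (ofℝ-+ _ _)) (𝔸.trans (ofℝ-cong (-‿inverseˡ _)) ofℝ-0)))
    where open AbelianGroupProperties 𝔸.+-abelianGroup using (inverseˡ-unique)

module ExponentAlgebra {c ℓ₁ ℓ₂ ℓ₃} (R : RealNumbers c ℓ₁ ℓ₂ ℓ₃) {a ℓ} (𝒜 : RealAlgebra R a ℓ) where
  open OrderedField R using (ℝ; _≈_; _+_; _*_; 1#; ι)
  open RealAlgebra 𝒜
  open IntegerCoefficients algebra using ()
    renaming (solve to solveᴬ; _:=_ to _⊜_; _:+_ to _⊕_; _:*_ to _⊗_; _:-_ to _⊖_; con to κ; ι to ιᴬ; ι-* to ιᴬ-*)

  -- Clears denominators at ζ = 0: in units of s = 1/10, the lattice coordinate is the integer `m`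
  -- and ε′ / 2 is the integer `n`, so the exponent is an integral combination of two constants.
  theta-exponent : ∀ {P i H τ a e : A} {s x y : ℝ} {m n q} → x ≈ ι m * s → a ≈ᴬ ofℝ x → y ≈ ι n * s → e ≈ᴬ ofℝ y → q ≡ m ℤ.* m →
    P *ᴬ i *ᴬ (H *ᴬ (a *ᴬ (a *ᴬ 1ᴬ)) *ᴬ τ +ᴬ a *ᴬ (0ᴬ +ᴬ e))
    ≈ᴬ ιᴬ q *ᴬ (P *ᴬ i *ᴬ (H *ᴬ (ofℝ s *ᴬ ofℝ s) *ᴬ τ)) +ᴬ ιᴬ (n ℤ.* m) *ᴬ (P *ᴬ i *ᴬ (ofℝ s *ᴬ ofℝ s))
  theta-exponent {P} {i} {H} {τ} {a} {e} {s} {x} {y} {m} {n} x≈ a≈ y≈ e≈ ≡.refl = 𝔸.trans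
    (𝔸.*-congˡ (𝔸.+-cong (𝔸.*-congʳ (𝔸.*-congˡ (𝔸.*-cong a≈ms (𝔸.*-congʳ a≈ms)))) (𝔸.*-cong a≈ms (𝔸.+-congˡ e≈ns))))
    (𝔸.trans (solveᴬ 7 (λ P i H τ s m n → P ⊗ i ⊗ (H ⊗ ((m ⊗ s) ⊗ ((m ⊗ s) ⊗ κ (+ 1))) ⊗ τ ⊕ (m ⊗ s) ⊗ (κ (+ 0) ⊕ n ⊗ s))
        ⊜ (m ⊗ m) ⊗ (P ⊗ i ⊗ (H ⊗ (s ⊗ s) ⊗ τ)) ⊕ (n ⊗ m) ⊗ (P ⊗ i ⊗ (s ⊗ s))) 𝔸.refl P i H τ (ofℝ s) (ιᴬ m) (ιᴬ n))
      (𝔸.+-cong (𝔸.*-congʳ (𝔸.sym (ιᴬ-* m m))) (𝔸.*-congʳ (𝔸.sym (ιᴬ-* n m)))))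
    where
    scaled : ∀ {x z} k → x ≈ ι k * s → z ≈ᴬ ofℝ x → z ≈ᴬ ιᴬ k *ᴬ ofℝ s
    scaled k x≈ z≈ = 𝔸.trans z≈ (𝔸.trans (ofℝ-cong x≈) (𝔸.trans (ofℝ-* _ _) (𝔸.*-congʳ (ofℝ-ι R 𝒜 k))))
    a≈ms : a ≈ᴬ ιᴬ m *ᴬ ofℝ s
    a≈ms = scaled m x≈ a≈
    e≈ns : e ≈ᴬ ιᴬ n *ᴬ ofℝ s
    e≈ns = scaled n y≈ e≈

  rotation : ∀ (i : A) m P s → ιᴬ m *ᴬ (ιᴬ (+ 5) *ᴬ (ofℝ P *ᴬ i *ᴬ (ofℝ s *ᴬ ofℝ s))) ≈ᴬ i *ᴬ ofℝ (ι m * (ι (+ 5) * (P * (s * s))))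
  rotation i m P s = 𝔸.trans
    (solveᴬ 5 (λ m f P i s → m ⊗ (f ⊗ (P ⊗ i ⊗ (s ⊗ s))) ⊜ i ⊗ (m ⊗ (f ⊗ (P ⊗ (s ⊗ s))))) 𝔸.refl (ιᴬ m) (ιᴬ (+ 5)) (ofℝ P) i (ofℝ s))
    (𝔸.*-congˡ (𝔸.sym (𝔸.trans (ofℝ-* _ _) (𝔸.*-cong (ofℝ-ι R 𝒜 m) (𝔸.trans (ofℝ-* _ _) (𝔸.*-cong (ofℝ-ι R 𝒜 (+ 5))
      (𝔸.trans (ofℝ-* _ _) (𝔸.*-congˡ (ofℝ-* s s)))))))))

  thirds : ∀ {t} (α : A) m → t + t + t ≈ 1# →
    (let w = ofℝ (ι m * t) *ᴬ α) → ιᴬ m *ᴬ α ≈ᴬ w +ᴬ w +ᴬ w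
  thirds {t} α m 3t≈1 = 𝔸.sym (𝔸.trans
    (𝔸.+-cong (𝔸.+-cong split split) split)
    (𝔸.trans (solveᴬ 3 (λ m t α → m ⊗ t ⊗ α ⊕ m ⊗ t ⊗ α ⊕ m ⊗ t ⊗ α ⊜ (t ⊕ t ⊕ t) ⊗ (m ⊗ α)) 𝔸.refl (ιᴬ m) (ofℝ t) α)
      (𝔸.trans (𝔸.*-congʳ (𝔸.trans (𝔸.sym (𝔸.trans (ofℝ-+ _ _) (𝔸.+-congʳ (ofℝ-+ t t)))) (𝔸.trans (ofℝ-cong 3t≈1) ofℝ-1)))
        (𝔸.*-identityˡ _))))
    where
    split : ofℝ (ι m * t) *ᴬ α ≈ᴬ ιᴬ m *ᴬ ofℝ t *ᴬ α
    split = 𝔸.*-congʳ (𝔸.trans (ofℝ-* _ _) (𝔸.*-congʳ (ofℝ-ι R 𝒜 m)))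

  -- (b - 1)(1 + b + b² + b³ + b⁴) = b⁵ - 1 for b = ω⁴, where b⁵ = ω²⁰ = 1.
  telescoping-roots : ∀ {e₀ e₄ e₈ e₁₂ e₁₆ e₂₀} → e₀ ≈ᴬ 1ᴬ → e₂₀ ≈ᴬ 1ᴬ →
    e₄ *ᴬ e₄ ≈ᴬ e₈ → e₄ *ᴬ e₈ ≈ᴬ e₁₂ → e₄ *ᴬ e₁₂ ≈ᴬ e₁₆ → e₄ *ᴬ e₁₆ ≈ᴬ e₂₀ →
    (e₄ -ᴬ 1ᴬ) *ᴬ (e₀ +ᴬ e₄ +ᴬ e₈ +ᴬ e₁₂ +ᴬ e₁₆) ≈ᴬ 0ᴬ
  telescoping-roots {e₀} {e₄} {e₈} {e₁₂} {e₁₆} {e₂₀} p₀ p₂₀ p₈ p₁₂ p₁₆ q₂₀ = 𝔸.trans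
    (solveᴬ 5 (λ a b c d e → (b ⊖ κ (+ 1)) ⊗ (a ⊕ b ⊕ c ⊕ d ⊕ e) ⊜ b ⊗ a ⊕ b ⊗ b ⊕ b ⊗ c ⊕ b ⊗ d ⊕ b ⊗ e ⊖ (a ⊕ b ⊕ c ⊕ d ⊕ e)) 𝔸.refl e₀ e₄ e₈ e₁₂ e₁₆)
    (𝔸.trans (𝔸.+-cong (𝔸.+-cong (𝔸.+-cong (𝔸.+-cong (𝔸.+-cong (𝔸.*-congˡ p₀) p₈) p₁₂) p₁₆) (𝔸.trans q₂₀ p₂₀))
        (𝔸.-‿cong (𝔸.+-congʳ (𝔸.+-congʳ (𝔸.+-congʳ (𝔸.+-congʳ p₀))))))
      (solveᴬ 4 (λ b c d e → b ⊗ κ (+ 1) ⊕ c ⊕ d ⊕ e ⊕ κ (+ 1) ⊖ (κ (+ 1) ⊕ b ⊕ c ⊕ d ⊕ e) ⊜ κ (+ 0)) 𝔸.refl e₄ e₈ e₁₂ e₁₆))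

-- The constants of the theta constants satisfy the assumptions of the cancellation.

module ThetaConstants {c ℓ₁ ℓ₂ ℓ₃} (R : RealNumbers c ℓ₁ ℓ₂ ℓ₃) where
  open ComplexNumbers R
  open ComplexNormedAlgebra R
  open ComplexExponential R
  open Exponential R ℂ-normedAlgebra using (exp; exp-cong; exp-+)
  open Characters R ℂ-normedAlgebra
  open ExponentAlgebra R ℂ-realAlgebra
  open GaussianDecay R

  -- `P`, `H` and `s` stand for 2π, 1/2 and 1/10. Then g = π / 10, γ = πi / 10 and, with the half, α
  -- = πiτ / 100.
  module _ {π P H s : ℝ} (isPi : IsPi π) (P≈2π : P ≈ ι (+ 2) * π) (0<H : 0# < H) (0<s : 0# < s) (10s≈1 : ι (+ 10) * s ≈ 1#) where

    private
      g : ℝ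
      g = ι (+ 5) * (P * (s * s))

      10g≈π : ι (+ 10) * g ≈ π
      10g≈π = trans (*-congˡ (*-congˡ (*-congʳ P≈2π))) (trans
        (solve 2 (λ π s → con (+ 10) :* (con (+ 5) :* (con (+ 2) :* π :* (s :* s))) := (con (+ 10) :* s) :* (con (+ 10) :* s) :* π) refl π s)
        (trans (*-congʳ (trans (*-cong 10s≈1 10s≈1) (*-identityˡ 1#))) (*-identityˡ π)))

      0<2 : 0# < ι (+ 2)
      0<2 = <-trans 0<1 (<-by 1# 0<1 refl)

      0<P : 0# < P
      0<P = <-respʳ-≈ (sym P≈2π) (*-positive 0<2 (proj₁ isPi))

      0<ι : ∀ n → 0# < ι (+ suc n)
      0<ι n = <-respʳ-≈ (·≈ι (suc n)) (suc-positive n)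

      0<g : 0# < g
      0<g = *-positive (0<ι 4) (*-positive 0<P (*-positive 0<s 0<s))

    β : ℂ
    β = ↑ P *ℂ 𝕚 *ℂ (↑ s *ℂ ↑ s)

    γ : ℂ
    γ = ιℂ (+ 5) *ℂ β

    private
      E : ℤ → ℂ
      E = character γ

      E≈ : ∀ m → E m ≈ℂ exp (𝕚 *ℂ ↑ (ι m * g))
      E≈ m = exp-cong {ιℂ m *ℂ γ} {𝕚 *ℂ ↑ (ι m * g)} (rotation 𝕚 m P s)

      E-* : ∀ m n → E m *ℂ E n ≈ℂ E (m ℤ.+ n)
      E-* m n = ℂR.sym {E (m ℤ.+ n)} {E m *ℂ E n} (character-+ γ m n)

    E-unit : ∀ m → E m ⊑ 1#
    E-unit m = ⊑-resp-≈ (ℂR.sym {E m} (E≈ m)) (exp-imaginary-⊑ {𝕚 *ℂ ↑ (ι m * g)}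
      (solve 1 (λ x → con (+ 0) :* x :- con (+ 1) :* con (+ 0) := con (+ 0)) refl (ι m * g)))

    E10 : E (+ 10) ≈ℂ -ℂ 1ℂ
    E10 = ℂR.trans {E (+ 10)} {exp (𝕚 *ℂ ↑ (ι (+ 10) * g))} { -ℂ 1ℂ } (E≈ (+ 10))
      (ℂR.trans {exp (𝕚 *ℂ ↑ (ι (+ 10) * g))} {exp (𝕚 *ℂ ↑ π)} { -ℂ 1ℂ }
        (exp-cong {𝕚 *ℂ ↑ (ι (+ 10) * g)} {𝕚 *ℂ ↑ π} (ℂR.*-congˡ {𝕚} {↑ (ι (+ 10) * g)} {↑ π} (10g≈π , refl)))
        (exp-iπ isPi))

    roots : E (+ 0) +ℂ E (+ 4) +ℂ E (+ 8) +ℂ E (+ 12) +ℂ E (+ 16) ≈ℂ 0ℂ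
    -- ω⁴ has the angle 4g = 4π / 10, which lies strictly between 0 and π; hence ω⁴ - 1 can be
    -- cancelled.
    roots = exp-roots-of-unity isPi {ι (+ 4) * g} {S} (*-positive (0<ι 3) 0<g)
        (<-by (ι (+ 6) * g) (*-positive (0<ι 5) 0<g) (trans (sym 10g≈π)
          (solve 1 (λ g → con (+ 10) :* g := con (+ 4) :* g :+ con (+ 6) :* g) refl g)))
        (ℂR.trans {(exp (𝕚 *ℂ ↑ (ι (+ 4) * g)) -ℂ 1ℂ) *ℂ S} {(E (+ 4) -ℂ 1ℂ) *ℂ S} {0ℂ}
          (ℂR.*-congʳ {S} {exp (𝕚 *ℂ ↑ (ι (+ 4) * g)) -ℂ 1ℂ} {E (+ 4) -ℂ 1ℂ}
            (ℂR.+-congʳ { -ℂ 1ℂ } {exp (𝕚 *ℂ ↑ (ι (+ 4) * g))} {E (+ 4)} (ℂR.sym {E (+ 4)} (E≈ (+ 4)))))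
          (telescoping-roots {E (+ 0)} {E (+ 4)} {E (+ 8)} {E (+ 12)} {E (+ 16)} {E (+ 20)} (character-0 γ) E20
            (E-* (+ 4) (+ 4)) (E-* (+ 4) (+ 8)) (E-* (+ 4) (+ 12)) (E-* (+ 4) (+ 16))))
      where
      S : ℂ
      S = E (+ 0) +ℂ E (+ 4) +ℂ E (+ 8) +ℂ E (+ 12) +ℂ E (+ 16)
      E20 : E (+ 20) ≈ℂ 1ℂ
      E20 = ℂR.trans {E (+ 20)} {E (+ 10) *ℂ E (+ 10)} {1ℂ} (character-+ γ (+ 10) (+ 10))
        (ℂR.trans {E (+ 10) *ℂ E (+ 10)} {(-ℂ 1ℂ) *ℂ (-ℂ 1ℂ)} {1ℂ} (ℂR.*-cong {E (+ 10)} { -ℂ 1ℂ } {E (+ 10)} { -ℂ 1ℂ } E10 E10)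
          (solveℂ 0 (⊝ κ (+ 1) ⊗ ⊝ κ (+ 1) ⊜ κ (+ 1)) ℂR.refl))

    module _ {τ : ℂ} (0<y : 0# < im τ) where

      α : ℂ
      α = ↑ P *ℂ 𝕚 *ℂ (↑ H *ℂ (↑ s *ℂ ↑ s) *ℂ τ)

      private
        t : ℝ
        -- `0<ι 2` is the positivity of 3, so t = 1/3: the share of the exponent that each of the
        -- three factors receives.
        t = proj₁ (positive-inverse (0<ι 2))

        0<t : 0# < t
        0<t = proj₁ (proj₂ (positive-inverse (0<ι 2)))

        3t≈1 : t + t + t ≈ 1#
        3t≈1 = trans (solve 1 (λ t → t :+ t :+ t := con (+ 3) :* t) refl t) (proj₂ (proj₂ (positive-inverse (0<ι 2))))

      0<rate : 0# < t * (P * H * im τ)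
      0<rate = *-positive 0<t (*-positive (*-positive 0<P 0<H) 0<y)

      private
        re-scaled : ∀ x → - re (↑ x *ℂ α) ≈ x * (P * H * (s * s) * im τ)
        re-scaled x = solve 6 (λ x P H s u y →
            :- proj₁ (⟨ x ⟩ ⊠ ((⟨ P ⟩ ⊠ (con (+ 0) , con (+ 1))) ⊠ ((⟨ H ⟩ ⊠ (⟨ s ⟩ ⊠ ⟨ s ⟩)) ⊠ (u , y))))
            := x :* (P :* H :* (s :* s) :* y)) refl x P H s (re τ) (im τ)
          where
          ⟨_⟩ : Polynomial 6 → Polynomial 6 × Polynomial 6
          ⟨ x ⟩ = x , con (+ 0)
          _⊠_ : (z w : Polynomial 6 × Polynomial 6) → Polynomial 6 × Polynomial 6
          (x , y) ⊠ (u , v) = x :* u :- y :* v , x :* v :+ y :* u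

        -- The integer norm carries the scale s² = 1/100, so m ≥ (10 L)² means m s² ≥ L².
        rate≤ : ∀ L m → (10 ℕ.* L) ℕ.* (10 ℕ.* L) ℕ.≤ m →
          t * (P * H * im τ) * (L · 1# * (L · 1#)) ≤ - re (↑ (ι (+ m) * t) *ℂ α)
        rate≤ L m p = ≤-respʳ (trans (solve 6 (λ t P H y m s → t :* (P :* H :* y) :* (m :* (s :* s)) := m :* t :* (P :* H :* (s :* s) :* y)) refl t P H (im τ) (ι (+ m)) s)
              (sym (re-scaled (ι (+ m) * t))))
            (*-monoˡ-≤ (<⇒≤ 0<rate) (≤-respˡ square (*-monoʳ-≤ (square-nonneg s) (≤-respʳ (·≈ι m) (·-mono-≤ p)))))
          where
          square : ((10 ℕ.* L) ℕ.* (10 ℕ.* L)) · 1# * (s * s) ≈ L · 1# * (L · 1#)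
          square = trans (*-congʳ (trans (·-homo-* (10 ℕ.* L) (10 ℕ.* L)) (*-cong 10L≈ 10L≈)))
            (trans (solve 3 (λ f l s → f :* l :* (f :* l) :* (s :* s) := (f :* s) :* (f :* s) :* (l :* l)) refl (ι (+ 10)) (L · 1#) s)
              (trans (*-congʳ (trans (*-cong 10s≈1 10s≈1) (*-identityˡ 1#))) (*-identityˡ _)))
            where
            10L≈ : (10 ℕ.* L) · 1# ≈ ι (+ 10) * (L · 1#)
            10L≈ = trans (·-homo-* 10 L) (*-congʳ (·≈ι 10))

      α-decay : ∀ L m → (10 ℕ.* L) ℕ.* (10 ℕ.* L) ℕ.≤ m → character α (+ m) ⊑ decay-bound 0<rate L
      α-decay L m p = ⊑-resp-≈ (ℂR.sym {character α (+ m)} {exp w *ℂ exp w *ℂ exp w} triple) (⊑-* (⊑-* third third) third)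
        where
        w : ℂ
        w = ↑ (ι (+ m) * t) *ℂ α
        third : exp w ⊑ proj₁ (decay-factor 0<rate L)
        third = exp-decay {w} (*-nonneg (<⇒≤ 0<rate) (square-nonneg (L · 1#))) (rate≤ L m p) (proj₂ (proj₂ (decay-factor 0<rate L)))
        triple : character α (+ m) ≈ℂ exp w *ℂ exp w *ℂ exp w
        triple = ℂR.trans {character α (+ m)} {exp (w +ℂ w +ℂ w)} {exp w *ℂ exp w *ℂ exp w}
          (exp-cong {ιℂ (+ m) *ℂ α} {w +ℂ w +ℂ w} (thirds α (+ m) 3t≈1))
          (ℂR.trans {exp (w +ℂ w +ℂ w)} {exp (w +ℂ w) *ℂ exp w} {exp w *ℂ exp w *ℂ exp w} (exp-+ (w +ℂ w) w)
            (ℂR.*-congʳ {exp w} {exp (w +ℂ w)} {exp w *ℂ exp w} (exp-+ w w)))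

-- Halves of the rational characteristics as integral multiples of 1/10.

module RationalCharacteristics {c ℓ₁ ℓ₂ ℓ₃} (R : RealNumbers c ℓ₁ ℓ₂ ℓ₃) where
  open OrderedField R
  open GaussianDecay R

  private
    module Tenth {r h : ℝ} (5r≈1 : (5 · 1#) * r ≈ 1#) (2h≈1 : (2 · 1#) * h ≈ 1#) where
      five : ι (+ 5) * r ≈ 1#
      five = trans (*-congʳ (sym (·≈ι 5))) 5r≈1

      ten : ι (+ 10) * (r * ((1 · 1#) * h)) ≈ 1#
      ten = trans (*-congˡ (*-congˡ (*-congʳ (·≈ι 1)))) (trans
        (solve 2 (λ r h → con (+ 10) :* (r :* (con (+ 1) :* h)) := (con (+ 5) :* r) :* (con (+ 2) :* h)) refl r h)
        (trans (*-cong five (trans (*-congʳ (sym (·≈ι 2))) 2h≈1)) (*-identityˡ 1#)))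

      shift : ∀ n p → let H = (1 · 1#) * h in fromℤ n + (p · 1#) * r * H ≈ ι (+ 10 ℤ.* n ℤ.+ + p) * (r * H)
      shift n p = sym (trans (*-congʳ (trans (ι-+ (+ 10 ℤ.* n) (+ p)) (+-congʳ (ι-* (+ 10) n))))
        (trans (solve 5 (λ f n p r H → (f :* n :+ p) :* (r :* H) := (f :* (r :* H)) :* n :+ p :* r :* H) refl (ι (+ 10)) (ι n) (ι (+ p)) r ((1 · 1#) * h))
          (+-cong (trans (*-congʳ ten) (trans (*-identityˡ _) (sym (fromℤ≈ι n)))) (*-congʳ (*-congʳ (sym (·≈ι p)))))))

      scale : ∀ k → let H = (1 · 1#) * h in (k · 1#) * r * H ≈ ι (+ k) * (r * H)
      scale k = trans (*-assoc _ _ _) (*-congʳ (·≈ι k))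

      -- The middle characteristic is written 1 // 1 and not 5 // 5, so its numerator 5 has to be
      -- produced separately.
      whole : ∀ {r₁} → (1 · 1#) * r₁ ≈ 1# → let H = (1 · 1#) * h in (1 · 1#) * r₁ * H ≈ ι (+ 5) * (r * H)
      whole e = trans (*-congʳ (trans e (sym five))) (*-assoc _ _ _)

    integer : ∀ {r} n → (1 · 1#) * r ≈ 1# → (n · 1#) * r ≈ ι (+ n)
    integer {r} n e = trans (*-cong (·≈ι n) (trans (sym (*-identityˡ r)) (trans (*-congʳ (sym (·≈ι 1))) e))) (*-identityʳ _)

  opaque
    tenth : ∃[ s ] 0# < s × ι (+ 10) * s ≈ 1#
      × (∀ n p → fromℤ n + (p // 5) * (1 // 2) ≈ ι (+ 10 ℤ.* n ℤ.+ + p) * s)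
      × (∀ k → (k // 5) * (1 // 2) ≈ ι (+ k) * s)
      × (1 // 1) * (1 // 2) ≈ ι (+ 5) * s
    tenth = recip 5 * (1 // 2) , *-positive (recip-positive 5) (*-positive (suc-positive 0) (recip-positive 2)) ,
      T.ten , T.shift , T.scale , T.whole (*-recip 1)
      where module T = Tenth (*-recip 5) (*-recip 2)

    0<1//2 : 0# < 1 // 2
    0<1//2 = *-positive (suc-positive 0) (recip-positive 2)

    2//1≈2 : ∀ π → (2 // 1) * π ≈ ι (+ 2) * π
    2//1≈2 π = *-congʳ (integer 2 (*-recip 1))

-- The identity for ε = (1 + 2h) / 5.

module ThetaIdentity {c ℓ₁ ℓ₂ ℓ₃} (R : RealNumbers c ℓ₁ ℓ₂ ℓ₃) where
  open ComplexNumbers R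
  open ComplexNormedAlgebra R
  open ComplexSeries R
  open ComplexExponential R
  open Exponential R ℂ-normedAlgebra using (exp; exp-cong)
  open ExponentAlgebra R ℂ-realAlgebra
  open GaussianDecay R
  open RationalCharacteristics R
  open AlternatingFifthPowers R ℂ-normedAlgebra
  open Theta R using (ℍ²; point; positive; exponent; IsTheta; ThetaFunction)

  module _ {π : ℝ} (isPi : IsPi π) (Θ : ThetaFunction π) (τ : ℍ²) (h : ℕ) (p≤10 : 1 ℕ.+ 2 ℕ.* h ℕ.≤ 10) where
    open ThetaFunction Θ

    private
      s : ℝ
      s = proj₁ tenth
      0<s : 0# < s
      0<s = proj₁ (proj₂ tenth)
      10s≈1 : ι (+ 10) * s ≈ 1#
      10s≈1 = proj₁ (proj₂ (proj₂ tenth))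
      ε : ℝ
      ε = (1 ℕ.+ 2 ℕ.* h) // 5
      module L = ShiftedLattice (1 ℕ.+ 2 ℕ.* h)
      module T = ThetaConstants R
      α β : ℂ
      α = T.α isPi (2//1≈2 π) 0<1//2 0<s 10s≈1 {point τ} (positive τ)
      β = T.β isPi (2//1≈2 π) 0<1//2 0<s 10s≈1

      e : ℝ → ℤ → ℂ
      e ε′ = proj₁ (isTheta ε ε′ 0ℂ τ)

      θ-limit : ∀ ε′ → Limℂ _ (θ[ ε ⨾ ε′ ] τ)
      θ-limit ε′ = HasSumℤ⇒Lim {e ε′} {θ[ ε ⨾ ε′ ] τ} (proj₂ (proj₂ (isTheta ε ε′ 0ℂ τ)))

      θ-terms : ∀ k ε′ → ε′ * (1 // 2) ≈ ι k * s → ∀ n → e ε′ n ≈ℂ exp (ιℂ (+ L.sq n) *ℂ α +ℂ ιℂ (k ℤ.* L.point n) *ℂ β)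
      θ-terms k ε′ ε′≈ n = ℂR.trans {e ε′ n} {exp (exponent π ε ε′ 0ℂ τ n)} {exp (ιℂ (+ L.sq n) *ℂ α +ℂ ιℂ (k ℤ.* L.point n) *ℂ β)}
        (IsExp⇒≈exp {exponent π ε ε′ 0ℂ τ n} (proj₁ (proj₂ (isTheta ε ε′ 0ℂ τ)) n))
        (exp-cong {exponent π ε ε′ 0ℂ τ n} {ιℂ (+ L.sq n) *ℂ α +ℂ ιℂ (k ℤ.* L.point n) *ℂ β}
          (theta-exponent {↑ ((2 // 1) * π)} {𝕚} {↑ (1 // 2)} {point τ} {↑ (fromℤ n + ε * (1 // 2))} {↑ (ε′ * (1 // 2))} {s}
            {fromℤ n + ε * (1 // 2)} {ε′ * (1 // 2)} {L.point n} {k} {+ L.sq n}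
            (proj₁ (proj₂ (proj₂ (proj₂ tenth))) n (1 ℕ.+ 2 ℕ.* h)) (refl , refl) ε′≈ (refl , refl) (∣i∣*∣i∣≡i*i (L.point n))))

      odd-fifths : ∀ k → (k // 5) * (1 // 2) ≈ ι (+ k) * s
      odd-fifths = proj₁ (proj₂ (proj₂ (proj₂ (proj₂ tenth))))

    identity : θ[ ε ⨾ 1 // 5 ] τ ^ 5 -ℂ θ[ ε ⨾ 3 // 5 ] τ ^ 5 +ℂ θ[ ε ⨾ 1 // 1 ] τ ^ 5 -ℂ θ[ ε ⨾ 7 // 5 ] τ ^ 5 +ℂ θ[ ε ⨾ 9 // 5 ] τ ^ 5 ≈ℂ 0ℂ
    identity = alternating-fifth-powers h p≤10 α β
      (T.E10 isPi (2//1≈2 π) 0<1//2 0<s 10s≈1) (T.roots isPi (2//1≈2 π) 0<1//2 0<s 10s≈1) (T.E-unit isPi (2//1≈2 π) 0<1//2 0<s 10s≈1)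
      (decay-bound (T.0<rate isPi (2//1≈2 π) 0<1//2 0<s 10s≈1 {point τ} (positive τ)))
      (T.α-decay isPi (2//1≈2 π) 0<1//2 0<s 10s≈1 {point τ} (positive τ))
      (box-remainder-null (T.0<rate isPi (2//1≈2 π) 0<1//2 0<s 10s≈1 {point τ} (positive τ)))
      {e (1 // 5)} {e (3 // 5)} {e (1 // 1)} {e (7 // 5)} {e (9 // 5)}
      {θ[ ε ⨾ 1 // 5 ] τ} {θ[ ε ⨾ 3 // 5 ] τ} {θ[ ε ⨾ 1 // 1 ] τ} {θ[ ε ⨾ 7 // 5 ] τ} {θ[ ε ⨾ 9 // 5 ] τ}
      (θ-terms (+ 1) (1 // 5) (odd-fifths 1)) (θ-terms (+ 3) (3 // 5) (odd-fifths 3))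
      (θ-terms (+ 5) (1 // 1) (proj₂ (proj₂ (proj₂ (proj₂ (proj₂ tenth))))))
      (θ-terms (+ 7) (7 // 5) (odd-fifths 7)) (θ-terms (+ 9) (9 // 5) (odd-fifths 9))
      (θ-limit (1 // 5)) (θ-limit (3 // 5)) (θ-limit (1 // 1)) (θ-limit (7 // 5)) (θ-limit (9 // 5))

theorem3p1 : ∀ {c ℓ₁ ℓ₂ ℓ₃} (R : RealNumbers c ℓ₁ ℓ₂ ℓ₃) → let open Theta R in
    (π : ℝ) → IsPi π →
    ThetaFunction π ×
    ((Θ : ThetaFunction π) → let open ThetaFunction Θ in
    (τ : ℍ²) →
    (  θ[ 1 // 5 ⨾ 1 // 5 ] τ ^ 5
    -ℂ θ[ 1 // 5 ⨾ 3 // 5 ] τ ^ 5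
    +ℂ θ[ 1 // 5 ⨾ 1 // 1 ] τ ^ 5
    -ℂ θ[ 1 // 5 ⨾ 7 // 5 ] τ ^ 5
    +ℂ θ[ 1 // 5 ⨾ 9 // 5 ] τ ^ 5 ≈ℂ 0ℂ)
    ×
    (  θ[ 3 // 5 ⨾ 1 // 5 ] τ ^ 5
    -ℂ θ[ 3 // 5 ⨾ 3 // 5 ] τ ^ 5
    +ℂ θ[ 3 // 5 ⨾ 1 // 1 ] τ ^ 5
    -ℂ θ[ 3 // 5 ⨾ 7 // 5 ] τ ^ 5
    +ℂ θ[ 3 // 5 ⨾ 9 // 5 ] τ ^ 5 ≈ℂ 0ℂ))
theorem3p1 R π isPi = ThetaSeries.thetaFunction R (proj₁ isPi) , λ Θ τ →
  -- h = 0 gives ε = 1/5 and h = 1 gives ε = 3/5.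
  ThetaIdentity.identity R isPi Θ τ 0 (ℕₚ.m≤m+n 1 9) , ThetaIdentity.identity R isPi Θ τ 1 (ℕₚ.m≤m+n 3 7)
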